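{- Let $k\in\mathbb Z_{>0}$ and $m_1,m_2\in\mathbb Z$. Then $$\Sigma(2^k,2^k;m_1,m_2)=2^k\delta_{2|k}\sum_{i=0}^{k-1}\big(g_1(2^2,m_1,2^{k-i})+(-1)^{i+1}g_{ -1}(2^2,m_1,2^{k-i})\big)\big(g_1(2^2,m_2,2^{i+1})+(-1)^ig_{ -1}(2^2,m_2,2^{i+1})\big).$$
   Context: $\delta_P$ is $1$ if the statement $P$ holds and $0$ otherwise. $(\frac{\cdot}{\cdot})$ is the Kronecker symbol; for nonzero reals $(x,y)_{\mathbb R}=-1$ if $x,y<0$ and $1$ otherwise. For $\epsilon=\pm1$ and $n\ge2$, $g_\epsilon(2^2,m,2^n)=\sum_{x\in(\mathbb Z/2^n\mathbb Z)^\times,\ x\equiv\epsilon\,(\mathrm{mod}\,4)}e^{2\pi i mx/2^n}$. For $n=1$ (where the residue mod $4$ is not defined) the convention is $g_\epsilon(2^2,m,2)=\tfrac12g_\epsilon(2^2,2m,4)=\tfrac12(-1)^m$, so that $g_1(2^2,m,2)+g_{ -1}(2^2,m,2)=\sum_{x\in(\mathbb Z/2)^\times}e^{\pi imx}=(-1)^m$. $\Gamma=\Gamma_1(4)$ is the group of $\gamma\in\mathrm{SL}(3,\mathbb Z)$ congruent mod $4$ to an upper triangular unipotent matrix, and $\Gamma_\infty$ is the group of upper triangular unipotent matrices in $\mathrm{SL}(3,\mathbb Z)$. The Plücker coordinates of a matrix with second row $(d,e,f)$ and third row $(g,h,i)$ are $(-g,-h,-i,-(dh-eg),di-fg,-(ei-fh))$;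 for $\gamma\in\Gamma$ they are written $(4A_1,4B_1,C_1,4A_2,4B_2,C_2)$ with integers $A_i,B_i,C_i$ (they satisfy $A_1C_2+4B_1B_2+C_1A_2=0$, $\gcd(A_i,B_i,C_i)=1$, $C_i\equiv-1$ mod $4$, and such tuples parametrize $\Gamma_\infty\backslash\Gamma$). Splitting: $s:\Gamma\to\{\pm1\}$ is the function such that $\gamma\mapsto(\gamma,s(\gamma))$ is Miller's splitting homomorphism of $\Gamma$ into the double cover of $\mathrm{SL}(3,\mathbb R)$; it is left and right $\Gamma_\infty$-invariant and for $A_1,A_2\neq0$ it is determined as follows. If $A_1>0$ and $A_2/D$ is odd, with $D=\gcd(A_1,A_2)$, $D_1=\gcd(D,B_1)$, $D_2=D/D_1$, $\epsilon=(\frac{ -1}{B_1/D_1})$, then $$s(\gamma)=\Big(\tfrac{\epsilon}{ -A_1A_2}\Big)\Big(\tfrac{A_1/D}{A_2/D}\Big)\Big(\tfrac{B_1/D_1}{A_1/D}\Big)\Big(\tfrac{4B_2/D_2}{|A_2|/D}\Big)\Big(\tfrac{D_1}{C_1}\Big)\Big(\tfrac{D_2}{C_2}\Big);$$ the remaining cases follow from $s(S_3\gamma S_3)=s(\gamma)$ with $S_3=\mathrm{diag}(1,1,-1)$, and $s(w_\ell{}^\intercal\gamma^{ -1}w_\ell^{ -1})=(-A_1,-A_2)_{\mathbb R}s(\gamma)$ with $w_\ell=\begin{pmatrix}0&0&1\\0&-1&0\\1&0&0\end{pmatrix}$. Exponential sums: for nonzero integers $A_1,A_2$, $\mathbb S(A_1,A_2)$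 is the set of $\gamma\in\Gamma$ with Plücker coordinates $(4A_1,*,*,4A_2,*,*)$, and $\Sigma(A_1,A_2;m_1,m_2)=\sum_{\gamma\in\Gamma_\infty\backslash\mathbb S(A_1,A_2)/\Gamma_\infty}s(\gamma)e^{2\pi i(m_1\frac{B_1}{A_1}+m_2\frac{B_2}{A_2})}$ for $m_1,m_2\in\mathbb Z$. -}

module Defs where

open import Algebra.Bundles using (CommutativeRing; Semiring)
open import Algebra.Morphism.Structures using (module MonoidMorphisms)
import Algebra.Definitions.RawSemiring as RawSemiringDefs
open import Data.Bool.Base using (if_then_else_)
open import Data.Fin.Base using (toℕ)
open import Data.Fin.Properties using (any?)
open import Data.Integer.Base as ℤ using (ℤ; +_; -[1+_]; 0ℤ; 1ℤ; -1ℤ; _+_; _-_; _*_; -_; ∣_∣)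
open import Data.Integer.Properties using (_<?_)
open import Data.Integer.DivMod using (_/ℕ_; _%ℕ_)
open import Data.Integer.Divisibility.Signed using (_∣_; _∣?_)
open import Data.List.Base using (List; foldr; map; filter; upTo)
open import Data.List.Relation.Unary.All using (All)
open import Data.List.Relation.Unary.AllPairs using (AllPairs)
open import Data.List.Relation.Unary.Any using (Any)
open import Data.Nat.Base as ℕ using (ℕ; zero; suc)
open import Data.Nat.Coprimality using (coprime?)
open import Data.Nat.GCD using (gcd)
open import Data.Nat.Primality.Factorisation using (factorise; factors)
import Data.Nat.Properties as ℕₚ
open import Data.Product.Base using (_×_; ∃)
open import Data.Rational.Unnormalised.Base as ℚᵘ using (ℚᵘ)
open import Level using (Level; _⊔_) renaming (suc to lsuc)
open import Relation.Binary.Core using (Rel)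
open import Relation.Binary.PropositionalEquality.Core using (_≡_)
open import Relation.Nullary.Decidable.Core using (Dec; does; yes; no; _×-dec_)
open import Relation.Nullary.Negation.Core using (¬_)
open import Relation.Unary using (Pred)

-- Floor division with x ÷ 0 = 0.  Below it is only evaluated where the
-- quotient is exact and the divisor is nonzero.
infixl 7 _÷_
_÷_ : ℤ → ℕ → ℤ
x ÷ zero      = 0ℤ
x ÷ n@(suc _) = x /ℕ n

infix 4 _≡_mod4
_≡_mod4 : ℤ → ℤ → Set
x ≡ y mod4 = + 4 ∣ x - y

------------------------------------------------------------------------
-- Symbols

legendre : ℤ → ℕ → ℤ
legendre a p with + p ∣? a
... | yes _ = 0ℤ
... | no  _ with any? {n = p} (λ x → + p ∣? + toℕ x * + toℕ x - a)
...   | yes _ = 1ℤ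
...   | no  _ = -1ℤ

-- (a / 2)
kronecker₂ : ℤ → ℤ
kronecker₂ a with a %ℕ 8
... | 1 = 1ℤ
... | 3 = -1ℤ
... | 5 = -1ℤ
... | 7 = 1ℤ
... | _ = 0ℤ

-- (a / p) for a prime p
kroneckerₚ : ℤ → ℕ → ℤ
kroneckerₚ a 2 = kronecker₂ a
kroneckerₚ a p = legendre a p

-- (a / -1)
kronecker₋₁ : ℤ → ℤ
kronecker₋₁ (+ _)    = 1ℤ
kronecker₋₁ -[1+ _ ] = -1ℤ

-- (a / n) for n > 0
kronecker⁺ : ℤ → (n : ℕ) → .{{ℕ.NonZero n}} → ℤ
kronecker⁺ a n = foldr _*_ 1ℤ (map (kroneckerₚ a) (factors (factorise n)))

kronecker : ℤ → ℤ → ℤ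
kronecker a (+ zero)      = if does (∣ a ∣ ℕₚ.≟ 1) then 1ℤ else 0ℤ
kronecker a (+ n@(suc _)) = kronecker⁺ a n
kronecker a -[1+ n ]      = kronecker₋₁ a * kronecker⁺ a (suc n)

hilbertℝ : ℤ → ℤ → ℤ
hilbertℝ -[1+ _ ] -[1+ _ ] = -1ℤ
hilbertℝ _        _        = 1ℤ

------------------------------------------------------------------------
-- 3 × 3 matrices

-- The entries in reading order.
record Mat : Set where
  constructor mat
  field
    a b c d e f g h i : ℤ

infixl 7 _∙_
_∙_ : Mat → Mat → Mat
mat a b c d e f g h i ∙ mat a′ b′ c′ d′ e′ f′ g′ h′ i′ = mat
  (a * a′ + b * d′ + c * g′) (a * b′ + b * e′ + c * h′) (a * c′ + b * f′ + c * i′)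
  (d * a′ + e * d′ + f * g′) (d * b′ + e * e′ + f * h′) (d * c′ + e * f′ + f * i′)
  (g * a′ + h * d′ + i * g′) (g * b′ + h * e′ + i * h′) (g * c′ + h * f′ + i * i′)

det : Mat → ℤ
det (mat a b c d e f g h i) =
  a * (e * i - f * h) - b * (d * i - f * g) + c * (d * h - e * g)

transpose : Mat → Mat
transpose (mat a b c d e f g h i) = mat
  a d g
  b e h
  c f i

-- The adjugate, which is the inverse when the determinant is 1.
_⁻¹ : Mat → Mat
mat a b c d e f g h i ⁻¹ = mat
  (e * i - f * h)     (- (b * i - c * h)) (b * f - c * e)
  (- (d * i - f * g)) (a * i - c * g)     (- (a * f - c * d))
  (d * h - e * g)     (- (a * h - b * g)) (a * e - b * d)

S₃ wₗ : Mat
S₃ = mat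
  1ℤ 0ℤ 0ℤ
  0ℤ 1ℤ 0ℤ
  0ℤ 0ℤ -1ℤ
wₗ = mat
  0ℤ 0ℤ  1ℤ
  0ℤ -1ℤ 0ℤ
  1ℤ 0ℤ  0ℤ

UpperUnipotent : Rel ℤ Level.zero → Pred Mat Level.zero
UpperUnipotent _∼_ (mat a b c d e f g h i) =
  (a ∼ 1ℤ × e ∼ 1ℤ × i ∼ 1ℤ) × (d ∼ 0ℤ × g ∼ 0ℤ × h ∼ 0ℤ)

Γ∞ : Pred Mat Level.zero
Γ∞ = UpperUnipotent _≡_

-- Γ₁(4)
Γ : Pred Mat Level.zero
Γ γ = det γ ≡ 1ℤ × UpperUnipotent _≡_mod4 γ

-- The Plücker coordinates of γ are (4A₁, 4B₁, C₁, 4A₂, 4B₂, C₂); the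
-- divisions by 4 are exact for γ in Γ.
A₁ B₁ C₁ A₂ B₂ C₂ : Mat → ℤ
A₁ (mat _ _ _ d e f g h i) = (- g) ÷ 4
B₁ (mat _ _ _ d e f g h i) = (- h) ÷ 4
C₁ (mat _ _ _ d e f g h i) = - i
A₂ (mat _ _ _ d e f g h i) = (- (d * h - e * g)) ÷ 4
B₂ (mat _ _ _ d e f g h i) = (d * i - f * g) ÷ 4
C₂ (mat _ _ _ d e f g h i) = - (e * i - f * h)

------------------------------------------------------------------------
-- The splitting

-- gcd (A₁ γ) (A₂ γ)
D : Mat → ℕ
D γ = gcd ∣ A₁ γ ∣ ∣ A₂ γ ∣

-- The explicit formula, for A₁ > 0 and A₂ / D odd.
s-formula : Mat → ℤ
s-formula γ =
    kronecker ε (- (A₁ γ * A₂ γ))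
  * kronecker (A₁ γ ÷ D γ) (A₂ γ ÷ D γ)
  * kronecker (B₁ γ ÷ D₁) (A₁ γ ÷ D γ)
  * kronecker ((+ 4 * B₂ γ) ÷ D₂) (+ ∣ A₂ γ ∣ ÷ D γ)
  * kronecker (+ D₁) (C₁ γ)
  * kronecker (+ D₂) (C₂ γ)
  where
  D₁ D₂ : ℕ
  D₁ = gcd (D γ) ∣ B₁ γ ∣
  D₂ = ∣ + D γ ÷ D₁ ∣
  ε : ℤ
  ε = kronecker -1ℤ (B₁ γ ÷ D₁)

-- The case of A₂ / D odd, using s (S₃γS₃) = s γ; S₃γS₃ has first coordinate -A₁.
s-odd : Mat → ℤ
s-odd γ = if does (0ℤ <? A₁ γ) then s-formula γ else s-formula (S₃ ∙ γ ∙ S₃)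

-- Defined for γ in Γ with A₁, A₂ ≠ 0.  The involution γ ↦ wₗ ᵀγ⁻¹ wₗ⁻¹
-- exchanges A₁ and A₂, and A₁ / D, A₂ / D are not both even.
s : Mat → ℤ
s γ = if does (+ 2 ∣? A₂ γ ÷ D γ)
  then hilbertℝ (- A₁ γ) (- A₂ γ) * s-odd (wₗ ∙ transpose (γ ⁻¹) ∙ wₗ ⁻¹)
  else s-odd γ

------------------------------------------------------------------------
-- Double cosets

𝕊 : ℤ → ℤ → Pred Mat Level.zero
𝕊 a₁ a₂ γ = Γ γ × A₁ γ ≡ a₁ × A₂ γ ≡ a₂

SameDoubleCoset : Rel Mat Level.zero
SameDoubleCoset γ δ = ∃ λ u → ∃ λ v → Γ∞ u × Γ∞ v × u ∙ γ ∙ v ≡ δ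

-- The list contains exactly one element of each class in Γ∞ \ 𝕊 / Γ∞.
record Representatives (a₁ a₂ : ℤ) (γs : List Mat) : Set where
  field
    sound    : All (𝕊 a₁ a₂) γs
    complete : (γ : Mat) → 𝕊 a₁ a₂ γ → Any (SameDoubleCoset γ) γs
    distinct : AllPairs (λ γ δ → ¬ SameDoubleCoset γ δ) γs

------------------------------------------------------------------------
-- Exponential sums

-- The properties of ℂ and e(x) = exp(2πix), x rational, in terms of
-- which the sums are evaluated.  The complex numbers are an instance.
-- Conversely, the axioms force e(1/2ⁿ) to be a root of X^(2ⁿ⁻¹) + 1, the
-- minimal polynomial of exp(2πi/2ⁿ) over ℚ, so an identity between
-- ℤ[1/2]-linear combinations of values of e at dyadic rationals holds in
-- every instance if and only if it holds in ℂ.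
record ExponentialRing (c ℓ : Level) : Set (lsuc (c ⊔ ℓ)) where
  field
    commutativeRing : CommutativeRing c ℓ
  open CommutativeRing commutativeRing public
    using (Carrier; _≈_; 0#; 1#; semiring; *-rawMonoid)
    renaming (_+_ to infixl 6 _⊕_; _*_ to infixl 7 _⊛_; -_ to infix 8 ⊖_)
  field
    ½ : Carrier
    ½⊕½≈1 : ½ ⊕ ½ ≈ 1#
    e : ℚᵘ → Carrier
    e-isMonoidHomomorphism :
      MonoidMorphisms.IsMonoidHomomorphism ℚᵘ.+-0-rawMonoid *-rawMonoid e
    e[½]≈-1 : e ℚᵘ.½ ≈ ⊖ 1#

module ExponentialSums {c ℓ : Level} (E : ExponentialRing c ℓ) where
  open ExponentialRing E public
    using (Carrier; _≈_; 0#; 1#; _⊕_; _⊛_; ⊖_; ½; e)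
  open RawSemiringDefs (Semiring.rawSemiring (ExponentialRing.semiring E)) public
    using (_^_)
    renaming (_×_ to infixr 8 _·_)

  ∑ : {A : Set} → List A → (A → Carrier) → Carrier
  ∑ xs t = foldr (λ x r → t x ⊕ r) 0# xs

  infixl 6 ∑
  syntax ∑ xs (λ x → t) = ∑[ x ∈ xs ] t

  fromℤ : ℤ → Carrier
  fromℤ (+ n)    = n · 1#
  fromℤ -[1+ n ] = ⊖ (suc n · 1#)

  δ : {P : Set} → Dec P → Carrier
  δ P? = if does P? then 1# else 0#

  -- The representatives in [0 , 2ⁿ) of the units of ℤ/2ⁿ congruent to ε
  -- mod 4, for n ≥ 2.
  units : ℤ → ℕ → List ℕ
  units ε n = filter (λ x → coprime? x (2 ℕ.^ n) ×-dec + 4 ∣? (+ x - ε)) (upTo (2 ℕ.^ n))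

  g-≥2 : ℤ → ℤ → ℕ → Carrier
  g-≥2 ε m n = ∑[ x ∈ units ε n ] e (((m * + x) ℚᵘ./ (2 ℕ.^ n)) {{ℕₚ.m^n≢0 2 n}})

  -- g_ε(2², m, 2ⁿ) for ε = ±1 and n ≥ 1.  Residues mod 4 are not defined on
  -- ℤ/2, so the value at n = 1 is a convention.
  g : ℤ → ℤ → ℕ → Carrier
  g ε m 1 = ½ ⊛ g-≥2 ε (+ 2 * m) 2
  g ε m n = g-≥2 ε m n

  _//_ : ℤ → (a : ℤ) → .{{ℤ.NonZero a}} → ℚᵘ
  b // a = (b ℚᵘ./ 1) ℚᵘ.÷ (a ℚᵘ./ 1)

  Σ-over : List Mat → (a₁ a₂ : ℤ) → .{{ℤ.NonZero a₁}} → .{{ℤ.NonZero a₂}} →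
           ℤ → ℤ → Carrier
  Σ-over γs a₁ a₂ m₁ m₂ =
    ∑[ γ ∈ γs ] fromℤ (s γ) ⊛ e (((m₁ ℚᵘ./ 1) ℚᵘ.* (B₁ γ // a₁)) ℚᵘ.+ ((m₂ ℚᵘ./ 1) ℚᵘ.* (B₂ γ // a₂)))

  -- Σ(a₁, a₂; m₁, m₂) = z: there are finitely many double cosets, and the
  -- sum over them is z for every choice of representatives.
  Σ⟨_,_⨾_,_⟩≈_ : (a₁ a₂ : ℤ) → .{{ℤ.NonZero a₁}} → .{{ℤ.NonZero a₂}} →
                 ℤ → ℤ → Carrier → Set ℓ
  Σ⟨ a₁ , a₂ ⨾ m₁ , m₂ ⟩≈ z =
    ∃ (Representatives a₁ a₂) ×
    ((γs : List Mat) → Representatives a₁ a₂ γs → Σ-over γs a₁ a₂ m₁ m₂ ≈ z)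

{-# OPTIONS --safe #-}

-- For A₁ = A₂ = 2ᵏ the Plücker relation reads 2ᵏ (C₁ + C₂) = -4 B₁ B₂ with
-- C₁ , C₂ ≡ -1 mod 4, so B₁ B₂ has valuation k - 1.  Write B₁ = 2ⁱ (1 + 2 a₁),
-- B₂ = 2ʲ (1 + 2 a₂) with i + j + 1 = k, and C₁ = 4 c₁ - 1, C₂ = 4 c₂ - 1; then
-- c₂ ≡ c₁ + a₁ + a₂ mod 2.  As D₁ = 2ⁱ and D₂ = 2ʲ⁺¹, the formula for s reduces to
-- (-1 / (1 + 2 a₁)) (2 / C₁)ⁱ (2 / C₂)ʲ⁺¹ = (-1)^(a₁ + i c₁ + (j + 1) c₂) by the
-- supplementary laws of quadratic reciprocity.  The double cosets correspond to
-- B₁ , B₂ mod 2ᵏ and C₁ mod 2ᵏ⁺².  The sum over C₁ vanishes for odd k; for even k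
-- the sign is (-1)^((i + 1) a₁ + i a₂) and the sum factors.

module Submission where

open import Level using (Level)
open import Data.Integer.Base using (ℤ; +_; 1ℤ; -1ℤ)
open import Data.List.Base using (upTo)
open import Data.Nat.Base using (ℕ; suc; _∸_; NonZero) renaming (_^_ to _^ℕ_)
open import Data.Nat.Divisibility using (_∣?_)
open import Data.Nat.Properties using (m^n≢0)
open import Defs

open import Algebra.Bundles using (AbelianGroup; CommutativeRing)
open import Algebra.Morphism.Structures using (module MonoidMorphisms)
import Algebra.Properties.CommutativeSemigroup as CommutativeSemigroupProperties
import Algebra.Properties.Ring as RingProperties
open import Data.Bool.Base using (if_then_else_; true; false)
open import Data.Empty using (⊥)
open import Data.Fin.Base using (toℕ; fromℕ<)
open import Data.Fin.Properties using (any?; toℕ-fromℕ<; toℕ<n)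
open import Data.Integer.Base as ℤ using (-[1+_]; 0ℤ; _+_; _-_; _*_; -_; ∣_∣) renaming (_^_ to _^ℤ_)
open import Data.Integer.DivMod using (_%ℕ_; _/ℕ_; n%ℕd<d; a≡a%ℕn+[a/ℕn]*n)
open import Data.Integer.Divisibility.Signed using (_∣_; divides; ∣ᵤ⇒∣; ∣⇒∣ᵤ) renaming (_∣?_ to _∣ℤ?_)
import Data.Integer.Properties as ℤₚ
open import Data.Integer.Tactic.RingSolver using (solve-∀)
open import Data.List.Base using (List; []; _∷_; _++_; length; map; foldr; concatMap; cartesianProduct; filter)
open import Data.List.Membership.Propositional using (_∈_; find; lose)
open import Data.List.Membership.Propositional.Properties using (∈-∃++; ∈-map⁺; ∈-map⁻; ∈-upTo⁺; ∈-upTo⁻; ∈-concatMap⁺; ∈-concatMap⁻; ∈-cartesianProduct⁺; ∈-cartesianProduct⁻)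
open import Data.List.Membership.Propositional.Properties.WithK using (unique∧set⇒bag)
open import Data.List.Properties using (length-map; length-upTo; upTo-∷ʳ)
open import Data.List.Relation.Binary.BagAndSetEquality using (∼bag⇒↭)
open import Data.List.Relation.Binary.Permutation.Propositional as ↭ using (_↭_; ↭-reflexive; ↭-trans; ↭-sym; ↭⇒↭ₛ)
open import Data.List.Relation.Binary.Permutation.Propositional.Properties using (∈-resp-↭; ↭-length; shift)
import Data.List.Relation.Binary.Permutation.Setoid.Properties as Permₛ
open import Data.List.Relation.Binary.Pointwise using (Pointwise; []; _∷_)
open import Data.List.Relation.Unary.All as All using (All; []; _∷_)
import Data.List.Relation.Unary.All.Properties as Allₚ
open import Data.List.Relation.Unary.AllPairs as AllPairs using (AllPairs; []; _∷_)
import Data.List.Relation.Unary.AllPairs.Properties as AllPairsₚ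
open import Data.List.Relation.Unary.Any using (here; there)
open import Data.List.Relation.Unary.Unique.Propositional using (Unique)
import Data.List.Relation.Unary.Unique.Propositional.Properties as Unique
open import Data.Nat.Base as ℕ using (zero; s≤s; z≤n)
open import Data.Nat.Coprimality as Coprime using (Coprime; coprime?; coprime-Bézout; coprime-divisor; coprime⇒gcd≡1; prime⇒coprime)
import Data.Nat.Divisibility as ℕ∣
open import Data.Nat.DivMod using (m≡m%n+[m/n]*n; m%n<n; _%_; _/_)
open import Data.Nat.GCD using (gcd; c*gcd[m,n]≡gcd[cm,cn]; module Bézout)
open import Data.Nat.ListAction using (product)
open import Data.Nat.ListAction.Properties using (product-↭)
open import Data.Nat.Primality using (Prime; euclidsLemma; irreducible[2]; prime⇒nonZero; prime⇒nonTrivial)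
open import Data.Nat.Primality.Factorisation using (factorise; factors; PrimeFactorisation)
import Data.Nat.Properties as ℕₚ
open import Data.Product.Base using (_×_; _,_; ∃; ∃₂; proj₁; proj₂)
open import Data.Rational.Unnormalised.Base as ℚᵘ using (ℚᵘ; *≡*)
open import Data.Sum.Base using (_⊎_; inj₁; inj₂)
open import Function.Base using (_∘_)
open import Function.Bundles using (mk⇔)
open import Relation.Binary.PropositionalEquality as ≡ using (_≡_; _≢_; refl; sym; trans; cong; cong₂; subst; subst₂; setoid; module ≡-Reasoning)
open import Relation.Nullary using (¬_; Dec; does; yes; no; contradiction)
open import Relation.Nullary.Decidable using (dec-true; dec-false; _×-dec_)
open import Relation.Unary using (Decidable)

open import Algebra.Properties.Group (AbelianGroup.group ℤₚ.+-0-abelianGroup) using () renaming (∙-cancelˡ to +-cancelˡ; ∙-cancelʳ to +-cancelʳ)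
open PrimeFactorisation using (isFactorisation; factorsPrime)

-- Parity and signs

-- Legendre symbols are defined by a search for a square root, so their values have to be derived
-- from Euler's criterion. Only the numerators -1 and 2ⁱ matter, since ε is a sign, D₁ and D₂ divide
-- 2ᵏ, and A₁ / D = A₂ / D = 1. The sum must be the same for every list of representatives, and such
-- a list must exist. Both follow from a complete invariant of double cosets: i, a₁ mod 2ʲ, a₂ mod
-- 2ⁱ and a corrected c₁ mod 2ᵏ. C₂ is absent because the Plücker relation can be divided by A₁ =
-- A₂; c₁ is corrected because reducing B₂ moves C₁. Each value of the invariant is realised by a
-- matrix built from an explicit inverse of 1 - 4 c modulo a power of 2. The sign comes out in terms
-- of unreduced parameters. Passing to residues is harmless because 2ⁱ i and 2ʲ j are always even,
-- also for i = 0 or j = 0. At i = 0 and at i = k - 1 a sum g of modulus 2 occurs. Its two halves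
-- add up to the full sum only if the sign in front of g₋₁ is +, and for even k it is.

data Parity : ℤ → Set where
  even : ∀ w → Parity (+ 2 * w)
  odd  : ∀ w → Parity (1ℤ + + 2 * w)

parity : ∀ z → Parity z
parity z = go (z %ℕ 2) (n%ℕd<d z 2) (a≡a%ℕn+[a/ℕn]*n z 2)
  where
  go : ∀ r → r ℕ.< 2 → z ≡ + r + (z /ℕ 2) * + 2 → Parity z
  go 0 _ eq = subst Parity (sym (trans eq (lem (z /ℕ 2)))) (even (z /ℕ 2))
    where
    lem : ∀ w → 0ℤ + w * + 2 ≡ + 2 * w
    lem = solve-∀
  go 1 _ eq = subst Parity (sym (trans eq (lem (z /ℕ 2)))) (odd (z /ℕ 2))
    where
    lem : ∀ w → 1ℤ + w * + 2 ≡ 1ℤ + + 2 * w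
    lem = solve-∀
  go (suc (suc r)) (s≤s (s≤s ())) _

-- The character (-1)^z of ℤ; the absolute value provides a natural exponent of the same parity.
sgn : ℤ → ℤ
sgn z = -1ℤ ^ℤ ∣ z ∣

-1^[2*n]≡1 : ∀ n → -1ℤ ^ℤ (2 ℕ.* n) ≡ 1ℤ
-1^[2*n]≡1 n = trans (sym (ℤₚ.^-*-assoc -1ℤ 2 n)) (ℤₚ.^-zeroˡ n)

sgn-even : ∀ w → sgn (+ 2 * w) ≡ 1ℤ
sgn-even w = trans (cong (-1ℤ ^ℤ_) (ℤₚ.∣i*j∣≡∣i∣*∣j∣ (+ 2) w)) (-1^[2*n]≡1 ∣ w ∣)

sgn-odd : ∀ w → sgn (1ℤ + + 2 * w) ≡ -1ℤ
sgn-odd (+ n) = trans (cong (λ m → sgn (1ℤ + m)) (sym (ℤₚ.pos-* 2 n))) (cong (-1ℤ *_) (-1^[2*n]≡1 n))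
sgn-odd -[1+ n ] = begin
  sgn (1ℤ + + 2 * -[1+ n ])  ≡⟨ cong (-1ℤ ^ℤ_) (sym (ℤₚ.∣-i∣≡∣i∣ (1ℤ + + 2 * -[1+ n ]))) ⟩
  sgn (- (1ℤ + + 2 * -[1+ n ])) ≡⟨ cong sgn (lem (+ n)) ⟩
  sgn (1ℤ + + 2 * + n)          ≡⟨ sgn-odd (+ n) ⟩
  -1ℤ                           ∎
  where
  open ≡-Reasoning
  lem : ∀ n → - (1ℤ + + 2 * (- (1ℤ + n))) ≡ 1ℤ + + 2 * n
  lem = solve-∀

sgn-+ : ∀ x y → sgn (x + y) ≡ sgn x * sgn y
sgn-+ x y with parity x | parity y
... | even v | even w rewrite sgn-even v | sgn-even w = trans (cong sgn (lem v w)) (sgn-even (v + w))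
  where
  lem : ∀ v w → + 2 * v + + 2 * w ≡ + 2 * (v + w)
  lem = solve-∀
... | even v | odd w rewrite sgn-even v | sgn-odd w = trans (cong sgn (lem v w)) (sgn-odd (v + w))
  where
  lem : ∀ v w → + 2 * v + (1ℤ + + 2 * w) ≡ 1ℤ + + 2 * (v + w)
  lem = solve-∀
... | odd v | even w rewrite sgn-odd v | sgn-even w = trans (cong sgn (lem v w)) (sgn-odd (v + w))
  where
  lem : ∀ v w → 1ℤ + + 2 * v + + 2 * w ≡ 1ℤ + + 2 * (v + w)
  lem = solve-∀
... | odd v | odd w rewrite sgn-odd v | sgn-odd w = trans (cong sgn (lem v w)) (sgn-even (1ℤ + (v + w)))
  where
  lem : ∀ v w → (1ℤ + + 2 * v) + (1ℤ + + 2 * w) ≡ + 2 * (1ℤ + (v + w))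
  lem = solve-∀

sgn-+2* : ∀ x w → sgn (x + + 2 * w) ≡ sgn x
sgn-+2* x w = trans (sgn-+ x (+ 2 * w)) (trans (cong (sgn x *_) (sgn-even w)) (ℤₚ.*-identityʳ (sgn x)))

sgn-*ℕ : ∀ n x → sgn (+ n * x) ≡ sgn x ^ℤ n
sgn-*ℕ zero    x = cong sgn (ℤₚ.*-zeroˡ x)
sgn-*ℕ (suc n) x = begin
  sgn (+ suc n * x)        ≡⟨ cong sgn (lem (+ n) x) ⟩
  sgn (x + + n * x)        ≡⟨ sgn-+ x (+ n * x) ⟩
  sgn x * sgn (+ n * x)    ≡⟨ cong (sgn x *_) (sgn-*ℕ n x) ⟩
  sgn x * sgn x ^ℤ n        ∎
  where
  open ≡-Reasoning
  lem : ∀ n x → (1ℤ + n) * x ≡ x + n * x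
  lem = solve-∀

sgn≡±1 : ∀ z → sgn z ≡ 1ℤ ⊎ sgn z ≡ -1ℤ
sgn≡±1 z with parity z
... | even w = inj₁ (sgn-even w)
... | odd w  = inj₂ (sgn-odd w)

-- Congruences

infix 4 _≡_[mod_]
-- A record instead of a synonym for `+ p ∣ x - y`, so that unification can recover `x` and `y`.
record _≡_[mod_] (x y : ℤ) (p : ℕ) : Set where
  constructor congruent
  field ∣-difference : + p ∣ x - y
open _≡_[mod_] public

pattern multiple q eq = congruent (divides q eq)

module _ {p : ℕ} where
  mod-refl : ∀ {x y} → x ≡ y → x ≡ y [mod p ]
  mod-refl {x} refl = multiple 0ℤ (ℤₚ.+-inverseʳ x)

  mod-sym : ∀ {x y} → x ≡ y [mod p ] → y ≡ x [mod p ]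
  mod-sym {x} {y} (multiple q eq) = multiple (- q) (trans (lem x y) (trans (cong -_ eq) (ℤₚ.neg-distribˡ-* q (+ p))))
    where
    lem : ∀ x y → y - x ≡ - (x - y)
    lem = solve-∀

  mod-trans : ∀ {x y z} → x ≡ y [mod p ] → y ≡ z [mod p ] → x ≡ z [mod p ]
  mod-trans {x} {y} {z} (multiple q eq) (multiple r eq′) =
    multiple (q + r) (trans (lem x y z) (trans (cong₂ _+_ eq eq′) (sym (ℤₚ.*-distribʳ-+ (+ p) q r))))
    where
    lem : ∀ x y z → x - z ≡ (x - y) + (y - z)
    lem = solve-∀

  mod-* : ∀ {x y x′ y′} → x ≡ x′ [mod p ] → y ≡ y′ [mod p ] → x * y ≡ x′ * y′ [mod p ]
  mod-* {x} {y} {x′} {y′} (multiple q eq) (multiple r eq′) =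
    multiple (q * y + x′ * r) (trans (lem x y x′ y′) (trans (cong₂ (λ u v → u * y + x′ * v) eq eq′) (lem′ q y x′ r (+ p))))
    where
    lem : ∀ x y x′ y′ → x * y - x′ * y′ ≡ (x - x′) * y + x′ * (y - y′)
    lem = solve-∀
    lem′ : ∀ q y x′ r p → q * p * y + x′ * (r * p) ≡ (q * y + x′ * r) * p
    lem′ = solve-∀

  mod-neg : ∀ {x y} → x ≡ y [mod p ] → - x ≡ - y [mod p ]
  mod-neg {x} {y} (multiple q eq) = multiple (- q) (trans (lem x y) (trans (cong -_ eq) (ℤₚ.neg-distribˡ-* q (+ p))))
    where
    lem : ∀ x y → - x - - y ≡ - (x - y)
    lem = solve-∀

  mod-^ : ∀ {x y} n → x ≡ y [mod p ] → x ^ℤ n ≡ y ^ℤ n [mod p ]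
  mod-^ zero    x≡y = mod-refl refl
  mod-^ (suc n) x≡y = mod-* x≡y (mod-^ n x≡y)

  mod-∣ : ∀ {x y} → x ≡ y [mod p ] → + p ∣ y → + p ∣ x
  mod-∣ {x} {y} (multiple q eq) (divides r eq′) =
    divides (q + r) (trans (lem x y) (trans (cong₂ _+_ eq eq′) (sym (ℤₚ.*-distribʳ-+ (+ p) q r))))
    where
    lem : ∀ x y → x ≡ (x - y) + y
    lem = solve-∀

residue-≤ : ∀ {p m n} → m ℕ.≤ n → n ℕ.< p → + m ≡ + n [mod p ] → m ≡ n
residue-≤ {p} {m} {n} m≤n n<p p∣m-n with n ℕ.∸ m in eq
... | zero  = ℕₚ.≤-antisym m≤n (ℕₚ.m∸n≡0⇒m≤n eq)
... | suc d = contradiction p∣1+d (ℕ∣.>⇒∤ 1+d<p)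
  where
  p∣1+d : p ℕ∣.∣ suc d
  p∣1+d = subst (p ℕ∣.∣_) (trans (cong ∣_∣ (ℤₚ.m-n≡m⊖n m n)) (trans (ℤₚ.∣⊖∣-≤ m≤n) eq)) (∣⇒∣ᵤ (∣-difference p∣m-n))
  1+d<p : suc d ℕ.< p
  1+d<p = subst (ℕ._< p) eq (ℕₚ.≤-<-trans (ℕₚ.m∸n≤m n m) n<p)

residue-unique : ∀ {p m n} → m ℕ.< p → n ℕ.< p → + m ≡ + n [mod p ] → m ≡ n
residue-unique {p} {m} {n} m<p n<p m≡n with ℕₚ.≤-total m n
... | inj₁ m≤n = residue-≤ m≤n n<p m≡n
... | inj₂ n≤m = sym (residue-≤ n≤m m<p (mod-sym m≡n))

-- Euler's criterion

remove : ∀ {A : Set} {x : A} {xs} → x ∈ xs → ∃ λ ys → xs ↭ x ∷ ys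
remove x∈xs with ys , zs , eq ← ∈-∃++ x∈xs = ys ++ zs , ↭-trans (↭-reflexive eq) (shift _ ys zs)

unique-↭ : ∀ {A : Set} {xs ys : List A} → xs ↭ ys → Unique xs → Unique ys
unique-↭ {A} p = Permₛ.Unique-resp-↭ (setoid A) (↭⇒↭ₛ p)

module _ {p : ℕ} (p-prime : Prime p) where

  private instance
    p≢0 : ℕ.NonZero p
    p≢0 = prime⇒nonZero p-prime

  euclid : ∀ x y → + p ∣ x * y → (+ p ∣ x) ⊎ (+ p ∣ y)
  euclid x y p∣xy with euclidsLemma ∣ x ∣ ∣ y ∣ p-prime (subst (p ℕ∣.∣_) (ℤₚ.∣i*j∣≡∣i∣*∣j∣ x y) (∣⇒∣ᵤ p∣xy))
  ... | inj₁ p∣x = inj₁ (∣ᵤ⇒∣ p∣x)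
  ... | inj₂ p∣y = inj₂ (∣ᵤ⇒∣ p∣y)

  mod-cancelˡ : ∀ {x y z} → ¬ + p ∣ x → x * y ≡ x * z [mod p ] → y ≡ z [mod p ]
  mod-cancelˡ {x} {y} {z} p∤x xy≡xz with euclid x (y - z) (subst (+ p ∣_) (lem x y z) (∣-difference xy≡xz))
    where
    lem : ∀ x y z → x * y - x * z ≡ x * (y - z)
    lem = solve-∀
  ... | inj₁ p∣x   = contradiction p∣x p∤x
  ... | inj₂ p∣y-z = congruent p∣y-z

  small-∤ : ∀ {n} → suc n ℕ.< p → ¬ + p ∣ + suc n
  small-∤ n<p p∣n = ℕ∣.>⇒∤ n<p (∣⇒∣ᵤ p∣n)

  inverse : ∀ {n} → suc n ℕ.< p → ∃ λ u → + suc n * u ≡ 1ℤ [mod p ]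
  inverse {n} n<p with coprime-Bézout (prime⇒coprime p-prime n<p)
  ... | Bézout.+- x y eq = - (+ y) , multiple (- (+ x)) (trans (lem₁ (+ suc n) (+ y)) (trans (cong -_ eqℤ) (lem₂ (+ x) (+ p))))
    where
    eqℤ : 1ℤ + + y * + suc n ≡ + x * + p
    eqℤ = trans (cong (λ w → 1ℤ + w) (sym (ℤₚ.pos-* y (suc n)))) (trans (cong +_ eq) (ℤₚ.pos-* x p))
    lem₁ : ∀ n y → n * (- y) - 1ℤ ≡ - (1ℤ + y * n)
    lem₁ = solve-∀
    lem₂ : ∀ x p → - (x * p) ≡ (- x) * p
    lem₂ = solve-∀
  ... | Bézout.-+ x y eq = + y , multiple (+ x) (trans (cong (_- 1ℤ) (ℤₚ.*-comm (+ suc n) (+ y))) (trans (cong (_- 1ℤ) (sym eqℤ)) (lem (+ x * + p))))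
    where
    eqℤ : 1ℤ + + x * + p ≡ + y * + suc n
    eqℤ = trans (cong (λ w → 1ℤ + w) (sym (ℤₚ.pos-* x p))) (trans (cong +_ eq) (ℤₚ.pos-* y (suc n)))
    lem : ∀ z → 1ℤ + z - 1ℤ ≡ z
    lem = solve-∀

  nonzeroResidues : List ℕ
  nonzeroResidues = map suc (upTo (ℕ.pred p))

  ∈-nonzeroResidues⁺ : ∀ {n} → suc n ℕ.< p → suc n ∈ nonzeroResidues
  ∈-nonzeroResidues⁺ n<p = ∈-map⁺ suc (∈-upTo⁺ (ℕ.s<s⁻¹ (subst (_ ℕ.<_) (sym (ℕₚ.suc-pred p)) n<p)))

  ∈-nonzeroResidues⁻ : ∀ {x} → x ∈ nonzeroResidues → ∃ λ n → x ≡ suc n × suc n ℕ.< p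
  ∈-nonzeroResidues⁻ x∈ with n , n∈ , refl ← ∈-map⁻ suc x∈ = n , refl , subst (suc n ℕ.<_) (ℕₚ.suc-pred p) (s≤s (∈-upTo⁻ n∈))

  nonzeroResidues-unique : Unique nonzeroResidues
  nonzeroResidues-unique = Unique.map⁺ ℕₚ.suc-injective (Unique.upTo⁺ (ℕ.pred p))

  module _ (a : ℤ) (p∤a : ¬ + p ∣ a) where

    -- Dirichlet's pairing of the nonzero residues; its fixed points are the square roots of a.
    Partners : ℕ → ℕ → Set
    Partners x y = + x * + y ≡ a [mod p ]

    partners-sym : ∀ {x y} → Partners x y → Partners y x
    partners-sym {x} {y} = subst (_≡ a [mod p ]) (ℤₚ.*-comm (+ x) (+ y))

    partners-∤ : ∀ {x y} → Partners x y → ¬ + p ∣ + x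
    partners-∤ {x} {y} xy≡a (divides q eq) = p∤a (mod-∣ (mod-sym xy≡a) (divides (q * + y) (trans (cong (_* + y) eq) (lem q (+ p) (+ y)))))
      where
      lem : ∀ q p y → q * p * y ≡ q * y * p
      lem = solve-∀

    partner-unique : ∀ {x y y′} → y ∈ nonzeroResidues → y′ ∈ nonzeroResidues → Partners x y → Partners x y′ → y ≡ y′
    partner-unique {x} {y} {y′} y∈ y′∈ xy≡a xy′≡a
      with _ , refl , y<p ← ∈-nonzeroResidues⁻ y∈ | _ , refl , y′<p ← ∈-nonzeroResidues⁻ y′∈ =
      residue-unique y<p y′<p (mod-cancelˡ (partners-∤ {x} {y} xy≡a) (mod-trans {y = a} xy≡a (mod-sym xy′≡a)))

    -- The partner is the residue of a u, where u is an inverse of x; it is not 0 because p does not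
    -- divide a.
    partner : ∀ {x} → x ∈ nonzeroResidues → ∃ λ y → y ∈ nonzeroResidues × Partners x y
    partner x∈ with n , refl , n<p ← ∈-nonzeroResidues⁻ x∈ with u , xu≡1 ← inverse n<p = lookFor (r%p) refl
      where
      r%p : ℕ
      r%p = (a * u) %ℕ p
      part : Partners (suc n) r%p
      part = mod-trans {y = + suc n * (a * u)} (mod-* {x = + suc n} (mod-refl refl) r≡au) (mod-trans {y = a * 1ℤ} (mod-trans {y = a * (+ suc n * u)} (mod-refl (lem (+ suc n) a u)) (mod-* {x = a} (mod-refl refl) xu≡1)) (mod-refl (ℤₚ.*-identityʳ a)))
        where
        lem : ∀ n a u → n * (a * u) ≡ a * (n * u)
        lem = solve-∀
        lem′ : ∀ r q → r - (r + q) ≡ - q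
        lem′ = solve-∀
        r≡au : + r%p ≡ a * u [mod p ]
        r≡au = multiple (- ((a * u) /ℕ p)) (trans (cong (λ z → + r%p - z) (a≡a%ℕn+[a/ℕn]*n (a * u) p)) (trans (lem′ (+ r%p) (((a * u) /ℕ p) * + p)) (ℤₚ.neg-distribˡ-* ((a * u) /ℕ p) (+ p))))
      lookFor : ∀ r → r ≡ r%p → ∃ λ y → y ∈ nonzeroResidues × Partners (suc n) y
      lookFor zero    eq = contradiction (mod-∣ (mod-sym (subst (Partners (suc n)) (sym eq) part)) (divides 0ℤ (ℤₚ.*-zeroʳ (+ suc n)))) p∤a
      lookFor (suc m) eq = suc m , ∈-nonzeroResidues⁺ (subst (ℕ._< p) (sym eq) (n%ℕd<d (a * u) p)) , subst (Partners (suc n)) (sym eq) part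

    -- The head and its partner contribute one factor a and are removed together. Uniqueness of
    -- partners keeps the rest closed: no remaining element can be matched with either of the two.
    pairing : ∀ m xs → length xs ≡ 2 ℕ.* m → Unique xs → (∀ {x} → x ∈ xs → x ∈ nonzeroResidues) →
              (∀ {x} → x ∈ xs → ∃ λ y → y ∈ xs × Partners x y × x ≢ y) →
              + product xs ≡ a ^ℤ m [mod p ]
    pairing zero    []       _  _ _ _ = mod-refl refl
    pairing zero    (x ∷ xs) () _ _ _
    pairing (suc m) []       () _ _ _
    pairing (suc m) (x ∷ xs) len (x∉xs ∷ xs!) xs⊆ closed with closed (here refl)
    ... | y , here eq , _ , x≢y = contradiction (sym eq) x≢y
    ... | y , there y∈xs , xy≡a , x≢y with zs , xs↭y∷zs ← remove y∈xs with y∉zs ∷ zs! ← unique-↭ xs↭y∷zs xs! =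
      mod-trans (mod-refl prod≡) (mod-* xy≡a (pairing m zs len′ zs! (xs⊆ ∘ there ∘ zs⊆xs) closed′))
      where
      zs⊆xs : ∀ {z} → z ∈ zs → z ∈ xs
      zs⊆xs z∈ = ∈-resp-↭ (↭-sym xs↭y∷zs) (there z∈)
      len′ : length zs ≡ 2 ℕ.* m
      len′ = ℕₚ.suc-injective (ℕₚ.suc-injective (trans (cong suc (sym (↭-length xs↭y∷zs))) (trans len (cong suc (ℕₚ.+-suc m (m ℕ.+ 0))))))
      prod≡ : + product (x ∷ xs) ≡ + x * + y * + product zs
      prod≡ = trans (cong (λ w → + (x ℕ.* w)) (product-↭ xs↭y∷zs))
              (trans (ℤₚ.pos-* x (y ℕ.* product zs)) (trans (cong (+ x *_) (ℤₚ.pos-* y (product zs))) (sym (ℤₚ.*-assoc (+ x) (+ y) (+ product zs)))))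
      closed′ : ∀ {z} → z ∈ zs → ∃ λ w → w ∈ zs × Partners z w × z ≢ w
      closed′ {z} z∈ with closed (there (zs⊆xs z∈))
      ... | w , here refl , zw≡a , z≢w =
            contradiction (partner-unique {w} (xs⊆ (there y∈xs)) (xs⊆ (there (zs⊆xs z∈))) xy≡a (partners-sym {z} {w} zw≡a)) (All.lookup y∉zs z∈)
      ... | w , there w∈xs , zw≡a , z≢w with ∈-resp-↭ xs↭y∷zs w∈xs
      ...   | here refl = contradiction (partner-unique {w} (xs⊆ (here refl)) (xs⊆ (there (zs⊆xs z∈))) (partners-sym {x} {w} xy≡a) (partners-sym {z} {w} zw≡a)) (All.lookup x∉xs (zs⊆xs z∈))
      ...   | there w∈zs = w , w∈zs , zw≡a , z≢w

    Root : ℕ → Set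
    Root x = Partners x x

    module _ h (p≡1+2h : p ≡ 1 ℕ.+ 2 ℕ.* h) where

      length-nonzeroResidues : length nonzeroResidues ≡ 2 ℕ.* h
      length-nonzeroResidues = trans (length-map suc (upTo (ℕ.pred p))) (trans (length-upTo (ℕ.pred p)) (cong ℕ.pred p≡1+2h))

      -- Without a root no residue is its own partner, so the 2 h residues form h pairs.
      nonresidue : (∀ x → x ℕ.< p → ¬ Root x) → + product nonzeroResidues ≡ a ^ℤ h [mod p ]
      nonresidue ¬root = pairing h nonzeroResidues length-nonzeroResidues nonzeroResidues-unique (λ x∈ → x∈) closed
        where
        closed : ∀ {x} → x ∈ nonzeroResidues → ∃ λ y → y ∈ nonzeroResidues × Partners x y × x ≢ y
        closed x∈ with y , y∈ , xy≡a ← partner x∈ | _ , refl , x<p ← ∈-nonzeroResidues⁻ x∈ = y , y∈ , xy≡a , λ { refl → ¬root _ x<p xy≡a }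

      -- The residues that are their own partners are x and x′ = p - x. Together they contribute x
      -- x′ ≡ - a, and the remaining residues form h - 1 pairs.
      residue : ∀ x → x ℕ.< p → Root x → + product nonzeroResidues ≡ - (a ^ℤ h) [mod p ]
      residue zero    _   0≡a = contradiction (mod-∣ (mod-sym 0≡a) (divides 0ℤ refl)) p∤a
      residue (suc n) x<p xx≡a = go h refl
        where
        x = suc n
        x′ = p ℕ.∸ x
        x+x′≡p : + x + + x′ ≡ + p
        x+x′≡p = trans (sym (ℤₚ.pos-+ x x′)) (cong +_ (ℕₚ.m+[n∸m]≡n (ℕₚ.<⇒≤ x<p)))
        x′≡-x : + x′ ≡ - + x [mod p ]
        x′≡-x = multiple 1ℤ (trans (lem (+ x) (+ x′)) (trans x+x′≡p (sym (ℤₚ.*-identityˡ (+ p)))))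
          where
          lem : ∀ x y → y - (- x) ≡ x + y
          lem = solve-∀
        xx′≡-a : + x * + x′ ≡ - a [mod p ]
        xx′≡-a = mod-trans (mod-* (mod-refl {x = + x} refl) x′≡-x) (mod-trans (mod-refl (lem (+ x))) (mod-neg xx≡a))
          where
          lem : ∀ x → x * (- x) ≡ - (x * x)
          lem = solve-∀
        x′x′≡a : Root x′
        x′x′≡a = mod-trans (mod-* x′≡-x x′≡-x) (mod-trans (mod-refl (lem (+ x))) xx≡a)
          where
          lem : ∀ x → (- x) * (- x) ≡ x * x
          lem = solve-∀
        x∈ : x ∈ nonzeroResidues
        x∈ = ∈-nonzeroResidues⁺ x<p
        x′∈ : x′ ∈ nonzeroResidues
        x′∈ with x′ in eq
        ... | zero  = contradiction (ℕₚ.m∸n≡0⇒m≤n eq) (ℕₚ.<⇒≱ x<p)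
        ... | suc m = ∈-nonzeroResidues⁺ (subst (ℕ._< p) eq (ℕₚ.∸-monoʳ-< (s≤s z≤n) (ℕₚ.<⇒≤ x<p)))
        x≢x′ : x ≢ x′
        x≢x′ x≡x′ = 2x≢1+2h (trans (cong (x ℕ.+_) (trans (ℕₚ.+-identityʳ x) x≡x′)) (trans (ℕₚ.m+[n∸m]≡n (ℕₚ.<⇒≤ x<p)) p≡1+2h))
          where
          2x≢1+2h : 2 ℕ.* x ≢ 1 ℕ.+ 2 ℕ.* h
          2x≢1+2h eq = ℕ∣.>⇒∤ (s≤s (s≤s z≤n)) (ℕ∣.∣m+n∣m⇒∣n (subst (2 ℕ∣.∣_) (trans eq (ℕₚ.+-comm 1 (2 ℕ.* h))) (ℕ∣.m∣m*n x)) (ℕ∣.m∣m*n h))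
        -- Two residues are taken out before the pairing, so h is exposed as a successor; h = 0
        -- would mean p = 1.
        go : ∀ h′ → h′ ≡ h → + product nonzeroResidues ≡ - (a ^ℤ h) [mod p ]
        go zero    refl = contradiction x<p (ℕₚ.≤⇒≯ (subst (ℕ._≤ x) (sym p≡1+2h) (s≤s z≤n)))
        go (suc m) refl with ys , nonzeroResidues↭x∷ys ← remove x∈ with x∉ys ∷ ys! ← unique-↭ nonzeroResidues↭x∷ys nonzeroResidues-unique
                        with ∈-resp-↭ nonzeroResidues↭x∷ys x′∈
        ... | here eq = contradiction (sym eq) x≢x′
        ... | there x′∈ys with zs , ys↭x′∷zs ← remove x′∈ys with x′∉zs ∷ zs! ← unique-↭ ys↭x′∷zs ys! =
          mod-trans (mod-refl prod≡) (mod-trans (mod-* xx′≡-a (pairing m zs len zs! zs⊆nonzeroResidues closed))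
            (mod-refl (sym (ℤₚ.neg-distribˡ-* a (a ^ℤ m)))))
          where
          zs⊆ys : ∀ {z} → z ∈ zs → z ∈ ys
          zs⊆ys z∈ = ∈-resp-↭ (↭-sym ys↭x′∷zs) (there z∈)
          zs⊆nonzeroResidues : ∀ {z} → z ∈ zs → z ∈ nonzeroResidues
          zs⊆nonzeroResidues z∈ = ∈-resp-↭ (↭-sym nonzeroResidues↭x∷ys) (there (zs⊆ys z∈))
          len : length zs ≡ 2 ℕ.* m
          len = ℕₚ.suc-injective (ℕₚ.suc-injective (trans (cong suc (sym (↭-length ys↭x′∷zs))) (trans (sym (↭-length nonzeroResidues↭x∷ys)) (trans length-nonzeroResidues (cong suc (ℕₚ.+-suc m (m ℕ.+ 0)))))))
          prod≡ : + product nonzeroResidues ≡ + x * + x′ * + product zs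
          prod≡ = trans (cong +_ (trans (product-↭ nonzeroResidues↭x∷ys) (cong (x ℕ.*_) (product-↭ ys↭x′∷zs))))
              (trans (ℤₚ.pos-* x (x′ ℕ.* product zs)) (trans (cong (+ x *_) (ℤₚ.pos-* x′ (product zs))) (sym (ℤₚ.*-assoc (+ x) (+ x′) (+ product zs)))))
          closed : ∀ {z} → z ∈ zs → ∃ λ w → w ∈ zs × Partners z w × z ≢ w
          closed {z} z∈ with w , w∈ , zw≡a ← partner (zs⊆nonzeroResidues z∈) = w , w∈zs , zw≡a , z≢w
            where
            z≢x : z ≢ x
            z≢x z≡x = All.lookup x∉ys (zs⊆ys z∈) (sym z≡x)
            z≢x′ : z ≢ x′
            z≢x′ z≡x′ = All.lookup x′∉zs z∈ (sym z≡x′)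
            w∈zs : w ∈ zs
            w∈zs with ∈-resp-↭ nonzeroResidues↭x∷ys w∈
            ... | here w≡x = contradiction (partner-unique {x} (zs⊆nonzeroResidues z∈) x∈ (partners-sym {z} {x} (subst (Partners z) w≡x zw≡a)) xx≡a) z≢x
            ... | there w∈ys with ∈-resp-↭ ys↭x′∷zs w∈ys
            ...   | here w≡x′ = contradiction (partner-unique {x′} (zs⊆nonzeroResidues z∈) x′∈ (partners-sym {z} {x′} (subst (Partners z) w≡x′ zw≡a)) x′x′≡a) z≢x′
            ...   | there w∈zs = w∈zs
            -- A further fixed point z would satisfy z² ≡ x², hence z ≡ x or z ≡ - x ≡ x′.
            z≢w : z ≢ w
            z≢w z≡w with euclid (+ z - + x) (+ z + + x) (subst (+ p ∣_) (lem (+ z) (+ x)) (∣-difference (mod-trans (subst (Partners z) (sym z≡w) zw≡a) (mod-sym xx≡a))))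
              where
              lem : ∀ z x → z * z - x * x ≡ (z - x) * (z + x)
              lem = solve-∀
            ... | inj₁ d with _ , refl , z<p ← ∈-nonzeroResidues⁻ (zs⊆nonzeroResidues z∈) = z≢x (residue-unique z<p x<p (congruent d))
            ... | inj₂ d with _ , refl , z<p ← ∈-nonzeroResidues⁻ (zs⊆nonzeroResidues z∈) | _ , x′≡ , x′<p ← ∈-nonzeroResidues⁻ x′∈ =
              z≢x′ (residue-unique z<p (subst (ℕ._< p) (sym x′≡) x′<p) (mod-trans (congruent (subst (+ p ∣_) (lem (+ z) (+ x)) d)) (mod-sym x′≡-x)))
              where
              lem : ∀ z x → z + x ≡ z - (- x)
              lem = solve-∀

module _ {p : ℕ} (p-prime : Prime p) (h : ℕ) (p≡1+2h : p ≡ 1 ℕ.+ 2 ℕ.* h) where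

  2<p : 2 ℕ.< p
  2<p = go h p≡1+2h
    where
    go : ∀ h′ → p ≡ 1 ℕ.+ 2 ℕ.* h′ → 2 ℕ.< p
    go zero    p≡1 = contradiction (ℕ.nonTrivial⇒n>1 p {{prime⇒nonTrivial p-prime}}) (ℕₚ.≤⇒≯ (ℕₚ.≤-reflexive p≡1))
    go (suc m) eq  = subst (2 ℕ.<_) (sym (trans eq (cong (suc ∘ suc) (ℕₚ.+-suc m (m ℕ.+ 0))))) (s≤s (s≤s (s≤s z≤n)))

  p∤1 : ¬ + p ∣ 1ℤ
  p∤1 = small-∤ p-prime (ℕₚ.<-trans (s≤s (s≤s z≤n)) 2<p)

  p∤2 : ¬ + p ∣ + 2
  p∤2 = small-∤ p-prime 2<p

  1≢-1 : ¬ 1ℤ ≡ -1ℤ [mod p ]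
  1≢-1 (congruent p∣2) = p∤2 p∣2

  -- Dirichlet's pairing for a = 1, which has the root 1.
  wilson : + product (nonzeroResidues p-prime) ≡ -1ℤ [mod p ]
  wilson = mod-trans (residue p-prime 1ℤ p∤1 h p≡1+2h 1 (ℕₚ.<-trans (s≤s (s≤s z≤n)) 2<p) (mod-refl refl)) (mod-refl (cong -_ (ℤₚ.^-zeroˡ h)))

  -- The product of the nonzero residues is -1 by Wilson's theorem. The pairing evaluates it as -
  -- a^h if a is a square and as a^h otherwise, so a^h is 1 or -1 accordingly.
  euler : ∀ {a} → ¬ + p ∣ a → legendre a p ≡ a ^ℤ h [mod p ]
  euler {a} p∤a with + p ∣ℤ? a
  ... | yes p∣a = contradiction p∣a p∤a
  ... | no  _   with any? {n = p} (λ x → + p ∣ℤ? + toℕ x * + toℕ x - a)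
  ...   | yes (x , d) = mod-trans (mod-neg (mod-trans (mod-sym wilson) (residue p-prime a p∤a h p≡1+2h (toℕ x) (toℕ<n x) (congruent d))))
                          (mod-refl (ℤₚ.neg-involutive (a ^ℤ h)))
  ...   | no ¬root = mod-trans (mod-sym wilson) (nonresidue p-prime a p∤a h p≡1+2h
                       λ x x<p (congruent d) → ¬root (fromℕ< x<p , subst (λ z → + p ∣ + z * + z - a) (sym (toℕ-fromℕ< x<p)) d))

  legendre≡±1 : ∀ {a} → ¬ + p ∣ a → legendre a p ≡ 1ℤ ⊎ legendre a p ≡ -1ℤ
  legendre≡±1 {a} p∤a with + p ∣ℤ? a
  ... | yes p∣a = contradiction p∣a p∤a
  ... | no  _   with any? {n = p} (λ x → + p ∣ℤ? + toℕ x * + toℕ x - a)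
  ...   | yes _ = inj₁ refl
  ...   | no _  = inj₂ refl

  ±1-unique : ∀ {x y} → x ≡ 1ℤ ⊎ x ≡ -1ℤ → y ≡ 1ℤ ⊎ y ≡ -1ℤ → x ≡ y [mod p ] → x ≡ y
  ±1-unique (inj₁ refl) (inj₁ refl) _ = refl
  ±1-unique (inj₁ refl) (inj₂ refl) c = contradiction c 1≢-1
  ±1-unique (inj₂ refl) (inj₁ refl) c = contradiction (mod-sym c) 1≢-1
  ±1-unique (inj₂ refl) (inj₂ refl) _ = refl

  -- Both values are 1 or -1, and p > 2 keeps these apart modulo p.
  legendre-sgn : ∀ {a} z → ¬ + p ∣ a → a ^ℤ h ≡ sgn z [mod p ] → legendre a p ≡ sgn z
  legendre-sgn z p∤a a^h≡ = ±1-unique (legendre≡±1 p∤a) (sgn≡±1 z) (mod-trans (euler p∤a) a^h≡)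

  legendre[-1] : legendre -1ℤ p ≡ sgn (+ h)
  legendre[-1] = legendre-sgn (+ h) (λ d → p∤1 (∣ᵤ⇒∣ (∣⇒∣ᵤ d))) (mod-refl refl)

-- Gauss's lemma for 2

-- The sum 1 + ⋯ + h, which equals (p² - 1) / 8 for p = 1 + 2 h. Gauss's lemma produces the first
-- form; additivity over the prime factors of a denominator is read off from the second.
triangle : ℕ → ℤ
triangle zero    = 0ℤ
triangle (suc h) = triangle h + + suc h

8*triangle : ∀ h → + 8 * triangle h + 1ℤ ≡ (1ℤ + + 2 * + h) * (1ℤ + + 2 * + h)
8*triangle zero    = refl
8*triangle (suc h) = trans (lem₁ (triangle h) (+ h)) (trans (cong (λ w → w + + 8 * (1ℤ + + h)) (8*triangle h)) (lem₂ (+ h)))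
  where
  lem₁ : ∀ t h → + 8 * (t + (1ℤ + h)) + 1ℤ ≡ + 8 * t + 1ℤ + + 8 * (1ℤ + h)
  lem₁ = solve-∀
  lem₂ : ∀ h → (1ℤ + + 2 * h) * (1ℤ + + 2 * h) + + 8 * (1ℤ + h) ≡ (1ℤ + + 2 * (1ℤ + h)) * (1ℤ + + 2 * (1ℤ + h))
  lem₂ = solve-∀

-- The quotient (n + l)! / n!; in particular `rising 0 h` is h!.
rising : ℕ → ℕ → ℤ
rising n zero    = 1ℤ
rising n (suc l) = + suc n * rising (suc n) l

-- The product 2 lo · 2 (lo + 1) ⋯ of l factors; the variable lower end allows factors to be split
-- off on both sides.
evens : ℤ → ℕ → ℤ
evens lo zero    = 1ℤ
evens lo (suc l) = + 2 * lo * evens (1ℤ + lo) l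

evens≡2^*rising : ∀ n l → evens (+ suc n) l ≡ (+ 2) ^ℤ l * rising n l
evens≡2^*rising n zero    = refl
evens≡2^*rising n (suc l) = trans (cong (+ 2 * + suc n *_) (evens≡2^*rising (suc n) l)) (lem (+ suc n) ((+ 2) ^ℤ l) (rising (suc n) l))
  where
  lem : ∀ n x r → + 2 * n * (x * r) ≡ + 2 * x * (n * r)
  lem = solve-∀

evens-top : ∀ lo l → evens lo (suc l) ≡ evens lo l * (+ 2 * (lo + + l))
evens-top lo zero    = lem lo
  where
  lem : ∀ lo → + 2 * lo * 1ℤ ≡ 1ℤ * (+ 2 * (lo + 0ℤ))
  lem = solve-∀
evens-top lo (suc l) = trans (cong (+ 2 * lo *_) (evens-top (1ℤ + lo) l)) (lem lo (evens (1ℤ + lo) l) (+ l))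
  where
  lem : ∀ lo e l → + 2 * lo * (e * (+ 2 * (1ℤ + lo + l))) ≡ + 2 * lo * e * (+ 2 * (lo + (1ℤ + l)))
  lem = solve-∀

-- The product of (-1)ʲ j over n < j ≤ n + l, for n even and for n odd.
signedᵉ signedᵒ : ℕ → ℕ → ℤ
signedᵉ n zero    = 1ℤ
signedᵉ n (suc l) = - + suc n * signedᵒ (suc n) l
signedᵒ n zero    = 1ℤ
signedᵒ n (suc l) = + suc n * signedᵉ (suc n) l

-- The signs of `signedᵉ n l` and `signedᵒ n l`, which depend only on l once the parity of n is
-- fixed.
signᵉ signᵒ : ℕ → ℤ
signᵉ zero    = 1ℤ
signᵉ (suc l) = - signᵒ l
signᵒ zero    = 1ℤ
signᵒ (suc l) = signᵉ l

signedᵉ≡ : ∀ n l → signedᵉ n l ≡ signᵉ l * rising n l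
signedᵒ≡ : ∀ n l → signedᵒ n l ≡ signᵒ l * rising n l
signedᵉ≡ n zero    = refl
signedᵉ≡ n (suc l) = trans (cong (- + suc n *_) (signedᵒ≡ (suc n) l)) (lem (+ suc n) (signᵒ l) (rising (suc n) l))
  where
  lem : ∀ n s r → - n * (s * r) ≡ - s * (n * r)
  lem = solve-∀
signedᵒ≡ n zero    = refl
signedᵒ≡ n (suc l) = trans (cong (+ suc n *_) (signedᵉ≡ (suc n) l)) (lem (+ suc n) (signᵉ l) (rising (suc n) l))
  where
  lem : ∀ n s r → n * (s * r) ≡ s * (n * r)
  lem = solve-∀

-- Two more factors contain exactly one odd j and flip the sign, while the triangular number grows
-- by the odd number 2 l + 3.
signᵉ≡ : ∀ l → signᵉ l ≡ sgn (triangle l)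
signᵉ≡ zero          = refl
signᵉ≡ (suc zero)    = refl
signᵉ≡ (suc (suc l)) = begin
  - signᵉ l ≡⟨ cong -_ (signᵉ≡ l) ⟩
  - sgn (triangle l) ≡⟨ lem (sgn (triangle l)) ⟩
  sgn (triangle l) * -1ℤ ≡⟨ cong (sgn (triangle l) *_) (sym (sgn-odd (1ℤ + + l))) ⟩
  sgn (triangle l) * sgn (1ℤ + + 2 * (1ℤ + + l)) ≡⟨ sym (sgn-+ (triangle l) _) ⟩
  sgn (triangle l + (1ℤ + + 2 * (1ℤ + + l))) ≡⟨ cong sgn (lem′ (triangle l) (+ l)) ⟩
  sgn (triangle (suc (suc l))) ∎
  where
  open ≡-Reasoning
  lem : ∀ x → - x ≡ x * -1ℤ
  lem = solve-∀
  lem′ : ∀ t l → t + (1ℤ + + 2 * (1ℤ + l)) ≡ t + (1ℤ + l) + (1ℤ + (1ℤ + l))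
  lem′ = solve-∀

module _ {p : ℕ} (p-prime : Prime p) (h : ℕ) (p≡1+2h : p ≡ 1 ℕ.+ 2 ℕ.* h) where

  +p≡ : + p ≡ 1ℤ + + 2 * + h
  +p≡ = trans (cong +_ p≡1+2h) (trans (ℤₚ.pos-+ 1 (2 ℕ.* h)) (cong (λ w → 1ℤ + w) (ℤₚ.pos-* 2 h)))

  -- An odd j ≤ h contributes p - j, which is even and greater than h: the
  -- evens up to p - 1 are removed from the top for odd j, from the bottom for
  -- even j.
  fold-evensᵉ : ∀ t l → + h ≡ + 2 * + t + + l → evens (1ℤ + + t) l ≡ signedᵉ (2 ℕ.* t) l [mod p ]
  fold-evensᵒ : ∀ t l → + h ≡ 1ℤ + + 2 * + t + + l → evens (1ℤ + + t) l ≡ signedᵒ (suc (2 ℕ.* t)) l [mod p ]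
  fold-evensᵉ t zero    _  = mod-refl refl
  fold-evensᵉ t (suc l) h≡ = mod-trans (mod-refl (trans (evens-top (1ℤ + + t) l) (ℤₚ.*-comm _ top)))
    (mod-* top≡ (fold-evensᵒ t l (trans h≡ (lem′ (+ t) (+ l)))))
    where
    top : ℤ
    top = + 2 * (1ℤ + + t + + l)
    lem′ : ∀ t l → + 2 * t + (1ℤ + l) ≡ 1ℤ + + 2 * t + l
    lem′ = solve-∀
    lem : ∀ t l → + 2 * (1ℤ + t + l) - (- (1ℤ + + 2 * t)) ≡ 1ℤ * (1ℤ + + 2 * (+ 2 * t + (1ℤ + l)))
    lem = solve-∀
    top≡ : top ≡ - + suc (2 ℕ.* t) [mod p ]
    top≡ = multiple 1ℤ (trans (cong (λ w → top - (- (1ℤ + w))) (ℤₚ.pos-* 2 t)) (trans (lem (+ t) (+ l)) (cong (1ℤ *_) (trans (cong (λ w → 1ℤ + + 2 * w) (sym h≡)) (sym +p≡)))))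
  fold-evensᵒ t zero    _  = mod-refl refl
  fold-evensᵒ t (suc l) h≡ = mod-* (mod-refl bottom≡)
    (subst (λ w → evens (+ suc (suc t)) l ≡ signedᵉ w l [mod p ]) (cong suc (ℕₚ.+-suc t (t ℕ.+ 0))) (fold-evensᵉ (suc t) l (trans h≡ (lem (+ t) (+ l)))))
    where
    lem : ∀ t l → 1ℤ + + 2 * t + (1ℤ + l) ≡ + 2 * (1ℤ + t) + l
    lem = solve-∀
    bottom≡ : + 2 * + suc t ≡ + suc (suc (2 ℕ.* t))
    bottom≡ = trans (sym (ℤₚ.pos-* 2 (suc t))) (cong +_ (cong suc (ℕₚ.+-suc t (t ℕ.+ 0))))

  rising-∤ : ∀ n l → n ℕ.+ l ℕ.< p → ¬ + p ∣ rising n l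
  rising-∤ n zero    _   p∣1 = p∤1 p-prime h p≡1+2h p∣1
  rising-∤ n (suc l) n+l p∣r with euclid p-prime (+ suc n) (rising (suc n) l) p∣r
  ... | inj₁ p∣n  = small-∤ p-prime (ℕₚ.≤-<-trans (s≤s (ℕₚ.m≤m+n n l)) (subst (ℕ._< p) (ℕₚ.+-suc n l) n+l)) p∣n
  ... | inj₂ p∣r′ = rising-∤ (suc n) l (subst (ℕ._< p) (ℕₚ.+-suc n l) n+l) p∣r′

  -- The product of the even numbers up to p - 1 is 2^h h!, and folding it modulo p gives (-1)^(1 +
  -- ⋯ + h) h!. The factor h! is prime to p and cancels.
  2^h≡sgn : (+ 2) ^ℤ h ≡ sgn (triangle h) [mod p ]
  2^h≡sgn = mod-cancelˡ p-prime (rising-∤ 0 h h<p)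
    (mod-trans (mod-refl (trans (ℤₚ.*-comm (rising 0 h) ((+ 2) ^ℤ h)) (sym (evens≡2^*rising 0 h))))
    (mod-trans (fold-evensᵉ 0 h (sym (ℤₚ.+-identityˡ (+ h))))
    (mod-refl (trans (signedᵉ≡ 0 h) (trans (ℤₚ.*-comm (signᵉ h) (rising 0 h)) (cong (rising 0 h *_) (signᵉ≡ h)))))))
    where
    h<p : h ℕ.< p
    h<p = subst (h ℕ.<_) (sym p≡1+2h) (s≤s (ℕₚ.m≤m+n h (h ℕ.+ 0)))

  p∤2^ : ∀ i → ¬ + p ∣ (+ 2) ^ℤ i
  p∤2^ zero    p∣1 = p∤1 p-prime h p≡1+2h p∣1
  p∤2^ (suc i) p∣  with euclid p-prime (+ 2) ((+ 2) ^ℤ i) p∣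
  ... | inj₁ p∣2  = p∤2 p-prime h p≡1+2h p∣2
  ... | inj₂ p∣2^ = p∤2^ i p∣2^

  -- Euler's criterion is applied to 2^i as a whole: its h-th power is the i-th power of 2^h.
  legendre[2^] : ∀ i → legendre ((+ 2) ^ℤ i) p ≡ sgn (+ i * triangle h)
  legendre[2^] i = legendre-sgn p-prime h p≡1+2h (+ i * triangle h) (p∤2^ i)
    (mod-trans (mod-refl swap) (mod-trans (mod-^ i 2^h≡sgn) (mod-refl (sym (sgn-*ℕ i (triangle h))))))
    where
    swap : ((+ 2) ^ℤ i) ^ℤ h ≡ ((+ 2) ^ℤ h) ^ℤ i
    swap = trans (ℤₚ.^-*-assoc (+ 2) i h) (trans (cong (λ m → (+ 2) ^ℤ m) (ℕₚ.*-comm i h)) (sym (ℤₚ.^-*-assoc (+ 2) h i)))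

-- The Kronecker symbols at -1 and at powers of 2

Odd : ℕ → Set
Odd n = ∃ λ h → n ≡ 1 ℕ.+ 2 ℕ.* h

2∤⇒odd : ∀ n → ¬ 2 ℕ∣.∣ n → Odd n
2∤⇒odd n 2∤n with n % 2 | m%n<n n 2 | m≡m%n+[m/n]*n n 2
... | 0           | _ | eq = contradiction (ℕ∣.divides (n / 2) eq) 2∤n
... | 1           | _ | eq = n / 2 , trans eq (cong suc (ℕₚ.*-comm (n / 2) 2))
... | suc (suc r) | s≤s (s≤s ()) | _

factors-odd : ∀ ps → ¬ 2 ℕ∣.∣ product ps → All Odd ps
factors-odd []       _ = []
factors-odd (p ∷ ps) 2∤ = 2∤⇒odd p (2∤ ∘ ℕ∣.∣m⇒∣m*n (product ps)) ∷ factors-odd ps (2∤ ∘ ℕ∣.∣n⇒∣m*n p)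

kroneckerₚ≡legendre : ∀ a {p} → Odd p → kroneckerₚ a p ≡ legendre a p
kroneckerₚ≡legendre a {0} _ = refl
kroneckerₚ≡legendre a {1} _ = refl
kroneckerₚ≡legendre a {2} (h , eq) = contradiction (ℕ∣.∣m+n∣m⇒∣n {2} {2 ℕ.* h} (subst (2 ℕ∣.∣_) (trans eq (ℕₚ.+-comm 1 (2 ℕ.* h))) ℕ∣.∣-refl) (ℕ∣.m∣m*n h)) (ℕ∣.>⇒∤ (s≤s (s≤s z≤n)))
kroneckerₚ≡legendre a {suc (suc (suc _))} _ = refl

product-pos : ∀ p ps → + product (p ∷ ps) ≡ + p * + product ps
product-pos p ps = ℤₚ.pos-* p (product ps)

-- For odd n = Π p the exponent (n² - 1) / 8 is additive modulo 2.
∏-kronecker[2^] : ∀ i ps → All Prime ps → All Odd ps → ∃ λ t →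
  (+ product ps * + product ps ≡ + 8 * t + 1ℤ) × foldr _*_ 1ℤ (map (kroneckerₚ ((+ 2) ^ℤ i)) ps) ≡ sgn (+ i * t)
∏-kronecker[2^] i [] _ _ = 0ℤ , refl , cong sgn (sym (ℤₚ.*-zeroʳ (+ i)))
∏-kronecker[2^] i (p ∷ ps) (p-prime ∷ ps-prime) (p-odd@(h , p≡1+2h) ∷ ps-odd) with t , n²≡ , ∏≡ ← ∏-kronecker[2^] i ps ps-prime ps-odd =
  + 8 * (t₀ * t) + t₀ + t , square , value
  where
  t₀ = triangle h
  p²≡ : + p * + p ≡ + 8 * t₀ + 1ℤ
  p²≡ = trans (cong (λ w → w * w) (+p≡ p-prime h p≡1+2h)) (sym (8*triangle h))
  lem : ∀ p n → (p * n) * (p * n) ≡ (p * p) * (n * n)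
  lem = solve-∀
  lem′ : ∀ t₀ t → (+ 8 * t₀ + 1ℤ) * (+ 8 * t + 1ℤ) ≡ + 8 * (+ 8 * (t₀ * t) + t₀ + t) + 1ℤ
  lem′ = solve-∀
  lem″ : ∀ i t₀ t → i * (+ 8 * (t₀ * t) + t₀ + t) ≡ (i * t₀ + i * t) + + 2 * (i * (+ 4 * (t₀ * t)))
  lem″ = solve-∀
  square : + product (p ∷ ps) * + product (p ∷ ps) ≡ + 8 * (+ 8 * (t₀ * t) + t₀ + t) + 1ℤ
  square = trans (cong (λ w → w * w) (product-pos p ps)) (trans (lem (+ p) (+ product ps)) (trans (cong₂ _*_ p²≡ n²≡) (lem′ t₀ t)))
  value : kroneckerₚ ((+ 2) ^ℤ i) p * foldr _*_ 1ℤ (map (kroneckerₚ ((+ 2) ^ℤ i)) ps) ≡ sgn (+ i * (+ 8 * (t₀ * t) + t₀ + t))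
  value = begin
    kroneckerₚ ((+ 2) ^ℤ i) p * foldr _*_ 1ℤ (map (kroneckerₚ ((+ 2) ^ℤ i)) ps)
      ≡⟨ cong₂ _*_ (trans (kroneckerₚ≡legendre ((+ 2) ^ℤ i) p-odd) (legendre[2^] p-prime h p≡1+2h i)) ∏≡ ⟩
    sgn (+ i * t₀) * sgn (+ i * t)  ≡⟨ sym (sgn-+ (+ i * t₀) (+ i * t)) ⟩
    sgn (+ i * t₀ + + i * t)        ≡⟨ sym (sgn-+2* (+ i * t₀ + + i * t) (+ i * (+ 4 * (t₀ * t)))) ⟩
    sgn ((+ i * t₀ + + i * t) + + 2 * (+ i * (+ 4 * (t₀ * t)))) ≡⟨ cong sgn (sym (lem″ (+ i) t₀ t)) ⟩
    sgn (+ i * (+ 8 * (t₀ * t) + t₀ + t)) ∎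
    where open ≡-Reasoning

-- The exponent (n - 1) / 2 is additive modulo 2: the product of 1 + 2 h and 1 + 2 t is 1 + 2 (h + t
-- + 2 h t).
∏-kronecker[-1] : ∀ ps → All Prime ps → All Odd ps → ∃ λ t →
  (+ product ps ≡ 1ℤ + + 2 * t) × foldr _*_ 1ℤ (map (kroneckerₚ -1ℤ) ps) ≡ sgn t
∏-kronecker[-1] [] _ _ = 0ℤ , refl , refl
∏-kronecker[-1] (p ∷ ps) (p-prime ∷ ps-prime) (p-odd@(h , p≡1+2h) ∷ ps-odd) with t , n≡ , ∏≡ ← ∏-kronecker[-1] ps ps-prime ps-odd =
  + h + t + + 2 * (+ h * t) ,
  trans (product-pos p ps) (trans (cong₂ _*_ (+p≡ p-prime h p≡1+2h) n≡) (lem (+ h) t)) ,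
  trans (cong₂ _*_ (trans (kroneckerₚ≡legendre -1ℤ p-odd) (legendre[-1] p-prime h p≡1+2h)) ∏≡)
    (trans (sym (sgn-+ (+ h) t)) (sym (sgn-+2* (+ h + t) (+ h * t))))
  where
  lem : ∀ h t → (1ℤ + + 2 * h) * (1ℤ + + 2 * t) ≡ 1ℤ + + 2 * (h + t + + 2 * (h * t))
  lem = solve-∀

odd-∤ : ∀ {z} w → z ≡ 1ℤ + + 2 * w → ¬ 2 ℕ∣.∣ ∣ z ∣
odd-∤ w refl 2∣z with trans (sym (sgn-odd w)) (trans (cong (-1ℤ ^ℤ_) (trans (ℕ∣._∣_.equality 2∣z) (ℕₚ.*-comm (ℕ∣.quotient 2∣z) 2))) (-1^[2*n]≡1 (ℕ∣.quotient 2∣z)))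
... | ()

module _ (n : ℕ) .{{_ : ℕ.NonZero n}} (2∤n : ¬ 2 ℕ∣.∣ n) where
  private
    ps = factors (factorise n)
    n≡ : n ≡ product ps
    n≡ = isFactorisation (factorise n)
    ps-prime = factorsPrime (factorise n)
    ps-odd = factors-odd ps (2∤n ∘ subst (2 ℕ∣.∣_) (sym n≡))

  kronecker⁺[2^] : ∀ i t → + n * + n ≡ + 8 * t + 1ℤ → kronecker⁺ ((+ 2) ^ℤ i) n ≡ sgn (+ i * t)
  kronecker⁺[2^] i t n²≡ with t′ , n²≡′ , ∏≡ ← ∏-kronecker[2^] i ps ps-prime ps-odd = trans ∏≡ (cong (λ w → sgn (+ i * w)) t′≡t)
    where
    t′≡t : t′ ≡ t
    t′≡t = ℤₚ.*-cancelˡ-≡ (+ 8) t′ t (+-cancelʳ 1ℤ (+ 8 * t′) (+ 8 * t) (trans (sym n²≡′) (trans (cong (λ w → + w * + w) (sym n≡)) n²≡)))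

  kronecker⁺[-1] : ∀ t → + n ≡ 1ℤ + + 2 * t → kronecker⁺ -1ℤ n ≡ sgn t
  kronecker⁺[-1] t n≡′ with t′ , n≡″ , ∏≡ ← ∏-kronecker[-1] ps ps-prime ps-odd = trans ∏≡ (cong sgn t′≡t)
    where
    t′≡t : t′ ≡ t
    t′≡t = ℤₚ.*-cancelˡ-≡ (+ 2) t′ t (+-cancelˡ 1ℤ (+ 2 * t′) (+ 2 * t) (trans (sym n≡″) (trans (cong +_ (sym n≡)) n≡′)))

pos-^ : ∀ m n → + (m ℕ.^ n) ≡ (+ m) ^ℤ n
pos-^ m zero    = refl
pos-^ m (suc n) = trans (ℤₚ.pos-* m (m ℕ.^ n)) (cong (+ m *_) (pos-^ m n))

-- For n = 4 c - 1 the exponent (n² - 1) / 8 is 2 c² - c, which has the parity of c. A negative n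
-- has the square of its absolute value, and its extra factor (2ⁱ / -1) is 1.
kronecker[2^] : ∀ i c → kronecker (+ (2 ℕ.^ i)) (+ 4 * c - 1ℤ) ≡ sgn (+ i * c)
kronecker[2^] i c = trans (cong (λ w → kronecker w (+ 4 * c - 1ℤ)) (pos-^ 2 i)) (go (+ 4 * c - 1ℤ) refl)
  where
  odd-lem : ∀ c → + 4 * c - 1ℤ ≡ 1ℤ + + 2 * (+ 2 * c - 1ℤ)
  odd-lem = solve-∀
  square-lem : ∀ c → (+ 4 * c - 1ℤ) * (+ 4 * c - 1ℤ) ≡ + 8 * (+ 2 * (c * c) - c) + 1ℤ
  square-lem = solve-∀
  exp-lem : ∀ i c → i * (+ 2 * (c * c) - c) ≡ i * c + + 2 * (i * (c * c - c))
  exp-lem = solve-∀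
  value : ∀ z → z ≡ + 4 * c - 1ℤ → .{{_ : ℕ.NonZero ∣ z ∣}} → kronecker⁺ ((+ 2) ^ℤ i) ∣ z ∣ ≡ sgn (+ i * c)
  value z z≡ = trans (kronecker⁺[2^] ∣ z ∣ (odd-∤ (+ 2 * c - 1ℤ) (trans z≡ (odd-lem c))) i (+ 2 * (c * c) - c)
      (trans (trans (sym (ℤₚ.pos-* ∣ z ∣ ∣ z ∣)) (square z)) (trans (cong (λ w → w * w) z≡) (square-lem c))))
    (trans (cong sgn (exp-lem (+ i) c)) (sgn-+2* (+ i * c) (+ i * (c * c - c))))
    where
    square : ∀ z → + (∣ z ∣ ℕ.* ∣ z ∣) ≡ z * z
    square (+ n)    = ℤₚ.pos-* n n
    square -[1+ n ] = refl
  go : ∀ z → z ≡ + 4 * c - 1ℤ → kronecker ((+ 2) ^ℤ i) z ≡ sgn (+ i * c)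
  go (+ zero)  eq = contradiction (ℕ∣.divides 0 refl) (odd-∤ (+ 2 * c - 1ℤ) (trans eq (odd-lem c)))
  go (+ suc n) eq = value (+ suc n) eq
  go -[1+ n ]  eq = trans (cong₂ _*_ (cong kronecker₋₁ (sym (pos-^ 2 i))) (value -[1+ n ] eq)) (ℤₚ.*-identityˡ _)

-- For negative 1 + 2 a the absolute value is 1 + 2 (- (1 + a)); its sign is opposite to that of a,
-- and the factor (-1 / -1) = -1 compensates.
kronecker[-1] : ∀ a → kronecker -1ℤ (1ℤ + + 2 * a) ≡ sgn a
kronecker[-1] a = go (1ℤ + + 2 * a) refl
  where
  go : ∀ z → z ≡ 1ℤ + + 2 * a → kronecker -1ℤ z ≡ sgn a
  go (+ zero)  eq = contradiction (ℕ∣.divides 0 refl) (odd-∤ a eq)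
  go (+ suc n) eq = kronecker⁺[-1] (suc n) (odd-∤ a eq) a eq
  go -[1+ n ]  eq = begin
    -1ℤ * kronecker⁺ -1ℤ (suc n)   ≡⟨ cong (-1ℤ *_) (kronecker⁺[-1] (suc n) (odd-∤ a eq) (- (1ℤ + a)) (trans (cong -_ eq) (lem a))) ⟩
    -1ℤ * sgn (- (1ℤ + a))         ≡⟨ cong (-1ℤ *_) (cong (-1ℤ ^ℤ_) (ℤₚ.∣-i∣≡∣i∣ (1ℤ + a))) ⟩
    -1ℤ * sgn (1ℤ + a)             ≡⟨ cong (-1ℤ *_) (sgn-+ 1ℤ a) ⟩
    -1ℤ * (-1ℤ * sgn a)            ≡⟨ lem′ (sgn a) ⟩
    sgn a                          ∎
    where
    open ≡-Reasoning
    lem : ∀ a → - (1ℤ + + 2 * a) ≡ 1ℤ + + 2 * (- (1ℤ + a))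
    lem = solve-∀
    lem′ : ∀ s → -1ℤ * (-1ℤ * s) ≡ s
    lem′ = solve-∀

-- Every prime factor of n is 2, and (1 / 2) = (-1 / 2) = 1.
kronecker⁺[±1,2^] : ∀ {ε} → ε ≡ 1ℤ ⊎ ε ≡ -1ℤ → ∀ n .{{_ : ℕ.NonZero n}} m → n ≡ 2 ℕ.^ m → kronecker⁺ ε n ≡ 1ℤ
kronecker⁺[±1,2^] {ε} ε≡±1 n m n≡2^m = go (factors (factorise n)) (factorsPrime (factorise n)) λ p∣ → subst (_ ℕ∣.∣_) (trans (sym (isFactorisation (factorise n))) n≡2^m) p∣
  where
  prime∣2^ : ∀ {p} m → Prime p → p ℕ∣.∣ 2 ℕ.^ m → p ≡ 2
  prime∣2^ zero    p-prime p∣1 = contradiction (ℕ∣.∣1⇒≡1 p∣1) λ { refl → ℕₚ.<-irrefl refl (ℕ.nonTrivial⇒n>1 1 {{prime⇒nonTrivial p-prime}}) }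
  prime∣2^ (suc m) p-prime p∣ with euclidsLemma 2 (2 ℕ.^ m) p-prime p∣
  ... | inj₂ p∣2^ = prime∣2^ m p-prime p∣2^
  ... | inj₁ p∣2 with irreducible[2] p∣2
  ...   | inj₁ refl = contradiction (ℕ.nonTrivial⇒n>1 1 {{prime⇒nonTrivial p-prime}}) (ℕₚ.<-irrefl refl)
  ...   | inj₂ p≡2  = p≡2
  kronecker₂[±1] : ∀ {ε} → ε ≡ 1ℤ ⊎ ε ≡ -1ℤ → kroneckerₚ ε 2 ≡ 1ℤ
  kronecker₂[±1] (inj₁ refl) = refl
  kronecker₂[±1] (inj₂ refl) = refl
  -- The hypothesis is about divisors because in this form it passes to the tail of the list.
  go : ∀ ps → All Prime ps → (∀ {p} → p ℕ∣.∣ product ps → p ℕ∣.∣ 2 ℕ.^ m) → foldr _*_ 1ℤ (map (kroneckerₚ ε) ps) ≡ 1ℤ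
  go [] _ _ = refl
  go (p ∷ ps) (p-prime ∷ ps-prime) ∣2^ with refl ← prime∣2^ m p-prime (∣2^ (ℕ∣.m∣m*n (product ps))) =
    cong₂ _*_ (kronecker₂[±1] ε≡±1) (go ps ps-prime λ q∣ → ∣2^ (ℕ∣.∣n⇒∣m*n p q∣))

-- The denominator - A₁ A₂ is minus a power of 2: the power contributes 1 and the sign contributes
-- (ε / -1) = ε.
kronecker[sgn,-4^] : ∀ a k → kronecker (sgn a) (- (+ (2 ℕ.^ k) * + (2 ℕ.^ k))) ≡ sgn a
kronecker[sgn,-4^] a k = trans (cong (λ w → kronecker (sgn a) (- w)) (sym (ℤₚ.pos-* (2 ℕ.^ k) (2 ℕ.^ k))))
  (go (2 ℕ.^ k ℕ.* 2 ℕ.^ k) (sym (ℕₚ.^-distribˡ-+-* 2 k k)))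
  where
  k₋₁ : kronecker₋₁ (sgn a) ≡ sgn a
  k₋₁ with sgn≡±1 a
  ... | inj₁ eq rewrite eq = refl
  ... | inj₂ eq rewrite eq = refl
  go : ∀ n → n ≡ 2 ℕ.^ (k ℕ.+ k) → kronecker (sgn a) (- + n) ≡ sgn a
  go zero    eq = contradiction (sym eq) (ℕ.≢-nonZero⁻¹ (2 ℕ.^ (k ℕ.+ k)) {{ℕₚ.m^n≢0 2 (k ℕ.+ k)}})
  go (suc n) eq = trans (cong₂ _*_ k₋₁ (kronecker⁺[±1,2^] (sgn≡±1 a) (suc n) (k ℕ.+ k) eq)) (ℤₚ.*-identityʳ (sgn a))

-- Exact quotients

cong₃ : ∀ {A B C D : Set} (f : A → B → C → D) {x x′ y y′ z z′} → x ≡ x′ → y ≡ y′ → z ≡ z′ → f x y z ≡ f x′ y′ z′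
cong₃ f refl refl refl = refl

÷-exact : ∀ x n .{{_ : ℕ.NonZero n}} → (x * + n) ÷ n ≡ x
÷-exact x n@(suc _) = sym (ℤₚ.*-cancelʳ-≡ x ((x * + n) /ℕ n) (+ n) x*n≡q*n)
  where
  r = (x * + n) %ℕ n
  q = (x * + n) /ℕ n
  eq : x * + n ≡ + r + q * + n
  eq = a≡a%ℕn+[a/ℕn]*n (x * + n) n
  lem : ∀ r x q n → x * n ≡ r + q * n → r - 0ℤ ≡ (x - q) * n
  lem r x q n eq = trans (lem₁ r (q * n)) (trans (cong (λ w → w - q * n) (sym eq)) (lem₂ x q n))
    where
    lem₁ : ∀ r s → r - 0ℤ ≡ r + s - s
    lem₁ = solve-∀
    lem₂ : ∀ x q n → x * n - q * n ≡ (x - q) * n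
    lem₂ = solve-∀
  r≡0 : r ≡ 0
  r≡0 = residue-unique (n%ℕd<d (x * + n) n) (s≤s z≤n) (multiple (x - q) (lem (+ r) x q (+ n) eq))
  x*n≡q*n : x * + n ≡ q * + n
  x*n≡q*n = trans eq (trans (cong (λ w → + w + q * + n) r≡0) (ℤₚ.+-identityˡ (q * + n)))

4*÷4 : ∀ x → (+ 4 * x) ÷ 4 ≡ x
4*÷4 x = trans (cong (_÷ 4) (ℤₚ.*-comm (+ 4) x)) (÷-exact x 4)

÷4-exact : ∀ {x} → + 4 ∣ x → x ≡ + 4 * (x ÷ 4)
÷4-exact (divides q refl) = trans (ℤₚ.*-comm q (+ 4)) (cong (+ 4 *_) (sym (÷-exact q 4)))

-- Matrices

cong-mat : ∀ {a b c d e f g h i a′ b′ c′ d′ e′ f′ g′ h′ i′} →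
  a ≡ a′ → b ≡ b′ → c ≡ c′ → d ≡ d′ → e ≡ e′ → f ≡ f′ → g ≡ g′ → h ≡ h′ → i ≡ i′ →
  mat a b c d e f g h i ≡ mat a′ b′ c′ d′ e′ f′ g′ h′ i′
cong-mat refl refl refl refl refl refl refl refl refl = refl

𝟙 : Mat
𝟙 = mat 1ℤ 0ℤ 0ℤ 0ℤ 1ℤ 0ℤ 0ℤ 0ℤ 1ℤ

∙-identityʳ : ∀ γ → γ ∙ 𝟙 ≡ γ
∙-identityʳ (mat a b c d e f g h i) = cong-mat (l₁ a b c) (l₂ a b c) (l₃ a b c) (l₁ d e f) (l₂ d e f) (l₃ d e f) (l₁ g h i) (l₂ g h i) (l₃ g h i)
  where
  l₁ : ∀ a b c → a * 1ℤ + b * 0ℤ + c * 0ℤ ≡ a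
  l₁ = solve-∀
  l₂ : ∀ a b c → a * 0ℤ + b * 1ℤ + c * 0ℤ ≡ b
  l₂ = solve-∀
  l₃ : ∀ a b c → a * 0ℤ + b * 0ℤ + c * 1ℤ ≡ c
  l₃ = solve-∀

∙-assoc : ∀ α β γ → α ∙ β ∙ γ ≡ α ∙ (β ∙ γ)
∙-assoc (mat a b c d e f g h i) (mat p q r s t u v w x) (mat a′ b′ c′ d′ e′ f′ g′ h′ i′) = cong-mat
  (l a b c a′ d′ g′) (l a b c b′ e′ h′) (l a b c c′ f′ i′)
  (l d e f a′ d′ g′) (l d e f b′ e′ h′) (l d e f c′ f′ i′)
  (l g h i a′ d′ g′) (l g h i b′ e′ h′) (l g h i c′ f′ i′)
  where
  lem : ∀ a b c x y z p q r s t u v w k →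
    (a * p + b * s + c * v) * x + (a * q + b * t + c * w) * y + (a * r + b * u + c * k) * z
    ≡ a * (p * x + q * y + r * z) + b * (s * x + t * y + u * z) + c * (v * x + w * y + k * z)
  lem = solve-∀
  l : ∀ a b c α β γ → _
  l a b c α β γ = lem a b c α β γ p q r s t u v w x

inverseˡ : ∀ γ → det γ ≡ 1ℤ → γ ⁻¹ ∙ γ ≡ 𝟙
inverseˡ (mat a b c d e f g h i) det≡1 = cong-mat
  (trans (l₁ a b c d e f g h i) det≡1) (l₂ a b c d e f g h i) (l₃ a b c d e f g h i)
  (l₄ a b c d e f g h i) (trans (l₅ a b c d e f g h i) det≡1) (l₆ a b c d e f g h i)
  (l₇ a b c d e f g h i) (l₈ a b c d e f g h i) (trans (l₉ a b c d e f g h i) det≡1)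
  where
  l₁ : ∀ a b c d e f g h i → (e * i - f * h) * a + (- (b * i - c * h)) * d + (b * f - c * e) * g ≡ a * (e * i - f * h) - b * (d * i - f * g) + c * (d * h - e * g)
  l₁ = solve-∀
  l₂ : ∀ a b c d e f g h i → (e * i - f * h) * b + (- (b * i - c * h)) * e + (b * f - c * e) * h ≡ 0ℤ
  l₂ = solve-∀
  l₃ : ∀ a b c d e f g h i → (e * i - f * h) * c + (- (b * i - c * h)) * f + (b * f - c * e) * i ≡ 0ℤ
  l₃ = solve-∀
  l₄ : ∀ a b c d e f g h i → (- (d * i - f * g)) * a + (a * i - c * g) * d + (- (a * f - c * d)) * g ≡ 0ℤ
  l₄ = solve-∀
  l₅ : ∀ a b c d e f g h i → (- (d * i - f * g)) * b + (a * i - c * g) * e + (- (a * f - c * d)) * h ≡ a * (e * i - f * h) - b * (d * i - f * g) + c * (d * h - e * g)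
  l₅ = solve-∀
  l₆ : ∀ a b c d e f g h i → (- (d * i - f * g)) * c + (a * i - c * g) * f + (- (a * f - c * d)) * i ≡ 0ℤ
  l₆ = solve-∀
  l₇ : ∀ a b c d e f g h i → (d * h - e * g) * a + (- (a * h - b * g)) * d + (a * e - b * d) * g ≡ 0ℤ
  l₇ = solve-∀
  l₈ : ∀ a b c d e f g h i → (d * h - e * g) * b + (- (a * h - b * g)) * e + (a * e - b * d) * h ≡ 0ℤ
  l₈ = solve-∀
  l₉ : ∀ a b c d e f g h i → (d * h - e * g) * c + (- (a * h - b * g)) * f + (a * e - b * d) * i ≡ a * (e * i - f * h) - b * (d * i - f * g) + c * (d * h - e * g)
  l₉ = solve-∀

upper : ℤ → ℤ → ℤ → Mat
upper x y z = mat 1ℤ x z 0ℤ 1ℤ y 0ℤ 0ℤ 1ℤ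

upper∈Γ∞ : ∀ x y z → Γ∞ (upper x y z)
upper∈Γ∞ x y z = (refl , refl , refl) , (refl , refl , refl)

det-∙-upper : ∀ γ x y z → det (γ ∙ upper x y z) ≡ det γ
det-∙-upper (mat a b c d e f g h i) x y z = lem a b c d e f g h i x y z
  where
  lem : ∀ a b c d e f g h i x y z → 
     (a * 1ℤ + b * 0ℤ + c * 0ℤ) * ((d * x + e * 1ℤ + f * 0ℤ) * (g * z + h * y + i * 1ℤ) - (d * z + e * y + f * 1ℤ) * (g * x + h * 1ℤ + i * 0ℤ)) - (a * x + b * 1ℤ + c * 0ℤ) * ((d * 1ℤ + e * 0ℤ + f * 0ℤ) * (g * z + h * y + i * 1ℤ) - (d * z + e * y + f * 1ℤ) * (g * 1ℤ + h * 0ℤ + i * 0ℤ)) + (a * z + b * y + c * 1ℤ) * ((d * 1ℤ + e * 0ℤ + f * 0ℤ) * (g * x + h * 1ℤ + i * 0ℤ) - (d * x + e * 1ℤ + f * 0ℤ) * (g * 1ℤ + h * 0ℤ + i * 0ℤ)) ≡ a * (e * i - f * h) - b * (d * i - f * g) + c * (d * h - e * g)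
  lem = solve-∀

-- Plücker coordinates

-- The coordinates are parameters, and the equations multiply by 4 instead of dividing. Thus the
-- effect of a matrix operation on them is a polynomial identity.
record Plücker (γ : Mat) (α₁ β₁ κ₁ α₂ β₂ κ₂ : ℤ) : Set where
  open Mat γ
  field
    g≡ : g ≡ - (+ 4 * α₁)
    h≡ : h ≡ - (+ 4 * β₁)
    i≡ : i ≡ - κ₁
    dh-eg≡ : d * h - e * g ≡ - (+ 4 * α₂)
    di-fg≡ : d * i - f * g ≡ + 4 * β₂
    ei-fh≡ : e * i - f * h ≡ - κ₂

Γ⇒Plücker : ∀ {γ} → Γ γ → Plücker γ (A₁ γ) (B₁ γ) (C₁ γ) (A₂ γ) (B₂ γ) (C₂ γ)
Γ⇒Plücker {mat a b c d e f g h i} (_ , (_ , _ , _) , (divides d′ d≡ , divides g′ g≡ , divides h′ h≡)) = record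
  { g≡ = flip-neg (÷4-exact (divides (- g′) (trans (cong -_ (trans (sym (l₀ g)) g≡)) (ℤₚ.neg-distribˡ-* g′ (+ 4)))))
  ; h≡ = flip-neg (÷4-exact (divides (- h′) (trans (cong -_ (trans (sym (l₀ h)) h≡)) (ℤₚ.neg-distribˡ-* h′ (+ 4)))))
  ; i≡ = sym (ℤₚ.neg-involutive i)
  ; dh-eg≡ = flip-neg (÷4-exact (divides (- (d′ * h - e * g′)) (trans (cong₂ (λ D G → - (D * h - e * G)) (trans (sym (l₀ d)) d≡) (trans (sym (l₀ g)) g≡)) (l₁ d′ h e g′))))
  ; di-fg≡ = ÷4-exact (divides (d′ * i - f * g′) (trans (cong₂ (λ D G → D * i - f * G) (trans (sym (l₀ d)) d≡) (trans (sym (l₀ g)) g≡)) (l₂ d′ i f g′)))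
  ; ei-fh≡ = sym (ℤₚ.neg-involutive (e * i - f * h))
  }
  where
  flip-neg : ∀ {x y} → - x ≡ y → x ≡ - y
  flip-neg {x} refl = sym (ℤₚ.neg-involutive x)
  l₀ : ∀ x → x - 0ℤ ≡ x
  l₀ = solve-∀
  l₁ : ∀ d h e g → - (d * + 4 * h - e * (g * + 4)) ≡ - (d * h - e * g) * + 4
  l₁ = solve-∀
  l₂ : ∀ d i f g → d * + 4 * i - f * (g * + 4) ≡ (d * i - f * g) * + 4
  l₂ = solve-∀

module _ γ {α₁ β₁ κ₁ α₂ β₂ κ₂} (P : Plücker γ α₁ β₁ κ₁ α₂ β₂ κ₂) where
  open Plücker P

  private
    neg-neg-÷4 : ∀ {x y} → x ≡ - (+ 4 * y) → (- x) ÷ 4 ≡ y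
    neg-neg-÷4 {x} {y} refl = trans (cong (_÷ 4) (ℤₚ.neg-involutive (+ 4 * y))) (4*÷4 y)

  Plücker⇒A₁ : A₁ γ ≡ α₁
  Plücker⇒A₁ = neg-neg-÷4 g≡
  Plücker⇒B₁ : B₁ γ ≡ β₁
  Plücker⇒B₁ = neg-neg-÷4 h≡
  Plücker⇒C₁ : C₁ γ ≡ κ₁
  Plücker⇒C₁ = trans (cong -_ i≡) (ℤₚ.neg-involutive κ₁)
  Plücker⇒A₂ : A₂ γ ≡ α₂
  Plücker⇒A₂ = neg-neg-÷4 dh-eg≡
  Plücker⇒B₂ : B₂ γ ≡ β₂
  Plücker⇒B₂ = trans (cong (_÷ 4) di-fg≡) (4*÷4 β₂)

  -- The matrix with rows (g , h , i), (d , e , f), (g , h , i) has determinant 0; expanded along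
  -- its first row, this is four times the relation.
  plücker-relation : α₁ * κ₂ + + 4 * β₁ * β₂ + κ₁ * α₂ ≡ 0ℤ
  plücker-relation = ℤₚ.*-cancelˡ-≡ (+ 4) _ 0ℤ (begin
    + 4 * (α₁ * κ₂ + + 4 * β₁ * β₂ + κ₁ * α₂) ≡⟨ l₁ α₁ β₁ κ₁ α₂ β₂ κ₂ ⟩
    (- (+ 4 * α₁)) * (- κ₂) - (- (+ 4 * β₁)) * (+ 4 * β₂) + (- κ₁) * (- (+ 4 * α₂))
      ≡⟨ cong₂ _+_ (cong₂ _-_ (cong₂ _*_ (sym g≡) (sym ei-fh≡)) (cong₂ _*_ (sym h≡) (sym di-fg≡))) (cong₂ _*_ (sym i≡) (sym dh-eg≡)) ⟩
    g * (e * i - f * h) - h * (d * i - f * g) + i * (d * h - e * g) ≡⟨ l₂ d e f g h i ⟩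
    0ℤ ∎)
    where
    open ≡-Reasoning
    open Mat γ
    l₁ : ∀ α₁ β₁ κ₁ α₂ β₂ κ₂ → + 4 * (α₁ * κ₂ + + 4 * β₁ * β₂ + κ₁ * α₂) ≡ (- (+ 4 * α₁)) * (- κ₂) - (- (+ 4 * β₁)) * (+ 4 * β₂) + (- κ₁) * (- (+ 4 * α₂))
    l₁ = solve-∀
    l₂ : ∀ d e f g h i → g * (e * i - f * h) - h * (d * i - f * g) + i * (d * h - e * g) ≡ 0ℤ
    l₂ = solve-∀

  Plücker-left : ∀ u → Γ∞ u → Plücker (u ∙ γ) α₁ β₁ κ₁ α₂ β₂ κ₂
  Plücker-left (mat _ x z _ _ y _ _ _) ((refl , refl , refl) , (refl , refl , refl)) = record
    { g≡ = trans (l₁ a d g) g≡ ; h≡ = trans (l₁ b e h) h≡ ; i≡ = trans (l₁ c f i) i≡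
    ; dh-eg≡ = trans (l₂ y a d g b e h) dh-eg≡ ; di-fg≡ = trans (l₂ y a d g c f i) di-fg≡ ; ei-fh≡ = trans (l₂ y b e h c f i) ei-fh≡ }
    where
    open Mat γ
    l₁ : ∀ a d g → 0ℤ * a + 0ℤ * d + 1ℤ * g ≡ g
    l₁ = solve-∀
    l₂ : ∀ y a d g b e h → (0ℤ * a + 1ℤ * d + y * g) * (0ℤ * b + 0ℤ * e + 1ℤ * h) - (0ℤ * b + 1ℤ * e + y * h) * (0ℤ * a + 0ℤ * d + 1ℤ * g) ≡ d * h - e * g
    l₂ = solve-∀

  -- The vector of minors transforms by the inverse transpose of `upper x y z`; x y - z is the
  -- corner entry of the inverse.
  Plücker-right : ∀ x y z → Plücker (γ ∙ upper x y z) α₁ (β₁ + α₁ * x) (κ₁ + + 4 * (α₁ * z + β₁ * y))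
                    α₂ (β₂ - α₂ * y) (κ₂ - + 4 * (β₂ * x) + + 4 * (α₂ * (x * y - z)))
  Plücker-right x y z = record
    { g≡ = trans (l₁ g h i) g≡
    ; h≡ = trans (l₂ g h i x) (trans (cong₂ (λ G H → G * x + H) g≡ h≡) (m₂ α₁ β₁ x))
    ; i≡ = trans (l₃ g h i y z) (trans (cong₃ (λ G H I → G * z + H * y + I) g≡ h≡ i≡) (m₃ α₁ β₁ κ₁ y z))
    ; dh-eg≡ = trans (l₄ d e f g h i x) dh-eg≡
    ; di-fg≡ = trans (l₅ d e f g h i y z) (trans (cong₂ (λ M N → M + N * y) di-fg≡ dh-eg≡) (m₅ α₂ β₂ y))
    ; ei-fh≡ = trans (l₆ d e f g h i x y z) (trans (cong₃ (λ M N O → O + M * x + N * (x * y - z)) di-fg≡ dh-eg≡ ei-fh≡) (m₆ α₂ β₂ κ₂ x (x * y - z)))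
    }
    where
    open Mat γ
    l₁ : ∀ g h i → g * 1ℤ + h * 0ℤ + i * 0ℤ ≡ g
    l₁ = solve-∀
    l₂ : ∀ g h i x → g * x + h * 1ℤ + i * 0ℤ ≡ g * x + h
    l₂ = solve-∀
    m₂ : ∀ α β x → (- (+ 4 * α)) * x + (- (+ 4 * β)) ≡ - (+ 4 * (β + α * x))
    m₂ = solve-∀
    l₃ : ∀ g h i y z → g * z + h * y + i * 1ℤ ≡ g * z + h * y + i
    l₃ = solve-∀
    m₃ : ∀ α β κ y z → (- (+ 4 * α)) * z + (- (+ 4 * β)) * y + (- κ) ≡ - (κ + + 4 * (α * z + β * y))
    m₃ = solve-∀
    l₄ : ∀ d e f g h i x → (d * 1ℤ + e * 0ℤ + f * 0ℤ) * (g * x + h * 1ℤ + i * 0ℤ) - (d * x + e * 1ℤ + f * 0ℤ) * (g * 1ℤ + h * 0ℤ + i * 0ℤ) ≡ d * h - e * g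
    l₄ = solve-∀
    l₅ : ∀ d e f g h i y z → (d * 1ℤ + e * 0ℤ + f * 0ℤ) * (g * z + h * y + i * 1ℤ) - (d * z + e * y + f * 1ℤ) * (g * 1ℤ + h * 0ℤ + i * 0ℤ) ≡ (d * i - f * g) + (d * h - e * g) * y
    l₅ = solve-∀
    m₅ : ∀ α β y → + 4 * β + (- (+ 4 * α)) * y ≡ + 4 * (β - α * y)
    m₅ = solve-∀
    l₆ : ∀ d e f g h i x y z → (d * x + e * 1ℤ + f * 0ℤ) * (g * z + h * y + i * 1ℤ) - (d * z + e * y + f * 1ℤ) * (g * x + h * 1ℤ + i * 0ℤ) ≡ (e * i - f * h) + (d * i - f * g) * x + (d * h - e * g) * (x * y - z)
    l₆ = solve-∀
    m₆ : ∀ α β κ x w → (- κ) + + 4 * β * x + (- (+ 4 * α)) * w ≡ - (κ - + 4 * (β * x) + + 4 * (α * w))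
    m₆ = solve-∀

-- Expanded along rows, the lower triangle of δ γ⁻¹ involves the last two rows of δ
-- only through the common third row and the common minors.
Plücker-unique : ∀ {γ δ α₁ β₁ κ₁ α₂ β₂ κ₂} → det γ ≡ 1ℤ → det δ ≡ 1ℤ →
  Plücker γ α₁ β₁ κ₁ α₂ β₂ κ₂ → Plücker δ α₁ β₁ κ₁ α₂ β₂ κ₂ → ∃ λ u → Γ∞ u × u ∙ γ ≡ δ
Plücker-unique {γ@(mat a b c d e f g h i)} {δ@(mat a′ b′ c′ d′ e′ f′ g′ h′ i′)} detγ detδ P Q =
  δ ∙ γ ⁻¹ , ((u₁₁ , u₂₂ , u₃₃) , (u₂₁ , u₃₁ , u₃₂)) ,
  trans (∙-assoc δ (γ ⁻¹) γ) (trans (cong (δ ∙_) (inverseˡ γ detγ)) (∙-identityʳ δ))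
  where
  module P = Plücker P
  module Q = Plücker Q
  open ≡-Reasoning
  g≡ = trans Q.g≡ (sym P.g≡)
  h≡ = trans Q.h≡ (sym P.h≡)
  i≡ = trans Q.i≡ (sym P.i≡)
  m₁ = trans P.dh-eg≡ (sym Q.dh-eg≡)
  m₂ = trans P.di-fg≡ (sym Q.di-fg≡)
  m₃ = trans P.ei-fh≡ (sym Q.ei-fh≡)
  expand : ∀ x y z p q r → x * p + y * (- q) + z * r ≡ x * p - y * q + z * r
  expand = solve-∀
  u₁₁ : a′ * (e * i - f * h) + b′ * (- (d * i - f * g)) + c′ * (d * h - e * g) ≡ 1ℤ
  u₁₁ = trans (expand a′ b′ c′ _ (d * i - f * g) _) (trans (cong₃ (λ x y z → a′ * x - b′ * y + c′ * z) m₃ m₂ m₁) detδ)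
  u₂₁ : d′ * (e * i - f * h) + e′ * (- (d * i - f * g)) + f′ * (d * h - e * g) ≡ 0ℤ
  u₂₁ = trans (cong₃ (λ x y z → d′ * x + e′ * (- y) + f′ * z) m₃ m₂ m₁) (lem d′ e′ f′ g′ h′ i′)
    where
    lem : ∀ d e f g h i → d * (e * i - f * h) + e * (- (d * i - f * g)) + f * (d * h - e * g) ≡ 0ℤ
    lem = solve-∀
  u₃₁ : g′ * (e * i - f * h) + h′ * (- (d * i - f * g)) + i′ * (d * h - e * g) ≡ 0ℤ
  u₃₁ = trans (cong₃ (λ x y z → x * (e * i - f * h) + y * (- (d * i - f * g)) + z * (d * h - e * g)) g≡ h≡ i≡) (lem d e f g h i)
    where
    lem : ∀ d e f g h i → g * (e * i - f * h) + h * (- (d * i - f * g)) + i * (d * h - e * g) ≡ 0ℤ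
    lem = solve-∀
  u₂₂ : d′ * (- (b * i - c * h)) + e′ * (a * i - c * g) + f′ * (- (a * h - b * g)) ≡ 1ℤ
  u₂₂ = begin
    d′ * (- (b * i - c * h)) + e′ * (a * i - c * g) + f′ * (- (a * h - b * g))
      ≡⟨ cong₃ (λ G H I → d′ * (- (b * I - c * H)) + e′ * (a * I - c * G) + f′ * (- (a * H - b * G))) (sym g≡) (sym h≡) (sym i≡) ⟩
    d′ * (- (b * i′ - c * h′)) + e′ * (a * i′ - c * g′) + f′ * (- (a * h′ - b * g′))
      ≡⟨ lem a b c d′ e′ f′ g′ h′ i′ ⟩
    a * (e′ * i′ - f′ * h′) - b * (d′ * i′ - f′ * g′) + c * (d′ * h′ - e′ * g′)
      ≡⟨ cong₃ (λ x y z → a * x - b * y + c * z) (sym m₃) (sym m₂) (sym m₁) ⟩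
    det γ ≡⟨ detγ ⟩
    1ℤ ∎
    where
    lem : ∀ a b c d e f g h i → d * (- (b * i - c * h)) + e * (a * i - c * g) + f * (- (a * h - b * g)) ≡ a * (e * i - f * h) - b * (d * i - f * g) + c * (d * h - e * g)
    lem = solve-∀
  u₃₂ : g′ * (- (b * i - c * h)) + h′ * (a * i - c * g) + i′ * (- (a * h - b * g)) ≡ 0ℤ
  u₃₂ = trans (cong₃ (λ x y z → x * (- (b * i - c * h)) + y * (a * i - c * g) + z * (- (a * h - b * g))) g≡ h≡ i≡) (lem a b c g h i)
    where
    lem : ∀ a b c g h i → g * (- (b * i - c * h)) + h * (a * i - c * g) + i * (- (a * h - b * g)) ≡ 0ℤ
    lem = solve-∀
  u₃₃ : g′ * (b * f - c * e) + h′ * (- (a * f - c * d)) + i′ * (a * e - b * d) ≡ 1ℤ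
  u₃₃ = trans (cong₃ (λ x y z → x * (b * f - c * e) + y * (- (a * f - c * d)) + z * (a * e - b * d)) g≡ h≡ i≡) (trans (lem a b c d e f g h i) detγ)
    where
    lem : ∀ a b c d e f g h i → g * (b * f - c * e) + h * (- (a * f - c * d)) + i * (a * e - b * d) ≡ a * (e * i - f * h) - b * (d * i - f * g) + c * (d * h - e * g)
    lem = solve-∀

-- The splitting on 𝕊 (2ᵏ , 2ᵏ)

2^≢0 : ∀ n → ℕ.NonZero (2 ℕ.^ n)
2^≢0 n = ℕₚ.m^n≢0 2 n

coprime-2^ : ∀ m {n} → ¬ 2 ℕ∣.∣ n → Coprime (2 ℕ.^ m) n
coprime-2^ zero    2∤n (d∣1 , _) = ℕ∣.∣1⇒≡1 d∣1
coprime-2^ (suc m) {n} 2∤n {d} (d∣2^ , d∣n) = coprime-2^ m 2∤n (coprime-divisor d⊥2 d∣2^ , d∣n)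
  where
  d⊥2 : Coprime d 2
  d⊥2 {e} (e∣d , e∣2) with irreducible[2] e∣2
  ... | inj₁ e≡1  = e≡1
  ... | inj₂ refl = contradiction (ℕ∣.∣-trans e∣d d∣n) 2∤n

gcd-2^-odd : ∀ i m a → gcd (2 ℕ.^ (i ℕ.+ m)) ∣ + (2 ℕ.^ i) * (1ℤ + + 2 * a) ∣ ≡ 2 ℕ.^ i
gcd-2^-odd i m a = begin
  gcd (2 ℕ.^ (i ℕ.+ m)) ∣ + (2 ℕ.^ i) * (1ℤ + + 2 * a) ∣   ≡⟨ cong₂ gcd (ℕₚ.^-distribˡ-+-* 2 i m) (ℤₚ.∣i*j∣≡∣i∣*∣j∣ (+ (2 ℕ.^ i)) (1ℤ + + 2 * a)) ⟩
  gcd (2 ℕ.^ i ℕ.* 2 ℕ.^ m) (2 ℕ.^ i ℕ.* ∣ 1ℤ + + 2 * a ∣) ≡⟨ sym (c*gcd[m,n]≡gcd[cm,cn] (2 ℕ.^ i) (2 ℕ.^ m) ∣ 1ℤ + + 2 * a ∣) ⟩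
  2 ℕ.^ i ℕ.* gcd (2 ℕ.^ m) ∣ 1ℤ + + 2 * a ∣               ≡⟨ cong (2 ℕ.^ i ℕ.*_) (coprime⇒gcd≡1 (coprime-2^ m (odd-∤ a refl))) ⟩
  2 ℕ.^ i ℕ.* 1                                            ≡⟨ ℕₚ.*-identityʳ (2 ℕ.^ i) ⟩
  2 ℕ.^ i                                                  ∎
  where open ≡-Reasoning

gcd-self : ∀ n → gcd n n ≡ n
gcd-self n = begin
  gcd n n                 ≡⟨ cong₂ gcd (sym (ℕₚ.*-identityʳ n)) (sym (ℕₚ.*-identityʳ n)) ⟩
  gcd (n ℕ.* 1) (n ℕ.* 1) ≡⟨ sym (c*gcd[m,n]≡gcd[cm,cn] n 1 1) ⟩
  n ℕ.* 1                 ≡⟨ ℕₚ.*-identityʳ n ⟩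
  n                       ∎
  where open ≡-Reasoning

÷-self : ∀ n .{{_ : ℕ.NonZero n}} → + n ÷ n ≡ 1ℤ
÷-self n = trans (cong (_÷ n) (sym (ℤₚ.*-identityˡ (+ n)))) (÷-exact 1ℤ n)

if-true : ∀ {A : Set} {b} {x y : A} → b ≡ true → (if b then x else y) ≡ x
if-true refl = refl

if-false : ∀ {A : Set} {b} {x y : A} → b ≡ false → (if b then x else y) ≡ y
if-false refl = refl

-- The expression `s-formula` with the gcds and the coordinates as independent arguments, so that
-- each can be replaced by its value separately.
formula : (D D₁ D₂ : ℕ) (α₁ β₁ κ₁ α₂ β₂ κ₂ : ℤ) → ℤ
formula D D₁ D₂ α₁ β₁ κ₁ α₂ β₂ κ₂ =
    kronecker (kronecker -1ℤ (β₁ ÷ D₁)) (- (α₁ * α₂))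
  * kronecker (α₁ ÷ D) (α₂ ÷ D)
  * kronecker (β₁ ÷ D₁) (α₁ ÷ D)
  * kronecker ((+ 4 * β₂) ÷ D₂) (+ ∣ α₂ ∣ ÷ D)
  * kronecker (+ D₁) κ₁
  * kronecker (+ D₂) κ₂

-- Since A₁ / D = A₂ / D = 1, three of the six symbols have denominator 1. There remain (ε / - A₁
-- A₂) = ε, (D₁ / C₁) and (D₂ / C₂).
formula-value : ∀ i j a β₂ c₁ c₂ → let n = 2 ℕ.^ suc (i ℕ.+ j) in
  formula n (2 ℕ.^ i) (2 ℕ.^ suc j) (+ n) (+ (2 ℕ.^ i) * (1ℤ + + 2 * a)) (+ 4 * c₁ - 1ℤ) (+ n) β₂ (+ 4 * c₂ - 1ℤ)
  ≡ sgn (a + + i * c₁ + + suc j * c₂)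
formula-value i j a β₂ c₁ c₂ = begin
  formula n (2 ℕ.^ i) (2 ℕ.^ suc j) (+ n) (+ (2 ℕ.^ i) * (1ℤ + + 2 * a)) (+ 4 * c₁ - 1ℤ) (+ n) β₂ (+ 4 * c₂ - 1ℤ)
    ≡⟨ cong₂ (λ b r → kronecker (kronecker -1ℤ b) (- (+ n * + n)) * kronecker r r * kronecker b r
                * kronecker ((+ 4 * β₂) ÷ (2 ℕ.^ suc j)) r * kronecker (+ (2 ℕ.^ i)) (+ 4 * c₁ - 1ℤ) * kronecker (+ (2 ℕ.^ suc j)) (+ 4 * c₂ - 1ℤ))
        (trans (cong (_÷ (2 ℕ.^ i)) (ℤₚ.*-comm (+ (2 ℕ.^ i)) (1ℤ + + 2 * a))) (÷-exact (1ℤ + + 2 * a) (2 ℕ.^ i) {{2^≢0 i}}))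
        (÷-self n {{2^≢0 (suc (i ℕ.+ j))}}) ⟩
  kronecker (kronecker -1ℤ (1ℤ + + 2 * a)) (- (+ n * + n)) * 1ℤ * 1ℤ * 1ℤ
    * kronecker (+ (2 ℕ.^ i)) (+ 4 * c₁ - 1ℤ) * kronecker (+ (2 ℕ.^ suc j)) (+ 4 * c₂ - 1ℤ)
    ≡⟨ cong₃ (λ x y z → x * 1ℤ * 1ℤ * 1ℤ * y * z)
        (trans (cong (λ ε → kronecker ε (- (+ n * + n))) (kronecker[-1] a)) (kronecker[sgn,-4^] a (suc (i ℕ.+ j))))
        (kronecker[2^] i c₁) (kronecker[2^] (suc j) c₂) ⟩
  sgn a * 1ℤ * 1ℤ * 1ℤ * sgn (+ i * c₁) * sgn (+ suc j * c₂)  ≡⟨ lem (sgn a) (sgn (+ i * c₁)) (sgn (+ suc j * c₂)) ⟩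
  sgn a * sgn (+ i * c₁) * sgn (+ suc j * c₂)                 ≡⟨ cong (_* sgn (+ suc j * c₂)) (sym (sgn-+ a (+ i * c₁))) ⟩
  sgn (a + + i * c₁) * sgn (+ suc j * c₂)                     ≡⟨ sym (sgn-+ (a + + i * c₁) (+ suc j * c₂)) ⟩
  sgn (a + + i * c₁ + + suc j * c₂)                           ∎
  where
  open ≡-Reasoning
  n = 2 ℕ.^ suc (i ℕ.+ j)
  lem : ∀ x y z → x * 1ℤ * 1ℤ * 1ℤ * y * z ≡ x * y * z
  lem = solve-∀

module _ {i j : ℕ} {γ : Mat} {a c₁ c₂ : ℤ}
  (A₁≡ : A₁ γ ≡ + (2 ℕ.^ suc (i ℕ.+ j))) (A₂≡ : A₂ γ ≡ + (2 ℕ.^ suc (i ℕ.+ j)))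
  (B₁≡ : B₁ γ ≡ + (2 ℕ.^ i) * (1ℤ + + 2 * a)) (C₁≡ : C₁ γ ≡ + 4 * c₁ - 1ℤ) (C₂≡ : C₂ γ ≡ + 4 * c₂ - 1ℤ) where

  private
    n = 2 ℕ.^ suc (i ℕ.+ j)
    instance
      n≢0 : ℕ.NonZero n
      n≢0 = 2^≢0 (suc (i ℕ.+ j))

    D≡ : D γ ≡ n
    D≡ = trans (cong₂ (λ x y → gcd ∣ x ∣ ∣ y ∣) A₁≡ A₂≡) (gcd-self n)

    D₁≡ : gcd (D γ) ∣ B₁ γ ∣ ≡ 2 ℕ.^ i
    D₁≡ = trans (cong₂ (λ x y → gcd x ∣ y ∣) (trans D≡ (cong (2 ℕ.^_) (sym (ℕₚ.+-suc i j)))) B₁≡) (gcd-2^-odd i (suc j) a)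

    D₂≡ : ∣ + D γ ÷ gcd (D γ) ∣ B₁ γ ∣ ∣ ≡ 2 ℕ.^ suc j
    D₂≡ = begin
      ∣ + D γ ÷ gcd (D γ) ∣ B₁ γ ∣ ∣    ≡⟨ cong₂ (λ x y → ∣ + x ÷ y ∣) D≡ D₁≡ ⟩
      ∣ + n ÷ (2 ℕ.^ i) ∣                       ≡⟨ cong (λ w → ∣ w ÷ (2 ℕ.^ i) ∣) n≡ ⟩
      ∣ (+ (2 ℕ.^ suc j) * + (2 ℕ.^ i)) ÷ (2 ℕ.^ i) ∣ ≡⟨ cong ∣_∣ (÷-exact (+ (2 ℕ.^ suc j)) (2 ℕ.^ i) {{2^≢0 i}}) ⟩
      2 ℕ.^ suc j                             ∎
      where
      open ≡-Reasoning
      n≡ : + n ≡ + (2 ℕ.^ suc j) * + (2 ℕ.^ i)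
      n≡ = trans (cong +_ (trans (cong (λ m → 2 ℕ.^ suc m) (ℕₚ.+-comm i j)) (ℕₚ.^-distribˡ-+-* 2 (suc j) i))) (ℤₚ.pos-* (2 ℕ.^ suc j) (2 ℕ.^ i))

    s≡s-formula : s γ ≡ s-formula γ
    s≡s-formula = begin
      s γ       ≡⟨ if-false A₂÷D-odd ⟩
      s-odd γ   ≡⟨ if-true A₁-positive ⟩
      s-formula γ ∎
      where
      open ≡-Reasoning
      A₂÷D-odd : does (+ 2 ∣ℤ? A₂ γ ÷ D γ) ≡ false
      A₂÷D-odd = cong (λ w → does (+ 2 ∣ℤ? w)) (trans (cong₂ _÷_ A₂≡ D≡) (÷-self n))
      A₁-positive : does (0ℤ ℤₚ.<? A₁ γ) ≡ true
      A₁-positive = trans (cong (λ w → does (0ℤ ℤₚ.<? w)) A₁≡) (positive n)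
        where
        positive : ∀ n → .{{_ : ℕ.NonZero n}} → does (0ℤ ℤₚ.<? + n) ≡ true
        positive (suc n) = refl

  s-value : s γ ≡ sgn (a + + i * c₁ + + suc j * c₂)
  s-value = begin
    s γ          ≡⟨ s≡s-formula ⟩
    formula (D γ) (gcd (D γ) ∣ B₁ γ ∣) (∣ + D γ ÷ gcd (D γ) ∣ B₁ γ ∣ ∣) (A₁ γ) (B₁ γ) (C₁ γ) (A₂ γ) (B₂ γ) (C₂ γ)
      ≡⟨ cong₂ (λ d₁ d₂ → formula (D γ) d₁ d₂ (A₁ γ) (B₁ γ) (C₁ γ) (A₂ γ) (B₂ γ) (C₂ γ)) D₁≡ D₂≡ ⟩
    formula (D γ) (2 ℕ.^ i) (2 ℕ.^ suc j) (A₁ γ) (B₁ γ) (C₁ γ) (A₂ γ) (B₂ γ) (C₂ γ)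
      ≡⟨ cong₂ (λ d b → formula d (2 ℕ.^ i) (2 ℕ.^ suc j) (A₁ γ) b (C₁ γ) (A₂ γ) (B₂ γ) (C₂ γ)) D≡ B₁≡ ⟩
    formula n (2 ℕ.^ i) (2 ℕ.^ suc j) (A₁ γ) (+ (2 ℕ.^ i) * (1ℤ + + 2 * a)) (C₁ γ) (A₂ γ) (B₂ γ) (C₂ γ)
      ≡⟨ cong₂ (λ x y → formula n (2 ℕ.^ i) (2 ℕ.^ suc j) x (+ (2 ℕ.^ i) * (1ℤ + + 2 * a)) (C₁ γ) y (B₂ γ) (C₂ γ)) A₁≡ A₂≡ ⟩
    formula n (2 ℕ.^ i) (2 ℕ.^ suc j) (+ n) (+ (2 ℕ.^ i) * (1ℤ + + 2 * a)) (C₁ γ) (+ n) (B₂ γ) (C₂ γ)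
      ≡⟨ cong₂ (λ x y → formula n (2 ℕ.^ i) (2 ℕ.^ suc j) (+ n) (+ (2 ℕ.^ i) * (1ℤ + + 2 * a)) x (+ n) (B₂ γ) y) C₁≡ C₂≡ ⟩
    formula n (2 ℕ.^ i) (2 ℕ.^ suc j) (+ n) (+ (2 ℕ.^ i) * (1ℤ + + 2 * a)) (+ 4 * c₁ - 1ℤ) (+ n) (B₂ γ) (+ 4 * c₂ - 1ℤ)
      ≡⟨ formula-value i j a (B₂ γ) c₁ c₂ ⟩
    sgn (a + + i * c₁ + + suc j * c₂) ∎
    where open ≡-Reasoning

-- Double cosets in 𝕊 (2ᵏ , 2ᵏ)

pos-2^-suc : ∀ i j → + (2 ℕ.^ suc (i ℕ.+ j)) ≡ + 2 * (+ (2 ℕ.^ i) * + (2 ℕ.^ j))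
pos-2^-suc i j = trans (ℤₚ.pos-* 2 (2 ℕ.^ (i ℕ.+ j))) (cong (+ 2 *_) (trans (cong +_ (ℕₚ.^-distribˡ-+-* 2 i j)) (ℤₚ.pos-* (2 ℕ.^ i) (2 ℕ.^ j))))

≡1mod4⇒ : ∀ {z} → + 4 ∣ z - 1ℤ → ∃ λ w → z ≡ 1ℤ + + 4 * w
≡1mod4⇒ {z} (divides w eq) = w , trans (l₁ z) (trans (cong (λ v → 1ℤ + v) eq) (cong (λ v → 1ℤ + v) (ℤₚ.*-comm w (+ 4))))
  where
  l₁ : ∀ z → z ≡ 1ℤ + (z - 1ℤ)
  l₁ = solve-∀

C₁-form : ∀ {γ} → Γ γ → ∃ λ c → C₁ γ ≡ + 4 * c - 1ℤ
C₁-form {mat a b c d e f g h i} (_ , (_ , _ , i≡1) , _) with w , refl ← ≡1mod4⇒ {i} i≡1 = - w , lem w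
  where
  lem : ∀ w → - (1ℤ + + 4 * w) ≡ + 4 * (- w) - 1ℤ
  lem = solve-∀

C₂-form : ∀ {γ} → Γ γ → ∃ λ c → C₂ γ ≡ + 4 * c - 1ℤ
C₂-form {mat a b c d e f g h i} (_ , (_ , e≡1 , i≡1) , (_ , _ , divides h′ h≡)) with w , refl ← ≡1mod4⇒ {i} i≡1 | v , refl ← ≡1mod4⇒ {e} e≡1 =
  f * h′ - v - w - + 4 * (v * w) , trans (cong (λ H → - ((1ℤ + + 4 * v) * (1ℤ + + 4 * w) - f * H)) (trans (sym (l₀ h)) h≡)) (lem v w f h′)
  where
  l₀ : ∀ x → x - 0ℤ ≡ x
  l₀ = solve-∀
  lem : ∀ v w f h → - ((1ℤ + + 4 * v) * (1ℤ + + 4 * w) - f * (h * + 4)) ≡ + 4 * (f * h - v - w - + 4 * (v * w)) - 1ℤ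
  lem = solve-∀

-- γ lies in the double coset of (B₁ , B₂ , C₁) = (P (1 + 2 a₁) , Q (1 + 2 a₂) , 4 c - 1):
-- right multiplication by upper x y z maps these to
-- (B₁ + A x , B₂ - A y , C₁ + 4 (A z + B₁ y)), where A = 2 P Q.
record Orbit (P Q A : ℤ) (a₁ a₂ c : ℕ) (γ : Mat) : Set where
  constructor orbit
  field
    x y z : ℤ
    B₁-value : B₁ γ ≡ P * (1ℤ + + 2 * (+ a₁ + Q * x))
    B₂-value : B₂ γ ≡ Q * (1ℤ + + 2 * (+ a₂ + P * y))
    C₁-value : C₁ γ ≡ + 4 * (+ c + A * z - P * (1ℤ + + 2 * + a₁) * y) - 1ℤ

module _ (P Q A : ℤ) .{{_ : ℤ.NonZero A}} (A≡ : A ≡ + 2 * (P * Q)) where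

  𝕊⇒Plücker : ∀ {γ} → 𝕊 A A γ → Plücker γ A (B₁ γ) (C₁ γ) A (B₂ γ) (C₂ γ)
  𝕊⇒Plücker (γ∈Γ , A₁≡ , A₂≡) = subst₂ (λ x y → Plücker _ x _ _ y _ _) A₁≡ A₂≡ (Γ⇒Plücker γ∈Γ)

  -- Because 4 P Q = 2 A, the Plücker relation is divisible by A and determines C₂. This is why
  -- `Orbit` does not record C₂.
  C₂≡ : ∀ γ {b₁ b₂ κ₁ κ₂} → Plücker γ A (P * b₁) κ₁ A (Q * b₂) κ₂ → κ₂ ≡ - (κ₁ + + 2 * (b₁ * b₂))
  C₂≡ γ {b₁} {b₂} {κ₁} {κ₂} p = ℤₚ.*-cancelˡ-≡ A _ _ (begin
    A * κ₂                                                           ≡⟨ l₁ A κ₂ (+ 4 * (P * b₁) * (Q * b₂)) κ₁ ⟩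
    (A * κ₂ + + 4 * (P * b₁) * (Q * b₂) + κ₁ * A) - (+ 4 * (P * b₁) * (Q * b₂) + κ₁ * A)
      ≡⟨ cong₂ (λ u v → u - v) (plücker-relation γ p) (trans (cong (_+ κ₁ * A) (l₂ P b₁ Q b₂)) (cong (λ u → + 2 * u * (b₁ * b₂) + κ₁ * A) (sym A≡))) ⟩
    0ℤ - (+ 2 * A * (b₁ * b₂) + κ₁ * A)                              ≡⟨ l₃ A (b₁ * b₂) κ₁ ⟩
    A * (- (κ₁ + + 2 * (b₁ * b₂)))                                   ∎)
    where
    open ≡-Reasoning
    l₁ : ∀ A κ₂ m κ₁ → A * κ₂ ≡ (A * κ₂ + m + κ₁ * A) - (m + κ₁ * A)
    l₁ = solve-∀
    l₂ : ∀ P b Q b′ → + 4 * (P * b) * (Q * b′) ≡ + 2 * (+ 2 * (P * Q)) * (b * b′)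
    l₂ = solve-∀
    l₃ : ∀ A b κ → 0ℤ - (+ 2 * A * b + κ * A) ≡ A * (- (κ + + 2 * b))
    l₃ = solve-∀

  -- A right factor makes B₁, B₂ and C₁ agree; then C₂ agrees by `C₂≡`, and `Plücker-unique`
  -- supplies the left factor.
  Orbit⇒SameDoubleCoset : ∀ {a₁ a₂ c γ δ} → 𝕊 A A γ → 𝕊 A A δ → Orbit P Q A a₁ a₂ c γ → Orbit P Q A a₁ a₂ c δ → SameDoubleCoset γ δ
  Orbit⇒SameDoubleCoset {a₁} {a₂} {c} {γ} {δ} γ∈𝕊@((detγ , _) , _) δ∈𝕊@((detδ , _) , _) (orbit x y z B₁γ B₂γ C₁γ) (orbit x′ y′ z′ B₁δ B₂δ C₁δ) =
    conclude (Plücker-unique {γ = γ ∙ upper X Y Z} {δ = δ} (trans (det-∙-upper γ X Y Z) detγ) detδ Pγv Pδ′)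
    where
    -- The signs follow the shifts of B₁ by A X and of B₂ by - A Y. The correction x Y in Z arises
    -- because C₁ moves by 4 B₁ Y, where the actual B₁ is P (1 + 2 a₁) + A x.
    X = x′ - x
    Y = y - y′
    Z = z′ - z - x * Y
    β₁ = P * (1ℤ + + 2 * (+ a₁ + Q * x′))
    β₂ = Q * (1ℤ + + 2 * (+ a₂ + P * y′))
    κ₁ = + 4 * (+ c + A * z′ - P * (1ℤ + + 2 * + a₁) * y′) - 1ℤ
    rename-coordinates : ∀ γ {β₁ β₂ κ₁ κ₂ β₁′ β₂′ κ₁′ κ₂′} → Plücker γ A β₁ κ₁ A β₂ κ₂ → β₁ ≡ β₁′ → β₂ ≡ β₂′ → κ₁ ≡ κ₁′ → κ₂ ≡ κ₂′ → Plücker γ A β₁′ κ₁′ A β₂′ κ₂′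
    rename-coordinates γ p refl refl refl refl = p
    Pδ : Plücker δ A β₁ κ₁ A β₂ (C₂ δ)
    Pδ = rename-coordinates δ (𝕊⇒Plücker δ∈𝕊) B₁δ B₂δ C₁δ refl
    Pδ′ = rename-coordinates δ Pδ refl refl refl (C₂≡ δ {1ℤ + + 2 * (+ a₁ + Q * x′)} {1ℤ + + 2 * (+ a₂ + P * y′)} Pδ)
    lB₁ : ∀ P Q a x x′ → P * (1ℤ + + 2 * (a + Q * x)) + + 2 * (P * Q) * (x′ - x) ≡ P * (1ℤ + + 2 * (a + Q * x′))
    lB₁ = solve-∀
    lB₂ : ∀ P Q a y y′ → Q * (1ℤ + + 2 * (a + P * y)) - + 2 * (P * Q) * (y - y′) ≡ Q * (1ℤ + + 2 * (a + P * y′))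
    lB₂ = solve-∀
    lC₁ : ∀ P Q a c x y z y′ z′ → + 4 * (c + + 2 * (P * Q) * z - P * (1ℤ + + 2 * a) * y) - 1ℤ + + 4 * (+ 2 * (P * Q) * (z′ - z - x * (y - y′)) + P * (1ℤ + + 2 * (a + Q * x)) * (y - y′))
          ≡ + 4 * (c + + 2 * (P * Q) * z′ - P * (1ℤ + + 2 * a) * y′) - 1ℤ
    lC₁ = solve-∀
    Pγ′ = rename-coordinates (γ ∙ upper X Y Z) (Plücker-right γ (𝕊⇒Plücker γ∈𝕊) X Y Z)
      (trans (cong₂ (λ b α → b + α * X) B₁γ A≡) (lB₁ P Q (+ a₁) x x′))
      (trans (cong₂ (λ b α → b - α * Y) B₂γ A≡) (lB₂ P Q (+ a₂) y y′))
      (trans (cong₂ (λ b κ → κ + + 4 * (A * Z + b * Y)) B₁γ C₁γ)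
        (trans (cong (λ α → + 4 * (+ c + α * z - P * (1ℤ + + 2 * + a₁) * y) - 1ℤ + + 4 * (α * Z + P * (1ℤ + + 2 * (+ a₁ + Q * x)) * Y)) A≡)
        (trans (lC₁ P Q (+ a₁) (+ c) x y z y′ z′) (cong (λ α → + 4 * (+ c + α * z′ - P * (1ℤ + + 2 * + a₁) * y′) - 1ℤ) (sym A≡)))))
      refl
    Pγv = rename-coordinates (γ ∙ upper X Y Z) Pγ′ refl refl refl (C₂≡ (γ ∙ upper X Y Z) {1ℤ + + 2 * (+ a₁ + Q * x′)} {1ℤ + + 2 * (+ a₂ + P * y′)} Pγ′)
    conclude : (∃ λ u → Γ∞ u × u ∙ (γ ∙ upper X Y Z) ≡ δ) → SameDoubleCoset γ δ
    conclude (u , u∈Γ∞ , eq) = u , upper X Y Z , u∈Γ∞ , upper∈Γ∞ X Y Z , trans (∙-assoc u γ (upper X Y Z)) eq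

  -- The left factor preserves the coordinates, and the right factor changes only (x , y , z).
  Orbit-resp : ∀ {a₁ a₂ c γ δ} → 𝕊 A A γ → SameDoubleCoset γ δ → Orbit P Q A a₁ a₂ c γ → Orbit P Q A a₁ a₂ c δ
  Orbit-resp {a₁} {a₂} {c} {γ} γ∈𝕊 (u , (mat _ X Z _ _ Y _ _ _) , u∈Γ∞ , ((refl , refl , refl) , (refl , refl , refl)) , refl) (orbit x y z B₁γ B₂γ C₁γ) = orbit (x + X) (y - Y) (z + Z + x * Y)
    (trans (Plücker⇒B₁ δ Pδ) (trans (cong₂ (λ b α → b + α * X) B₁γ A≡) (lB₁ P Q (+ a₁) x X)))
    (trans (Plücker⇒B₂ δ Pδ) (trans (cong₂ (λ b α → b - α * Y) B₂γ A≡) (lB₂ P Q (+ a₂) y Y)))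
    (trans (Plücker⇒C₁ δ Pδ) (trans (cong₂ (λ b κ → κ + + 4 * (A * Z + b * Y)) B₁γ C₁γ)
        (trans (cong (λ α → + 4 * (+ c + α * z - P * (1ℤ + + 2 * + a₁) * y) - 1ℤ + + 4 * (α * Z + P * (1ℤ + + 2 * (+ a₁ + Q * x)) * Y)) A≡)
        (trans (lC₁ P Q (+ a₁) (+ c) x y z Y Z) (cong (λ α → + 4 * (+ c + α * (z + Z + x * Y) - P * (1ℤ + + 2 * + a₁) * (y - Y)) - 1ℤ) (sym A≡))))))
    where
    δ = u ∙ γ ∙ upper X Y Z
    Pδ = Plücker-right (u ∙ γ) (Plücker-left γ (𝕊⇒Plücker γ∈𝕊) u u∈Γ∞) X Y Z
    lB₁ : ∀ P Q a x X → P * (1ℤ + + 2 * (a + Q * x)) + + 2 * (P * Q) * X ≡ P * (1ℤ + + 2 * (a + Q * (x + X)))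
    lB₁ = solve-∀
    lB₂ : ∀ P Q a y Y → Q * (1ℤ + + 2 * (a + P * y)) - + 2 * (P * Q) * Y ≡ Q * (1ℤ + + 2 * (a + P * (y - Y)))
    lB₂ = solve-∀
    lC₁ : ∀ P Q a c x y z Y Z → + 4 * (c + + 2 * (P * Q) * z - P * (1ℤ + + 2 * a) * y) - 1ℤ + + 4 * (+ 2 * (P * Q) * Z + P * (1ℤ + + 2 * (a + Q * x)) * Y)
          ≡ + 4 * (c + + 2 * (P * Q) * (z + Z + x * Y) - P * (1ℤ + + 2 * a) * (y - Y)) - 1ℤ
    lC₁ = solve-∀

-- For n = 0 the second factor vanishes; otherwise the first one is even.
2^n*n-even : ∀ n → ∃ λ w → + (2 ℕ.^ n) * + n ≡ + 2 * w
2^n*n-even zero    = 0ℤ , refl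
2^n*n-even (suc n) = + (2 ℕ.^ n) * + suc n , trans (cong (_* + suc n) (ℤₚ.pos-* 2 (2 ℕ.^ n))) (ℤₚ.*-assoc (+ 2) (+ (2 ℕ.^ n)) (+ suc n))

-- The exponent of s depends only on the orbit, because P i and Q j are even.
exponent-invariant : ∀ P Q A i j a₁ a₂ c x y z v w → A ≡ + 2 * (P * Q) → P * i ≡ + 2 * v → Q * j ≡ + 2 * w →
  let α₁ = a₁ + Q * x; α₂ = a₂ + P * y; c₁ = c + A * z - P * (1ℤ + + 2 * a₁) * y
      c₂ = - (c₁ + α₁ + α₂ + + 2 * (α₁ * α₂)) in
  sgn (α₁ + i * c₁ + (1ℤ + j) * c₂) ≡ sgn ((+ 2 + j) * a₁ + (1ℤ + j) * a₂ + (1ℤ + i + j) * c)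
exponent-invariant P Q A i j a₁ a₂ c x y z v w refl Pi≡ Qj≡ = trans (cong sgn exponent) (sgn-+2* base rest)
  where
  open ≡-Reasoning
  α₁ = a₁ + Q * x
  α₂ = a₂ + P * y
  c₁ = c + + 2 * (P * Q) * z - P * (1ℤ + + 2 * a₁) * y
  c₂ = - (c₁ + α₁ + α₂ + + 2 * (α₁ * α₂))
  base = (+ 2 + j) * a₁ + (1ℤ + j) * a₂ + (1ℤ + i + j) * c
  E = (1ℤ + j) * (c₁ + α₁ + α₂ + α₁ * α₂)
  F = (1ℤ + i + j) * (P * Q * z - P * a₁ * y)
  rest = (Q * x + w * x) - v * y + F - E
  exponent : α₁ + i * c₁ + (1ℤ + j) * c₂ ≡ base + + 2 * rest
  exponent = begin
    α₁ + i * c₁ + (1ℤ + j) * c₂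
      ≡⟨ l₁ i j c₁ α₁ α₂ ⟩
    ((+ 2 + j) * α₁ + (1ℤ + j) * α₂ + (1ℤ + i + j) * c₁) + + 2 * (- E)
      ≡⟨ l₂ i j a₁ a₂ c P Q x y z E ⟩
    base + (Q * j * x - P * i * y + + 2 * (Q * x + F - E))
      ≡⟨ cong₂ (λ q p → base + (q * x - p * y + + 2 * (Q * x + F - E))) Qj≡ Pi≡ ⟩
    base + (+ 2 * w * x - + 2 * v * y + + 2 * (Q * x + F - E))
      ≡⟨ l₃ base w x v y (Q * x) F E ⟩
    base + + 2 * rest ∎
    where
    l₁ : ∀ i j c a a′ → a + i * c + (1ℤ + j) * (- (c + a + a′ + + 2 * (a * a′))) ≡ ((+ 2 + j) * a + (1ℤ + j) * a′ + (1ℤ + i + j) * c) + + 2 * (- ((1ℤ + j) * (c + a + a′ + a * a′)))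
    l₁ = solve-∀
    l₂ : ∀ i j a a′ c P Q x y z E → ((+ 2 + j) * (a + Q * x) + (1ℤ + j) * (a′ + P * y) + (1ℤ + i + j) * (c + + 2 * (P * Q) * z - P * (1ℤ + + 2 * a) * y)) + + 2 * (- E)
      ≡ ((+ 2 + j) * a + (1ℤ + j) * a′ + (1ℤ + i + j) * c) + (Q * j * x - P * i * y + + 2 * (Q * x + (1ℤ + i + j) * (P * Q * z - P * a * y) - E))
    l₂ = solve-∀
    l₃ : ∀ b w x v y q r e → b + (+ 2 * w * x - + 2 * v * y + + 2 * (q + r - e)) ≡ b + + 2 * ((q + w * x) - v * y + r - e)
    l₃ = solve-∀

module _ (P Q A : ℤ) .{{_ : ℤ.NonZero A}} (A≡ : A ≡ + 2 * (P * Q)) where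

  Orbit⇒C₂ : ∀ {a₁ a₂ c} γ → 𝕊 A A γ → (O : Orbit P Q A a₁ a₂ c γ) → let open Orbit O in
    C₂ γ ≡ + 4 * (- ((+ c + A * z - P * (1ℤ + + 2 * + a₁) * y) + (+ a₁ + Q * x) + (+ a₂ + P * y) + + 2 * ((+ a₁ + Q * x) * (+ a₂ + P * y)))) - 1ℤ
  Orbit⇒C₂ {a₁} {a₂} {c} γ γ∈𝕊 (orbit x y z B₁≡ B₂≡ C₁≡) = trans (C₂≡ P Q A A≡ γ {1ℤ + + 2 * α₁} {1ℤ + + 2 * α₂} p) (lem c₁ α₁ α₂)
    where
    α₁ = + a₁ + Q * x
    α₂ = + a₂ + P * y
    c₁ = + c + A * z - P * (1ℤ + + 2 * + a₁) * y
    rename-coordinates : ∀ {β₁ β₂ κ₁ κ₂ β₁′ β₂′ κ₁′} → Plücker γ A β₁ κ₁ A β₂ κ₂ → β₁ ≡ β₁′ → β₂ ≡ β₂′ → κ₁ ≡ κ₁′ → Plücker γ A β₁′ κ₁′ A β₂′ κ₂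
    rename-coordinates p refl refl refl = p
    p : Plücker γ A (P * (1ℤ + + 2 * α₁)) (+ 4 * c₁ - 1ℤ) A (Q * (1ℤ + + 2 * α₂)) (C₂ γ)
    p = rename-coordinates (𝕊⇒Plücker P Q A A≡ γ∈𝕊) B₁≡ B₂≡ C₁≡
    lem : ∀ c a a′ → - (+ 4 * c - 1ℤ + + 2 * ((1ℤ + + 2 * a) * (1ℤ + + 2 * a′))) ≡ + 4 * (- (c + a + a′ + + 2 * (a * a′))) - 1ℤ
    lem = solve-∀

s-Orbit : ∀ i j {a₁ a₂ c} γ → let A = + (2 ℕ.^ suc (i ℕ.+ j)) in 𝕊 A A γ → Orbit (+ (2 ℕ.^ i)) (+ (2 ℕ.^ j)) A a₁ a₂ c γ →
  s γ ≡ sgn ((+ 2 + + j) * + a₁ + (1ℤ + + j) * + a₂ + (1ℤ + + i + + j) * + c)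
s-Orbit i j {a₁} {a₂} {c} γ γ∈𝕊@(_ , A₁≡ , A₂≡) O@(orbit x y z B₁≡ B₂≡ C₁≡) =
  trans (s-value {i} {j} {γ} {α₁} {c₁} {c₂} A₁≡ A₂≡ B₁≡ C₁≡ (Orbit⇒C₂ P Q A {{2^≢0 (suc (i ℕ.+ j))}} A≡ γ γ∈𝕊 O))
    (exponent-invariant P Q A (+ i) (+ j) (+ a₁) (+ a₂) (+ c) x y z (proj₁ Pi-even) (proj₁ Qj-even) A≡ (proj₂ Pi-even) (proj₂ Qj-even))
  where
  P = + (2 ℕ.^ i)
  Q = + (2 ℕ.^ j)
  A = + (2 ℕ.^ suc (i ℕ.+ j))
  A≡ : A ≡ + 2 * (P * Q)
  A≡ = pos-2^-suc i j
  Pi-even = 2^n*n-even i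
  Qj-even = 2^n*n-even j
  α₁ = + a₁ + Q * x
  α₂ = + a₂ + P * y
  c₁ = + c + A * z - P * (1ℤ + + 2 * + a₁) * y
  c₂ = - (c₁ + α₁ + α₂ + + 2 * (α₁ * α₂))

-- Every element of 𝕊 (2ᵏ , 2ᵏ) lies in exactly one orbit

even≢odd : ∀ v w → + 2 * v ≢ 1ℤ + + 2 * w
even≢odd v w eq with trans (sym (sgn-even v)) (trans (cong sgn eq) (sgn-odd w))
... | ()

2^suc-* : ∀ n x → + (2 ℕ.^ suc n) * x ≡ + 2 * (+ (2 ℕ.^ n) * x)
2^suc-* n x = trans (cong (_* x) (ℤₚ.pos-* 2 (2 ℕ.^ n))) (ℤₚ.*-assoc (+ 2) (+ (2 ℕ.^ n)) x)

*-even : ∀ v u → v * (+ 2 * u) ≡ + 2 * (v * u)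
*-even = solve-∀

odd*odd : ∀ v u → (1ℤ + + 2 * v) * (1ℤ + + 2 * u) ≡ 1ℤ + + 2 * (v + u + + 2 * (v * u))
odd*odd = solve-∀

-- Induction on n: an even factor is halved and its exponent raised by 1. By parity of the product,
-- both factors are odd exactly when n = 0.
split-2^ : ∀ n x y w → x * y ≡ + (2 ℕ.^ n) * (1ℤ + + 2 * w) →
  ∃₂ λ i j → n ≡ i ℕ.+ j × ∃₂ λ a b → x ≡ + (2 ℕ.^ i) * (1ℤ + + 2 * a) × y ≡ + (2 ℕ.^ j) * (1ℤ + + 2 * b)
split-2^ n x y w eq with parity x | parity y
split-2^ zero    _ y w eq | even v | _      = contradiction (trans (sym (ℤₚ.*-assoc (+ 2) v y)) (trans eq (ℤₚ.*-identityˡ _))) (even≢odd (v * y) w)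
split-2^ zero    x _ w eq | odd v  | even u = contradiction (trans (sym (*-even x u)) (trans eq (ℤₚ.*-identityˡ _))) (even≢odd (x * u) w)
split-2^ zero    _ _ w eq | odd v  | odd u  = 0 , 0 , refl , v , u , sym (ℤₚ.*-identityˡ _) , sym (ℤₚ.*-identityˡ _)
split-2^ (suc n) _ y w eq | even v | _
  with i , j , refl , a , b , refl , y≡ ← split-2^ n v y w (ℤₚ.*-cancelˡ-≡ (+ 2) (v * y) _ (trans (sym (ℤₚ.*-assoc (+ 2) v y)) (trans eq (2^suc-* n (1ℤ + + 2 * w))))) =
  suc i , j , refl , a , b , sym (2^suc-* i (1ℤ + + 2 * a)) , y≡
split-2^ (suc n) x _ w eq | odd v  | even u
  with i , j , refl , a , b , x≡ , refl ← split-2^ n x u w (ℤₚ.*-cancelˡ-≡ (+ 2) (x * u) _ (trans (sym (*-even x u)) (trans eq (2^suc-* n (1ℤ + + 2 * w))))) =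
  i , suc j , sym (ℕₚ.+-suc i j) , a , b , x≡ , sym (2^suc-* j (1ℤ + + 2 * b))
split-2^ (suc n) _ _ w eq | odd v  | odd u  =
  contradiction (sym (trans (sym (odd*odd v u)) (trans eq (2^suc-* n (1ℤ + + 2 * w))))) (even≢odd _ (v + u + + 2 * (v * u)))

valuation-unique : ∀ i j a b → + (2 ℕ.^ i) * (1ℤ + + 2 * a) ≡ + (2 ℕ.^ j) * (1ℤ + + 2 * b) → i ≡ j
valuation-unique zero    zero    _ _ _ = refl
valuation-unique zero    (suc j) a b eq = contradiction (sym (trans (sym (ℤₚ.*-identityˡ (1ℤ + + 2 * a))) (trans eq (2^suc-* j (1ℤ + + 2 * b))))) (even≢odd _ a)
valuation-unique (suc i) zero    a b eq = sym (valuation-unique zero (suc i) b a (sym eq))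
valuation-unique (suc i) (suc j) a b eq = cong suc (valuation-unique i j a b (ℤₚ.*-cancelˡ-≡ (+ 2) _ _ (trans (sym (2^suc-* i (1ℤ + + 2 * a))) (trans eq (2^suc-* j (1ℤ + + 2 * b))))))

divMod : ∀ z n .{{_ : ℕ.NonZero n}} → ∃₂ λ r q → r ℕ.< n × z ≡ + r + + n * q
divMod z n = z %ℕ n , z /ℕ n , n%ℕd<d z n , trans (a≡a%ℕn+[a/ℕn]*n z n) (cong (λ w → + (z %ℕ n) + w) (ℤₚ.*-comm (z /ℕ n) (+ n)))

divMod-unique : ∀ {n r r′} q q′ .{{_ : ℕ.NonZero n}} → r ℕ.< n → r′ ℕ.< n → + r + + n * q ≡ + r′ + + n * q′ → r ≡ r′ × q ≡ q′
divMod-unique {n} {r} {r′} q q′ r<n r′<n eq with residue-unique r<n r′<n (multiple (q′ - q) (lem (+ r) (+ r′) (+ n) eq))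
  where
  lem : ∀ r r′ n → r + n * q ≡ r′ + n * q′ → r - r′ ≡ (q′ - q) * n
  lem r r′ n eq = trans (l₁ r r′ n q) (trans (cong (λ w → w - r′ - n * q) eq) (l₂ r′ n q q′))
    where
    l₁ : ∀ r r′ n q → r - r′ ≡ r + n * q - r′ - n * q
    l₁ = solve-∀
    l₂ : ∀ r′ n q q′ → r′ + n * q′ - r′ - n * q ≡ (q′ - q) * n
    l₂ = solve-∀
... | refl = refl , ℤₚ.*-cancelˡ-≡ (+ n) q q′ (+-cancelˡ (+ r) (+ n * q) (+ n * q′) eq)

-- With C₁ = 4 c₁ - 1 and C₂ = 4 c₂ - 1 the Plücker relation reads 4 B₁ B₂ = - 2 N (4 (c₁ + c₂) -
-- 2), so B₁ B₂ is N times the odd number 1 - 2 (c₁ + c₂).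
B₁B₂≡ : ∀ N A γ → .{{_ : ℤ.NonZero N}} → A ≡ + 2 * N → Γ γ → Plücker γ A (B₁ γ) (C₁ γ) A (B₂ γ) (C₂ γ) → ∃ λ w → B₁ γ * B₂ γ ≡ N * (1ℤ + + 2 * w)
B₁B₂≡ N _ γ refl γ∈Γ p with c₁ , C₁≡ ← C₁-form {γ} γ∈Γ | c₂ , C₂≡ ← C₂-form {γ} γ∈Γ = - (c₁ + c₂) , ℤₚ.*-cancelˡ-≡ (+ 4) _ _ (begin
  + 4 * (B₁ γ * B₂ γ)       ≡⟨ l₁ N (B₁ γ) (B₂ γ) (C₁ γ) (C₂ γ) ⟩
  (+ 2 * N * C₂ γ + + 4 * B₁ γ * B₂ γ + C₁ γ * (+ 2 * N)) - + 2 * N * (C₁ γ + C₂ γ)  ≡⟨ cong₂ (λ u v → u - + 2 * N * v) (plücker-relation γ p) (cong₂ _+_ C₁≡ C₂≡) ⟩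
  0ℤ - + 2 * N * (+ 4 * c₁ - 1ℤ + (+ 4 * c₂ - 1ℤ)) ≡⟨ l₂ N c₁ c₂ ⟩
  + 4 * (N * (1ℤ + + 2 * (- (c₁ + c₂)))) ∎)
  where
  open ≡-Reasoning
  l₁ : ∀ N b b′ c c′ → + 4 * (b * b′) ≡ (+ 2 * N * c′ + + 4 * b * b′ + c * (+ 2 * N)) - + 2 * N * (c + c′)
  l₁ = solve-∀
  l₂ : ∀ N c c′ → 0ℤ - + 2 * N * (+ 4 * c - 1ℤ + (+ 4 * c′ - 1ℤ)) ≡ + 4 * (N * (1ℤ + + 2 * (- (c + c′))))
  l₂ = solve-∀

orbit-exists : ∀ n γ → let A = + (2 ℕ.^ suc n) in 𝕊 A A γ → ∃₂ λ i j → n ≡ i ℕ.+ j × ∃₂ λ a₁ a₂ → ∃ λ c →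
  a₁ ℕ.< 2 ℕ.^ j × a₂ ℕ.< 2 ℕ.^ i × c ℕ.< 2 ℕ.^ suc n × Orbit (+ (2 ℕ.^ i)) (+ (2 ℕ.^ j)) A a₁ a₂ c γ
-- The exponents i and j are not known yet; `𝕊⇒Plücker` accepts any factorisation A = 2 P Q, and P =
-- 2ⁿ, Q = 1 will do.
orbit-exists n γ γ∈𝕊@(γ∈Γ , _) with B₁B₂≡ (+ (2 ℕ.^ n)) (+ (2 ℕ.^ suc n)) γ {{2^≢0 n}} (ℤₚ.pos-* 2 (2 ℕ.^ n)) γ∈Γ (𝕊⇒Plücker (+ (2 ℕ.^ n)) 1ℤ (+ (2 ℕ.^ suc n)) {{2^≢0 (suc n)}} (trans (ℤₚ.pos-* 2 (2 ℕ.^ n)) (cong (+ 2 *_) (sym (ℤₚ.*-identityʳ (+ (2 ℕ.^ n)))))) γ∈𝕊)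
... | w , B₁B₂ with split-2^ n (B₁ γ) (B₂ γ) w B₁B₂ | C₁-form {γ} γ∈Γ
... | i , j , n≡ , α₁ , α₂ , B₁≡ , B₂≡ | c₁ , C₁≡
  with divMod α₁ (2 ℕ.^ j) {{2^≢0 j}} | divMod α₂ (2 ℕ.^ i) {{2^≢0 i}}
... | a₁ , x , a₁< , α₁≡ | a₂ , y , a₂< , α₂≡
  -- The y that reduces B₂ also moves C₁; the term P (1 + 2 a₁) y is added back before c₁ is
  -- reduced.
  with divMod (c₁ + + (2 ℕ.^ i) * (1ℤ + + 2 * + a₁) * y) (2 ℕ.^ suc n) {{2^≢0 (suc n)}}
... | c , z , c< , c₁≡ =
  i , j , n≡ , a₁ , a₂ , c , a₁< , a₂< , c< ,
  orbit x y z (trans B₁≡ (cong (λ α → + (2 ℕ.^ i) * (1ℤ + + 2 * α)) α₁≡)) (trans B₂≡ (cong (λ α → + (2 ℕ.^ j) * (1ℤ + + 2 * α)) α₂≡))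
    (trans C₁≡ (cong (λ κ → + 4 * κ - 1ℤ) (trans (lem c₁ _) (cong (_- + (2 ℕ.^ i) * (1ℤ + + 2 * + a₁) * y) c₁≡))))
  where
  lem : ∀ c w → c ≡ c + w - w
  lem = solve-∀

odd-part-unique : ∀ p .{{_ : ℕ.NonZero p}} {u v} → + p * (1ℤ + + 2 * u) ≡ + p * (1ℤ + + 2 * v) → u ≡ v
odd-part-unique p {u} {v} eq = ℤₚ.*-cancelˡ-≡ (+ 2) u v (+-cancelˡ 1ℤ (+ 2 * u) (+ 2 * v) (ℤₚ.*-cancelˡ-≡ (+ p) (1ℤ + + 2 * u) (1ℤ + + 2 * v) eq))

cancel-C₁ : ∀ w {u v} → + 4 * (u - w) - 1ℤ ≡ + 4 * (v - w) - 1ℤ → u ≡ v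
cancel-C₁ w {u} {v} eq = +-cancelʳ (- w) u v (ℤₚ.*-cancelˡ-≡ (+ 4) (u - w) (v - w) (+-cancelʳ (- 1ℤ) (+ 4 * (u - w)) (+ 4 * (v - w)) eq))

-- The data are recovered in this order: i as the valuation of B₁, then j, then a₁ from B₁, a₂ and y
-- from B₂, and finally c from C₁, where y has to be known already.
orbit-unique : ∀ {i j i′ j′ a₁ a₂ c a₁′ a₂′ c′} n γ → n ≡ i ℕ.+ j → n ≡ i′ ℕ.+ j′ →
  a₁ ℕ.< 2 ℕ.^ j → a₂ ℕ.< 2 ℕ.^ i → c ℕ.< 2 ℕ.^ suc n → a₁′ ℕ.< 2 ℕ.^ j′ → a₂′ ℕ.< 2 ℕ.^ i′ → c′ ℕ.< 2 ℕ.^ suc n →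
  Orbit (+ (2 ℕ.^ i)) (+ (2 ℕ.^ j)) (+ (2 ℕ.^ suc n)) a₁ a₂ c γ → Orbit (+ (2 ℕ.^ i′)) (+ (2 ℕ.^ j′)) (+ (2 ℕ.^ suc n)) a₁′ a₂′ c′ γ →
  (i , a₁ , a₂ , c) ≡ (i′ , a₁′ , a₂′ , c′)
orbit-unique {i} {j} {i′} {j′} {a₁} {a₂} {c} {a₁′} {a₂′} {c′} n γ n≡ n≡′ a₁< a₂< c< a₁<′ a₂<′ c<′ (orbit x y z B₁≡ B₂≡ C₁≡) (orbit x′ y′ z′ B₁≡′ B₂≡′ C₁≡′)
  with refl ← valuation-unique i i′ (+ a₁ + + (2 ℕ.^ j) * x) (+ a₁′ + + (2 ℕ.^ j′) * x′) (trans (sym B₁≡) B₁≡′)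
  with refl ← ℕₚ.+-cancelˡ-≡ i j j′ (trans (sym n≡) n≡′)
  with refl , refl ← divMod-unique {2 ℕ.^ j} {a₁} {a₁′} x x′ {{2^≢0 j}} a₁< a₁<′ (odd-part-unique (2 ℕ.^ i) {{2^≢0 i}} (trans (sym B₁≡) B₁≡′))
  with refl , refl ← divMod-unique {2 ℕ.^ i} {a₂} {a₂′} y y′ {{2^≢0 i}} a₂< a₂<′ (odd-part-unique (2 ℕ.^ j) {{2^≢0 j}} (trans (sym B₂≡) B₂≡′))
  with refl , refl ← divMod-unique {2 ℕ.^ suc n} {c} {c′} z z′ {{2^≢0 (suc n)}} c< c<′
         (cancel-C₁ (+ (2 ℕ.^ i) * (1ℤ + + 2 * + a₁) * y) (trans (sym C₁≡) C₁≡′)) = refl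
--

-- Representatives

-- A row r₃ with w · r₃ = 1 and a vector N of minors with N · r₃ = 0 are
-- completed by r₂ = w × N; here w = (w₁ , 0 , w₃), N = (1 - 4 c₂ , -4 β₂ , -4 A)
-- and the first row is (p , 0 , q).
completion : (A β₁ β₂ c₁ c₂ w₁ t₃ q r : ℤ) → Mat
completion A β₁ β₂ c₁ c₂ w₁ t₃ q r = mat
  (1ℤ + + 4 * r)              0ℤ                                  q
  (+ 4 * ((1ℤ + + 4 * t₃) * β₂)) ((1ℤ + + 4 * t₃) * (1ℤ - + 4 * c₂) + + 4 * (w₁ * A)) (- (+ 4 * (w₁ * β₂)))
  (- (+ 4 * A))               (- (+ 4 * β₁))                      (1ℤ - + 4 * c₁)

-- The minors are (w × N) × r₃ = (w · r₃) N - (N · r₃) w. Here `bézout₃` is w · r₃ = 1, and `rel` is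
-- N · r₃ = 0 up to a factor 4, so the minors form N. The product of the first row with N is the
-- determinant, which is 1 by `bézout₁`.
module _ (A β₁ β₂ c₁ c₂ w₁ t₃ q r : ℤ)
  (rel : + 4 * (β₁ * β₂) ≡ A * (+ 2 - + 4 * c₁ - + 4 * c₂))
  (bézout₃ : (1ℤ + + 4 * t₃) * (1ℤ - + 4 * c₁) - + 4 * (w₁ * A) ≡ 1ℤ)
  (bézout₁ : (1ℤ + + 4 * r) * (1ℤ - + 4 * c₂) - + 4 * (q * A) ≡ 1ℤ) where

  private
    γ = completion A β₁ β₂ c₁ c₂ w₁ t₃ q r
    open Mat γ
    w₃ = 1ℤ + + 4 * t₃

  completion-minor₁ : d * h - e * g ≡ - (+ 4 * A)
  completion-minor₁ = begin
    + 4 * (w₃ * β₂) * (- (+ 4 * β₁)) - (w₃ * (1ℤ - + 4 * c₂) + + 4 * (w₁ * A)) * (- (+ 4 * A))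
      ≡⟨ l₁ A β₁ β₂ c₁ c₂ w₁ w₃ ⟩
    - (+ 4 * A) * (w₃ * (1ℤ - + 4 * c₁) - + 4 * (w₁ * A)) - + 4 * w₃ * (+ 4 * (β₁ * β₂) - A * (+ 2 - + 4 * c₁ - + 4 * c₂))
      ≡⟨ cong₂ (λ x y → - (+ 4 * A) * x - + 4 * w₃ * (y - A * (+ 2 - + 4 * c₁ - + 4 * c₂))) bézout₃ rel ⟩
    - (+ 4 * A) * 1ℤ - + 4 * w₃ * (A * (+ 2 - + 4 * c₁ - + 4 * c₂) - A * (+ 2 - + 4 * c₁ - + 4 * c₂))
      ≡⟨ l₂ (- (+ 4 * A)) (+ 4 * w₃) (A * (+ 2 - + 4 * c₁ - + 4 * c₂)) ⟩
    - (+ 4 * A) ∎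
    where
    open ≡-Reasoning
    l₁ : ∀ A β₁ β₂ c₁ c₂ w₁ w₃ → + 4 * (w₃ * β₂) * (- (+ 4 * β₁)) - (w₃ * (1ℤ - + 4 * c₂) + + 4 * (w₁ * A)) * (- (+ 4 * A))
       ≡ - (+ 4 * A) * (w₃ * (1ℤ - + 4 * c₁) - + 4 * (w₁ * A)) - + 4 * w₃ * (+ 4 * (β₁ * β₂) - A * (+ 2 - + 4 * c₁ - + 4 * c₂))
    l₁ = solve-∀
    l₂ : ∀ x y z → x * 1ℤ - y * (z - z) ≡ x
    l₂ = solve-∀

  completion-minor₂ : d * i - f * g ≡ + 4 * β₂
  completion-minor₂ = trans (lem A β₂ c₁ w₁ w₃) (trans (cong (+ 4 * β₂ *_) bézout₃) (ℤₚ.*-identityʳ (+ 4 * β₂)))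
    where
    lem : ∀ A β₂ c₁ w₁ w₃ → + 4 * (w₃ * β₂) * (1ℤ - + 4 * c₁) - (- (+ 4 * (w₁ * β₂))) * (- (+ 4 * A)) ≡ + 4 * β₂ * (w₃ * (1ℤ - + 4 * c₁) - + 4 * (w₁ * A))
    lem = solve-∀

  completion-minor₃ : e * i - f * h ≡ 1ℤ - + 4 * c₂
  completion-minor₃ = begin
    (w₃ * (1ℤ - + 4 * c₂) + + 4 * (w₁ * A)) * (1ℤ - + 4 * c₁) - (- (+ 4 * (w₁ * β₂))) * (- (+ 4 * β₁))
      ≡⟨ l₁ A β₁ β₂ c₁ c₂ w₁ w₃ ⟩
    (1ℤ - + 4 * c₂) * (w₃ * (1ℤ - + 4 * c₁) - + 4 * (w₁ * A)) - + 4 * w₁ * (+ 4 * (β₁ * β₂) - A * (+ 2 - + 4 * c₁ - + 4 * c₂))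
      ≡⟨ cong₂ (λ x y → (1ℤ - + 4 * c₂) * x - + 4 * w₁ * (y - A * (+ 2 - + 4 * c₁ - + 4 * c₂))) bézout₃ rel ⟩
    (1ℤ - + 4 * c₂) * 1ℤ - + 4 * w₁ * (A * (+ 2 - + 4 * c₁ - + 4 * c₂) - A * (+ 2 - + 4 * c₁ - + 4 * c₂))
      ≡⟨ l₂ (1ℤ - + 4 * c₂) (+ 4 * w₁) (A * (+ 2 - + 4 * c₁ - + 4 * c₂)) ⟩
    1ℤ - + 4 * c₂ ∎
    where
    open ≡-Reasoning
    l₁ : ∀ A β₁ β₂ c₁ c₂ w₁ w₃ → (w₃ * (1ℤ - + 4 * c₂) + + 4 * (w₁ * A)) * (1ℤ - + 4 * c₁) - (- (+ 4 * (w₁ * β₂))) * (- (+ 4 * β₁))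
      ≡ (1ℤ - + 4 * c₂) * (w₃ * (1ℤ - + 4 * c₁) - + 4 * (w₁ * A)) - + 4 * w₁ * (+ 4 * (β₁ * β₂) - A * (+ 2 - + 4 * c₁ - + 4 * c₂))
    l₁ = solve-∀
    l₂ : ∀ x y z → x * 1ℤ - y * (z - z) ≡ x
    l₂ = solve-∀

  completion-det : det γ ≡ 1ℤ
  completion-det = trans (cong₂ (λ x y → (1ℤ + + 4 * r) * x - 0ℤ * (d * i - f * g) + q * y) completion-minor₃ completion-minor₁) (trans (lem r q A c₂ (d * i - f * g)) bézout₁)
    where
    lem : ∀ r q A c m → (1ℤ + + 4 * r) * (1ℤ - + 4 * c) - 0ℤ * m + q * (- (+ 4 * A)) ≡ (1ℤ + + 4 * r) * (1ℤ - + 4 * c) - + 4 * (q * A)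
    lem = solve-∀

  completion∈Γ : Γ γ
  completion∈Γ = completion-det , (divides r (l₁ r) , divides (t₃ - c₂ - + 4 * (t₃ * c₂) + w₁ * A) (l₂ t₃ c₂ (w₁ * A)) , divides (- c₁) (l₃ c₁)) ,
    (divides (w₃ * β₂) (l₄ (w₃ * β₂)) , divides (- A) (l₅ A) , divides (- β₁) (l₅ β₁))
    where
    l₁ : ∀ r → 1ℤ + + 4 * r - 1ℤ ≡ r * + 4
    l₁ = solve-∀
    l₂ : ∀ t c m → (1ℤ + + 4 * t) * (1ℤ - + 4 * c) + + 4 * m - 1ℤ ≡ (t - c - + 4 * (t * c) + m) * + 4
    l₂ = solve-∀
    l₃ : ∀ c → 1ℤ - + 4 * c - 1ℤ ≡ (- c) * + 4
    l₃ = solve-∀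
    l₄ : ∀ x → + 4 * x - 0ℤ ≡ x * + 4
    l₄ = solve-∀
    l₅ : ∀ x → - (+ 4 * x) - 0ℤ ≡ (- x) * + 4
    l₅ = solve-∀

  completion-Plücker : Plücker γ A β₁ (+ 4 * c₁ - 1ℤ) A β₂ (+ 4 * c₂ - 1ℤ)
  completion-Plücker = record
    { g≡ = refl ; h≡ = refl ; i≡ = lem c₁ ; dh-eg≡ = completion-minor₁ ; di-fg≡ = completion-minor₂ ; ei-fh≡ = trans completion-minor₃ (lem c₂) }
    where
    lem : ∀ c → 1ℤ - + 4 * c ≡ - (+ 4 * c - 1ℤ)
    lem = solve-∀

-- (1 - x) (1 + x + ⋯ + xⁿ⁻¹) = 1 - xⁿ inverts 1 - 4 c modulo a power of 2.
geometric : ℤ → ℕ → ℤ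
geometric x zero    = 0ℤ
geometric x (suc n) = 1ℤ + x * geometric x n

geometric-sum : ∀ x n → geometric x n * (1ℤ - x) ≡ 1ℤ - x ^ℤ n
geometric-sum x zero    = lem x
  where
  lem : ∀ x → 0ℤ * (1ℤ - x) ≡ 1ℤ - 1ℤ
  lem = solve-∀
geometric-sum x (suc n) = trans (l₁ x (geometric x n)) (trans (cong (λ w → 1ℤ - x + x * w) (geometric-sum x n)) (l₂ x (x ^ℤ n)))
  where
  l₁ : ∀ x g → (1ℤ + x * g) * (1ℤ - x) ≡ 1ℤ - x + x * (g * (1ℤ - x))
  l₁ = solve-∀
  l₂ : ∀ x y → 1ℤ - x + x * (1ℤ - y) ≡ 1ℤ - x * y
  l₂ = solve-∀

-- The power 4^(k + 1) is split as 4 · 2ᵏ · 2ᵏ: one 2ᵏ is the A of the Bézout relations, the other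
-- goes into the coefficient.
[4*c]^ℤ : ∀ k c → (+ 4 * c) ^ℤ suc k ≡ + 4 * (+ (2 ℕ.^ k) * c ^ℤ suc k * + (2 ℕ.^ k))
[4*c]^ℤ zero    c = lem c
  where
  lem : ∀ c → + 4 * c * 1ℤ ≡ + 4 * (1ℤ * (c * 1ℤ) * 1ℤ)
  lem = solve-∀
[4*c]^ℤ (suc k) c = trans (cong (+ 4 * c *_) ([4*c]^ℤ k c)) (trans (lem c (+ (2 ℕ.^ k)) (c ^ℤ suc k)) (cong (λ w → + 4 * (w * (c * c ^ℤ suc k) * w)) (sym (ℤₚ.pos-* 2 (2 ℕ.^ k)))))
  where
  lem : ∀ c p d → + 4 * c * (+ 4 * (p * d * p)) ≡ + 4 * (+ 2 * p * (c * d) * (+ 2 * p))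
  lem = solve-∀

-- The first factor is the geometric sum of k + 1 terms, which inverts 1 - 4 c up to (4 c)^(k + 1);
-- the second product cancels that remainder. The relation serves for the third row with c₁ and for
-- the first row with c₂.
bézout : ∀ k c → (1ℤ + + 4 * (c * geometric (+ 4 * c) k)) * (1ℤ - + 4 * c) - + 4 * ((- (+ (2 ℕ.^ k) * c ^ℤ suc k)) * + (2 ℕ.^ k)) ≡ 1ℤ
bézout k c = begin
  (1ℤ + + 4 * (c * geometric (+ 4 * c) k)) * (1ℤ - + 4 * c) - + 4 * ((- u) * p)
    ≡⟨ l₁ c (geometric (+ 4 * c) k) u p ⟩
  geometric (+ 4 * c) (suc k) * (1ℤ - + 4 * c) + + 4 * (u * p)
    ≡⟨ cong₂ _+_ (geometric-sum (+ 4 * c) (suc k)) (sym ([4*c]^ℤ k c)) ⟩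
  1ℤ - (+ 4 * c) ^ℤ suc k + (+ 4 * c) ^ℤ suc k
    ≡⟨ l₂ ((+ 4 * c) ^ℤ suc k) ⟩
  1ℤ ∎
  where
  open ≡-Reasoning
  p = + (2 ℕ.^ k)
  u = + (2 ℕ.^ k) * c ^ℤ suc k
  l₁ : ∀ c g u p → (1ℤ + + 4 * (c * g)) * (1ℤ - + 4 * c) - + 4 * ((- u) * p) ≡ (1ℤ + + 4 * c * g) * (1ℤ - + 4 * c) + + 4 * (u * p)
  l₁ = solve-∀
  l₂ : ∀ x → 1ℤ - x + x ≡ 1ℤ
  l₂ = solve-∀

Plücker-exists : ∀ k β₁ β₂ c₁ c₂ → let A = + (2 ℕ.^ k) in + 4 * (β₁ * β₂) ≡ A * (+ 2 - + 4 * c₁ - + 4 * c₂) →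
  ∃ λ γ → Γ γ × Plücker γ A β₁ (+ 4 * c₁ - 1ℤ) A β₂ (+ 4 * c₂ - 1ℤ)
Plücker-exists k β₁ β₂ c₁ c₂ rel = completion A β₁ β₂ c₁ c₂ w₁ t₃ q r , completion∈Γ A β₁ β₂ c₁ c₂ w₁ t₃ q r rel (bézout k c₁) (bézout k c₂) , completion-Plücker A β₁ β₂ c₁ c₂ w₁ t₃ q r rel (bézout k c₁) (bézout k c₂)
  where
  A = + (2 ℕ.^ k)
  w₁ = - (A * c₁ ^ℤ suc k)
  t₃ = c₁ * geometric (+ 4 * c₁) k
  q = - (A * c₂ ^ℤ suc k)
  r = c₂ * geometric (+ 4 * c₂) k

orbit-inhabited : ∀ i j a₁ a₂ c → let A = + (2 ℕ.^ suc (i ℕ.+ j)) in ∃ λ γ → 𝕊 A A γ × Orbit (+ (2 ℕ.^ i)) (+ (2 ℕ.^ j)) A a₁ a₂ c γ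
orbit-inhabited i j a₁ a₂ c = conclude (Plücker-exists (suc (i ℕ.+ j)) β₁ β₂ (+ c) c₂ rel)
  where
  P = + (2 ℕ.^ i)
  Q = + (2 ℕ.^ j)
  A = + (2 ℕ.^ suc (i ℕ.+ j))
  β₁ = P * (1ℤ + + 2 * + a₁)
  β₂ = Q * (1ℤ + + 2 * + a₂)
  -- The only value compatible with the Plücker relation, namely that of `Orbit⇒C₂` at x = y = z =
  -- 0.
  c₂ = - (+ c + + a₁ + + a₂ + + 2 * (+ a₁ * + a₂))
  rel : + 4 * (β₁ * β₂) ≡ A * (+ 2 - + 4 * + c - + 4 * c₂)
  rel = trans (lem P Q (+ a₁) (+ a₂) (+ c)) (cong (_* (+ 2 - + 4 * + c - + 4 * c₂)) (sym (pos-2^-suc i j)))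
    where
    lem : ∀ P Q a b c → + 4 * (P * (1ℤ + + 2 * a) * (Q * (1ℤ + + 2 * b))) ≡ + 2 * (P * Q) * (+ 2 - + 4 * c - + 4 * (- (c + a + b + + 2 * (a * b))))
    lem = solve-∀
  conclude : (∃ λ γ → Γ γ × Plücker γ A β₁ (+ 4 * + c - 1ℤ) A β₂ (+ 4 * c₂ - 1ℤ)) → ∃ λ γ → 𝕊 A A γ × Orbit P Q A a₁ a₂ c γ
  conclude (γ , γ∈Γ , p) = γ , (γ∈Γ , Plücker⇒A₁ γ p , Plücker⇒A₂ γ p) , orbit 0ℤ 0ℤ 0ℤ
    (trans (Plücker⇒B₁ γ p) (lB P (+ a₁) Q)) (trans (Plücker⇒B₂ γ p) (lB Q (+ a₂) P))
    (trans (Plücker⇒C₁ γ p) (lC (+ c) A (P * (1ℤ + + 2 * + a₁))))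
    where
    lB : ∀ P a Q → P * (1ℤ + + 2 * a) ≡ P * (1ℤ + + 2 * (a + Q * 0ℤ))
    lB = solve-∀
    lC : ∀ c A w → + 4 * c - 1ℤ ≡ + 4 * (c + A * 0ℤ - w * 0ℤ) - 1ℤ
    lC = solve-∀

-- Lists in correspondence

module _ {A B : Set} {R : A → B → Set} where

  choose : ∀ {xs} → All (λ x → ∃ (R x)) xs → ∃ (Pointwise R xs)
  choose []             = [] , []
  choose ((y , r) ∷ rs) with ys , rs′ ← choose rs = y ∷ ys , r ∷ rs′

  choose′ : ∀ {ys} → All (λ y → ∃ λ x → R x y) ys → ∃ λ xs → Pointwise R xs ys
  choose′ []             = [] , []
  choose′ ((x , r) ∷ rs) with xs , rs′ ← choose′ rs = x ∷ xs , r ∷ rs′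

  pointwise-∈ˡ : ∀ {x xs ys} → Pointwise R xs ys → x ∈ xs → ∃ λ y → y ∈ ys × R x y
  pointwise-∈ˡ (r ∷ rs) (here refl) = _ , here refl , r
  pointwise-∈ˡ (r ∷ rs) (there x∈)  with y , y∈ , r′ ← pointwise-∈ˡ rs x∈ = y , there y∈ , r′

  pointwise-∈ʳ : ∀ {y xs ys} → Pointwise R xs ys → y ∈ ys → ∃ λ x → x ∈ xs × R x y
  pointwise-∈ʳ (r ∷ rs) (here refl) = _ , here refl , r
  pointwise-∈ʳ (r ∷ rs) (there y∈)  with x , x∈ , r′ ← pointwise-∈ʳ rs y∈ = x , there x∈ , r′

  module _ {S : A → A → Set} {T : B → B → Set} where

    pointwise-allPairsˡ : (∀ {x x′ y y′} → R x y → R x′ y′ → T y y′ → S x x′) →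
      ∀ {xs ys} → Pointwise R xs ys → AllPairs T ys → AllPairs S xs
    pointwise-allPairsˡ f []       []       = []
    pointwise-allPairsˡ f (r ∷ rs) (t ∷ ts) =
      All.tabulate (λ x∈ → let y , y∈ , r′ = pointwise-∈ˡ rs x∈ in f r r′ (All.lookup t y∈)) ∷ pointwise-allPairsˡ f rs ts

    pointwise-allPairsʳ : (∀ {x x′ y y′} → R x y → R x′ y′ → S x x′ → T y y′) →
      ∀ {xs ys} → Pointwise R xs ys → AllPairs S xs → AllPairs T ys
    pointwise-allPairsʳ f []       []       = []
    pointwise-allPairsʳ f (r ∷ rs) (s ∷ ss) =
      All.tabulate (λ y∈ → let x , x∈ , r′ = pointwise-∈ʳ rs y∈ in f r r′ (All.lookup s x∈)) ∷ pointwise-allPairsʳ f rs ss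

unique-⊆-↭ : ∀ {A : Set} {xs ys : List A} → Unique xs → Unique ys → (∀ {x} → x ∈ xs → x ∈ ys) → (∀ {x} → x ∈ ys → x ∈ xs) → xs ↭ ys
unique-⊆-↭ xs! ys! ⊆ ⊇ = ∼bag⇒↭ (unique∧set⇒bag xs! ys! (mk⇔ ⊆ ⊇))

-- The orbits (i , a₁ , a₂ , c) in 𝕊 (2ⁿ⁺¹ , 2ⁿ⁺¹)

Key : Set
Key = ℕ × ℕ × ℕ × ℕ

keysOver : ℕ → ℕ → List (ℕ × ℕ × ℕ)
keysOver n i = cartesianProduct (upTo (2 ℕ.^ (n ℕ.∸ i))) (cartesianProduct (upTo (2 ℕ.^ i)) (upTo (2 ℕ.^ suc n)))

keys : ℕ → List Key
keys n = concatMap (λ i → map (i ,_) (keysOver n i)) (upTo (suc n))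

∈-keys⁺ : ∀ n {i a₁ a₂ c} → i ℕ.< suc n → a₁ ℕ.< 2 ℕ.^ (n ℕ.∸ i) → a₂ ℕ.< 2 ℕ.^ i → c ℕ.< 2 ℕ.^ suc n → (i , a₁ , a₂ , c) ∈ keys n
∈-keys⁺ n i< a₁< a₂< c< = ∈-concatMap⁺ _ (lose (∈-upTo⁺ i<) (∈-map⁺ _ (∈-cartesianProduct⁺ (∈-upTo⁺ a₁<) (∈-cartesianProduct⁺ (∈-upTo⁺ a₂<) (∈-upTo⁺ c<)))))

∈-keys⁻ : ∀ n {i a₁ a₂ c} → (i , a₁ , a₂ , c) ∈ keys n → i ℕ.< suc n × a₁ ℕ.< 2 ℕ.^ (n ℕ.∸ i) × a₂ ℕ.< 2 ℕ.^ i × c ℕ.< 2 ℕ.^ suc n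
∈-keys⁻ n q∈ with i , i∈ , q∈′ ← find (∈-concatMap⁻ _ {xs = upTo (suc n)} q∈) with _ , x∈ , refl ← ∈-map⁻ (i ,_) q∈′
  with a₁∈ , y∈ ← ∈-cartesianProduct⁻ (upTo (2 ℕ.^ (n ℕ.∸ i))) (cartesianProduct (upTo (2 ℕ.^ i)) (upTo (2 ℕ.^ suc n))) x∈
  with a₂∈ , c∈ ← ∈-cartesianProduct⁻ (upTo (2 ℕ.^ i)) (upTo (2 ℕ.^ suc n)) y∈ =
  ∈-upTo⁻ i∈ , ∈-upTo⁻ a₁∈ , ∈-upTo⁻ a₂∈ , ∈-upTo⁻ c∈

keys-unique : ∀ n → Unique (keys n)
keys-unique n = Unique.concat⁺ (Allₚ.map⁺ (All.universal (λ i → Unique.map⁺ (λ { refl → refl }) (keysOver-unique i)) (upTo (suc n))))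
  (AllPairsₚ.map⁺ (AllPairs.map (λ i≢j {v} (x∈ , y∈) → disjoint i≢j (∈-map⁻ _ x∈) (∈-map⁻ _ y∈)) (Unique.upTo⁺ (suc n))))
  where
  keysOver-unique : ∀ i → Unique (keysOver n i)
  keysOver-unique i = Unique.cartesianProduct⁺ (Unique.upTo⁺ (2 ℕ.^ (n ℕ.∸ i))) (Unique.cartesianProduct⁺ (Unique.upTo⁺ (2 ℕ.^ i)) (Unique.upTo⁺ (2 ℕ.^ suc n)))
  disjoint : ∀ {i j} {q : Key} → i ≢ j → ∃ (λ x → x ∈ keysOver n i × q ≡ (i , x)) → ∃ (λ x → x ∈ keysOver n j × q ≡ (j , x)) → ⊥
  disjoint i≢j (_ , _ , refl) (_ , _ , refl) = contradiction refl i≢j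

module _ (n : ℕ) where
  private
    A : ℤ
    A = + (2 ℕ.^ suc n)

  InOrbit : Mat → Key → Set
  InOrbit γ (i , a₁ , a₂ , c) = Orbit (+ (2 ℕ.^ i)) (+ (2 ℕ.^ (n ℕ.∸ i))) A a₁ a₂ c γ

  record HasKey (γ : Mat) (q : Key) : Set where
    constructor hasKey
    field
      ∈𝕊      : 𝕊 A A γ
      ∈keys   : q ∈ keys n
      inOrbit : InOrbit γ q
  open HasKey public

  n≡i+[n∸i] : ∀ {i} → i ℕ.< suc n → n ≡ i ℕ.+ (n ℕ.∸ i)
  n≡i+[n∸i] (s≤s i≤n) = sym (ℕₚ.m+[n∸m]≡n i≤n)

  private
    A≡ : ∀ {i} → i ℕ.< suc n → A ≡ + 2 * (+ (2 ℕ.^ i) * + (2 ℕ.^ (n ℕ.∸ i)))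
    A≡ {i} i< = trans (cong (λ m → + (2 ℕ.^ suc m)) (n≡i+[n∸i] i<)) (pos-2^-suc i (n ℕ.∸ i))

    instance
      A≢0 : ℤ.NonZero A
      A≢0 = 2^≢0 (suc n)

  key : ∀ γ → 𝕊 A A γ → ∃ (HasKey γ)
  key γ γ∈𝕊 = fromOrbit (orbit-exists n γ γ∈𝕊)
    where
    fromOrbit : (∃₂ λ i j → n ≡ i ℕ.+ j × ∃₂ λ a₁ a₂ → ∃ λ c →
      a₁ ℕ.< 2 ℕ.^ j × a₂ ℕ.< 2 ℕ.^ i × c ℕ.< 2 ℕ.^ suc n × Orbit (+ (2 ℕ.^ i)) (+ (2 ℕ.^ j)) A a₁ a₂ c γ) → ∃ (HasKey γ)
    fromOrbit (i , j , n≡i+j , a₁ , a₂ , c , a₁< , a₂< , c< , O) =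
      (i , a₁ , a₂ , c) , hasKey γ∈𝕊
      (∈-keys⁺ n (s≤s (subst (i ℕ.≤_) (sym n≡i+j) (ℕₚ.m≤m+n i j))) (subst (λ m → a₁ ℕ.< 2 ℕ.^ m) j≡n∸i a₁<) a₂< c<)
      (subst (λ m → Orbit (+ (2 ℕ.^ i)) (+ (2 ℕ.^ m)) A a₁ a₂ c γ) j≡n∸i O)
      where
      j≡n∸i : j ≡ n ℕ.∸ i
      j≡n∸i = sym (trans (cong (ℕ._∸ i) n≡i+j) (ℕₚ.m+n∸m≡n i j))

  representative : ∀ {q} → q ∈ keys n → ∃ λ γ → HasKey γ q
  representative {i , a₁ , a₂ , c} q∈ with i< , _ ← ∈-keys⁻ n q∈ =
    let γ , γ∈𝕊 , O = subst (λ m → ∃ λ γ → let A = + (2 ℕ.^ suc m) in 𝕊 A A γ × Orbit (+ (2 ℕ.^ i)) (+ (2 ℕ.^ (n ℕ.∸ i))) A a₁ a₂ c γ)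
                        (sym (n≡i+[n∸i] i<)) (orbit-inhabited i (n ℕ.∸ i) a₁ a₂ c)
    in γ , hasKey γ∈𝕊 q∈ O

  key⇒coset : ∀ {γ δ q} → HasKey γ q → HasKey δ q → SameDoubleCoset γ δ
  key⇒coset {q = i , _} (hasKey γ∈𝕊 q∈ O) (hasKey δ∈𝕊 _ O′) =
    Orbit⇒SameDoubleCoset (+ (2 ℕ.^ i)) (+ (2 ℕ.^ (n ℕ.∸ i))) A (A≡ (proj₁ (∈-keys⁻ n q∈))) γ∈𝕊 δ∈𝕊 O O′

  -- The orbit of γ is carried over to δ, and a single matrix has only one key.
  coset⇒key : ∀ {γ δ q q′} → HasKey γ q → HasKey δ q′ → SameDoubleCoset γ δ → q ≡ q′
  coset⇒key {γ} {δ} {q = i , _} {q′ = i′ , _} (hasKey γ∈𝕊 q∈ O) (hasKey δ∈𝕊 q′∈ O′) γ∼δ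
    with i< , a₁< , a₂< , c< ← ∈-keys⁻ n q∈ | i<′ , a₁<′ , a₂<′ , c<′ ← ∈-keys⁻ n q′∈ =
    orbit-unique n δ (n≡i+[n∸i] i<) (n≡i+[n∸i] i<′) a₁< a₂< c< a₁<′ a₂<′ c<′
      (Orbit-resp (+ (2 ℕ.^ i)) (+ (2 ℕ.^ (n ℕ.∸ i))) A (A≡ i<) γ∈𝕊 γ∼δ O) O′

  representatives : ∃ (Representatives A A)
  representatives with γs , rs ← choose′ {R = HasKey} (All.tabulate representative) = γs , record
    { sound    = All.tabulate λ γ∈ → ∈𝕊 (proj₂ (proj₂ (pointwise-∈ˡ rs γ∈)))
    ; complete = λ γ γ∈𝕊 → let q , h = key γ γ∈𝕊
                               δ , δ∈ , h′ = pointwise-∈ʳ rs (∈keys h)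
                           in lose δ∈ (key⇒coset h h′)
    ; distinct = pointwise-allPairsˡ (λ h h′ q≢q′ γ∼δ → q≢q′ (coset⇒key h h′ γ∼δ)) rs (keys-unique n)
    }

  module _ {γs} (reps : Representatives A A γs) where
    open Representatives reps

    keysOf : ∃ (Pointwise HasKey γs)
    keysOf = choose (All.map (λ {γ} → key γ) sound)

    private
      qs : List Key
      qs = proj₁ keysOf
      rs : Pointwise HasKey γs qs
      rs = proj₂ keysOf

      qs! : Unique qs
      qs! = pointwise-allPairsʳ separate rs distinct
        where
        separate : ∀ {γ δ q q′} → HasKey γ q → HasKey δ q′ → ¬ SameDoubleCoset γ δ → q ≢ q′
        separate {γ} {δ} h h′ γ≁δ q≡q′ = γ≁δ (key⇒coset h (subst (HasKey δ) (sym q≡q′) h′))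

      qs⊆ : ∀ {q} → q ∈ qs → q ∈ keys n
      qs⊆ q∈ = ∈keys (proj₂ (proj₂ (pointwise-∈ʳ rs q∈)))

      ⊆qs : ∀ {q} → q ∈ keys n → q ∈ qs
      ⊆qs {q} q∈ =
        let γ , h = representative q∈
            δ , δ∈ , γ∼δ = find (complete γ (∈𝕊 h))
            q′ , q′∈ , h′ = pointwise-∈ˡ rs δ∈
        in subst (_∈ qs) (sym (coset⇒key h h′ γ∼δ)) q′∈

    -- The key is a complete invariant of the double coset: `distinct` makes the keys of the list
    -- pairwise different, and `complete` makes every key occur. Hence all lists of representatives
    -- give the same sum.
    keysOf-↭ : proj₁ keysOf ↭ keys n
    keysOf-↭ = unique-⊆-↭ qs! (keys-unique n) qs⊆ ⊆qs

-- The sums in an exponential ring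

module _ {c ℓ} (E : ExponentialRing c ℓ) where
  open ExponentialSums E
  private
    module R = CommutativeRing (ExponentialRing.commutativeRing E)
    module e = MonoidMorphisms.IsMonoidHomomorphism (ExponentialRing.e-isMonoidHomomorphism E)
  open CommutativeSemigroupProperties R.+-commutativeSemigroup using () renaming (interchange to +-interchange)
  open CommutativeSemigroupProperties R.*-commutativeSemigroup using () renaming (interchange to *-interchange; x∙yz≈y∙xz to x*yz≈y*xz)
  open RingProperties R.ring using (-‿distribˡ-*; -‿distribʳ-*; -‿involutive)
  open import Relation.Binary.Reasoning.Setoid R.setoid

  -- Sums over lists

  ∑-cong-∈ : ∀ {A : Set} {f g : A → Carrier} xs → (∀ {x} → x ∈ xs → f x ≈ g x) → ∑ xs f ≈ ∑ xs g
  ∑-cong-∈ []       f≈g = R.refl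
  ∑-cong-∈ (x ∷ xs) f≈g = R.+-cong (f≈g (here ≡.refl)) (∑-cong-∈ xs (f≈g ∘ there))

  ∑-cong : ∀ {A : Set} {f g : A → Carrier} xs → (∀ x → f x ≈ g x) → ∑ xs f ≈ ∑ xs g
  ∑-cong xs f≈g = ∑-cong-∈ xs λ {x} _ → f≈g x

  ∑-↭ : ∀ {A : Set} (f : A → Carrier) {xs ys} → xs ↭ ys → ∑ xs f ≈ ∑ ys f
  ∑-↭ f ↭.refl             = R.refl
  ∑-↭ f (↭.prep x p)       = R.+-congˡ (∑-↭ f p)
  ∑-↭ f (↭.swap {xs} {ys} x y p) = begin
    f x ⊕ (f y ⊕ ∑ xs f)  ≈⟨ R.+-congˡ (R.+-congˡ (∑-↭ f p)) ⟩
    f x ⊕ (f y ⊕ ∑ ys f)  ≈⟨ R.+-assoc (f x) (f y) (∑ ys f) ⟨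
    (f x ⊕ f y) ⊕ ∑ ys f  ≈⟨ R.+-congʳ (R.+-comm (f x) (f y)) ⟩
    (f y ⊕ f x) ⊕ ∑ ys f  ≈⟨ R.+-assoc (f y) (f x) (∑ ys f) ⟩
    f y ⊕ (f x ⊕ ∑ ys f)  ∎
  ∑-↭ f (↭.trans p q)      = R.trans (∑-↭ f p) (∑-↭ f q)

  ∑-pointwise : ∀ {A B : Set} {S : A → B → Set} {f : A → Carrier} {g : B → Carrier} → (∀ {x y} → S x y → f x ≈ g y) →
    ∀ {xs ys} → Pointwise S xs ys → ∑ xs f ≈ ∑ ys g
  ∑-pointwise f≈g []       = R.refl
  ∑-pointwise f≈g (s ∷ ss) = R.+-cong (f≈g s) (∑-pointwise f≈g ss)

  ∑-++ : ∀ {A : Set} (f : A → Carrier) xs ys → ∑ (xs ++ ys) f ≈ ∑ xs f ⊕ ∑ ys f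
  ∑-++ f []       ys = R.sym (R.+-identityˡ (∑ ys f))
  ∑-++ f (x ∷ xs) ys = R.trans (R.+-congˡ (∑-++ f xs ys)) (R.sym (R.+-assoc (f x) (∑ xs f) (∑ ys f)))

  ∑-map : ∀ {A B : Set} (f : B → Carrier) (h : A → B) xs → ∑ (map h xs) f ≈ ∑ xs (f ∘ h)
  ∑-map f h []       = R.refl
  ∑-map f h (x ∷ xs) = R.+-congˡ (∑-map f h xs)

  ∑-concatMap : ∀ {A B : Set} (f : B → Carrier) (h : A → List B) xs → ∑ (concatMap h xs) f ≈ ∑ xs (λ x → ∑ (h x) f)
  ∑-concatMap f h []       = R.refl
  ∑-concatMap f h (x ∷ xs) = R.trans (∑-++ f (h x) (concatMap h xs)) (R.+-congˡ (∑-concatMap f h xs))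

  ∑-cartesianProduct : ∀ {A B : Set} (f : A × B → Carrier) xs ys → ∑ (cartesianProduct xs ys) f ≈ ∑ xs (λ x → ∑ ys (λ y → f (x , y)))
  ∑-cartesianProduct f []       ys = R.refl
  ∑-cartesianProduct f (x ∷ xs) ys = R.trans (∑-++ f (map (x ,_) ys) (cartesianProduct xs ys)) (R.+-cong (∑-map f (x ,_) ys) (∑-cartesianProduct f xs ys))

  ∑-*ˡ : ∀ {A : Set} a (f : A → Carrier) xs → ∑ xs (λ x → a ⊛ f x) ≈ a ⊛ ∑ xs f
  ∑-*ˡ a f []       = R.sym (R.zeroʳ a)
  ∑-*ˡ a f (x ∷ xs) = R.trans (R.+-congˡ (∑-*ˡ a f xs)) (R.sym (R.distribˡ a (f x) (∑ xs f)))

  ∑-*ʳ : ∀ {A : Set} a (f : A → Carrier) xs → ∑ xs (λ x → f x ⊛ a) ≈ ∑ xs f ⊛ a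
  ∑-*ʳ a f xs = R.trans (∑-cong xs λ x → R.*-comm (f x) a) (R.trans (∑-*ˡ a f xs) (R.*-comm a (∑ xs f)))

  ∑-⊕ : ∀ {A : Set} (f g : A → Carrier) xs → ∑ xs f ⊕ ∑ xs g ≈ ∑ xs (λ x → f x ⊕ g x)
  ∑-⊕ f g []       = R.+-identityˡ 0#
  ∑-⊕ f g (x ∷ xs) = R.trans (+-interchange (f x) (∑ xs f) (g x) (∑ xs g)) (R.+-congˡ (∑-⊕ f g xs))

  ∑-const : ∀ {A : Set} a (xs : List A) → ∑ xs (λ _ → a) ≈ fromℤ (+ length xs) ⊛ a
  ∑-const a []       = R.sym (R.zeroˡ a)
  ∑-const a (x ∷ xs) = R.trans (R.+-cong (R.sym (R.*-identityˡ a)) (∑-const a xs)) (R.sym (R.distribʳ a 1# (fromℤ (+ length xs))))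

  ∑-filter : ∀ {A : Set} {P : A → Set} (P? : Decidable P) (f : A → Carrier) xs → ∑ (filter P? xs) f ≈ ∑ xs (λ x → if does (P? x) then f x else 0#)
  ∑-filter P? f []       = R.refl
  ∑-filter P? f (x ∷ xs) with does (P? x)
  ... | true  = R.+-congˡ (∑-filter P? f xs)
  ... | false = R.trans (∑-filter P? f xs) (R.sym (R.+-identityˡ _))

  ∑-upTo-suc : ∀ (f : ℕ → Carrier) n → ∑ (upTo (suc n)) f ≈ ∑ (upTo n) f ⊕ f n
  ∑-upTo-suc f n = R.trans (R.reflexive (cong (λ xs → ∑ xs f) (≡.sym (upTo-∷ʳ n)))) (R.trans (∑-++ f (upTo n) (n ∷ [])) (R.+-congˡ (R.+-identityʳ (f n))))

  ∑-upTo-2* : ∀ (f : ℕ → Carrier) n → ∑ (upTo (2 ℕ.* n)) f ≈ ∑ (upTo n) (λ x → f (2 ℕ.* x) ⊕ f (1 ℕ.+ 2 ℕ.* x))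
  ∑-upTo-2* f zero    = R.refl
  ∑-upTo-2* f (suc n) = begin
    ∑ (upTo (2 ℕ.* suc n)) f                                  ≈⟨ R.reflexive (cong (λ m → ∑ (upTo m) f) (cong suc (ℕₚ.+-suc n (n ℕ.+ 0)))) ⟩
    ∑ (upTo (suc (suc (2 ℕ.* n)))) f                          ≈⟨ ∑-upTo-suc f (suc (2 ℕ.* n)) ⟩
    ∑ (upTo (suc (2 ℕ.* n))) f ⊕ f (suc (2 ℕ.* n))            ≈⟨ R.+-congʳ (∑-upTo-suc f (2 ℕ.* n)) ⟩
    (∑ (upTo (2 ℕ.* n)) f ⊕ f (2 ℕ.* n)) ⊕ f (suc (2 ℕ.* n))  ≈⟨ R.+-assoc _ _ _ ⟩
    ∑ (upTo (2 ℕ.* n)) f ⊕ (f (2 ℕ.* n) ⊕ f (suc (2 ℕ.* n)))  ≈⟨ R.+-congʳ (∑-upTo-2* f n) ⟩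
    ∑ (upTo n) pair ⊕ pair n                                  ≈⟨ ∑-upTo-suc pair n ⟨
    ∑ (upTo (suc n)) pair                                     ∎
    where
    pair : ℕ → Carrier
    pair x = f (2 ℕ.* x) ⊕ f (1 ℕ.+ 2 ℕ.* x)

  -- Signs as ring elements

  σ : ℤ → Carrier
  σ z = fromℤ (sgn z)

  fromℤ-1 : fromℤ 1ℤ ≈ 1#
  fromℤ-1 = R.+-identityʳ 1#

  fromℤ--1 : fromℤ -1ℤ ≈ ⊖ 1#
  fromℤ--1 = R.-‿cong fromℤ-1

  σ≈1 : ∀ {z} → sgn z ≡ 1ℤ → σ z ≈ 1#
  σ≈1 eq = R.trans (R.reflexive (cong fromℤ eq)) fromℤ-1

  σ≈-1 : ∀ {z} → sgn z ≡ -1ℤ → σ z ≈ ⊖ 1#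
  σ≈-1 eq = R.trans (R.reflexive (cong fromℤ eq)) fromℤ--1

  -1⊛-1 : ⊖ 1# ⊛ ⊖ 1# ≈ 1#
  -1⊛-1 = R.trans (R.sym (-‿distribˡ-* 1# (⊖ 1#))) (R.trans (R.-‿cong (R.*-identityˡ (⊖ 1#))) (-‿involutive 1#))

  σ-+ : ∀ x y → σ (x + y) ≈ σ x ⊛ σ y
  σ-+ x y with sgn≡±1 x | sgn≡±1 y
  ... | inj₁ p | inj₁ q = R.trans (σ≈1 {x + y} (≡.trans (sgn-+ x y) (cong₂ _*_ p q))) (R.sym (R.trans (R.*-cong (σ≈1 {x} p) (σ≈1 {y} q)) (R.*-identityˡ 1#)))
  ... | inj₁ p | inj₂ q = R.trans (σ≈-1 {x + y} (≡.trans (sgn-+ x y) (cong₂ _*_ p q))) (R.sym (R.trans (R.*-cong (σ≈1 {x} p) (σ≈-1 {y} q)) (R.*-identityˡ (⊖ 1#))))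
  ... | inj₂ p | inj₁ q = R.trans (σ≈-1 {x + y} (≡.trans (sgn-+ x y) (cong₂ _*_ p q))) (R.sym (R.trans (R.*-cong (σ≈-1 {x} p) (σ≈1 {y} q)) (R.*-identityʳ (⊖ 1#))))
  ... | inj₂ p | inj₂ q = R.trans (σ≈1 {x + y} (≡.trans (sgn-+ x y) (cong₂ _*_ p q))) (R.sym (R.trans (R.*-cong (σ≈-1 {x} p) (σ≈-1 {y} q)) -1⊛-1))

  σ-+2* : ∀ x w → σ (x + + 2 * w) ≈ σ x
  σ-+2* x w = R.reflexive (cong fromℤ (sgn-+2* x w))

  -1^≈σ : ∀ n → (⊖ 1#) ^ n ≈ σ (+ n)
  -1^≈σ zero    = R.sym fromℤ-1
  -1^≈σ (suc n) = R.sym (R.trans (σ-+ 1ℤ (+ n)) (R.*-cong fromℤ--1 (R.sym (-1^≈σ n))))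

  -- Values of `e` at dyadic rationals

  frac : ℤ → ℕ → ℚᵘ
  frac z n = (z ℚᵘ./ (2 ℕ.^ n)) {{ℕₚ.m^n≢0 2 n}}

  -- The value at 1/2 is -1 by assumption, so e(1) = e(1/2 + 1/2) = (-1)² = 1.
  e-natural : ∀ n → e (+ n ℚᵘ./ 1) ≈ 1#
  e-natural zero    = e.ε-homo
  e-natural (suc n) = begin
    e ((+ suc n) ℚᵘ./ 1)                 ≈⟨ e.⟦⟧-cong (*≡* (lem (+ n))) ⟩
    e ((ℚᵘ.½ ℚᵘ.+ ℚᵘ.½) ℚᵘ.+ (+ n ℚᵘ./ 1)) ≈⟨ e.homo (ℚᵘ.½ ℚᵘ.+ ℚᵘ.½) (+ n ℚᵘ./ 1) ⟩
    e (ℚᵘ.½ ℚᵘ.+ ℚᵘ.½) ⊛ e (+ n ℚᵘ./ 1)    ≈⟨ R.*-cong e[½+½] (e-natural n) ⟩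
    1# ⊛ 1#                              ≈⟨ R.*-identityˡ 1# ⟩
    1#                                   ∎
    where
    lem : ∀ n → (1ℤ + n) * + 4 ≡ (+ 4 * + 1 + n * + 4) * 1ℤ
    lem = solve-∀
    e[½+½] : e (ℚᵘ.½ ℚᵘ.+ ℚᵘ.½) ≈ 1#
    e[½+½] = R.trans (e.homo ℚᵘ.½ ℚᵘ.½) (R.trans (R.*-cong (ExponentialRing.e[½]≈-1 E) (ExponentialRing.e[½]≈-1 E)) -1⊛-1)
  e-integer : ∀ z → e (z ℚᵘ./ 1) ≈ 1#
  e-integer (+ n)    = e-natural n
  e-integer -[1+ n ] = begin
    e (-[1+ n ] ℚᵘ./ 1)                            ≈⟨ R.*-identityʳ _ ⟨
    e (-[1+ n ] ℚᵘ./ 1) ⊛ 1#                       ≈⟨ R.*-congˡ (e-natural (suc n)) ⟨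
    e (-[1+ n ] ℚᵘ./ 1) ⊛ e ((+ suc n) ℚᵘ./ 1)     ≈⟨ e.homo (-[1+ n ] ℚᵘ./ 1) ((+ suc n) ℚᵘ./ 1) ⟨
    e ((-[1+ n ] ℚᵘ./ 1) ℚᵘ.+ ((+ suc n) ℚᵘ./ 1))  ≈⟨ e.⟦⟧-cong (*≡* (lem (+ suc n))) ⟩
    e ℚᵘ.0ℚᵘ                                       ≈⟨ e.ε-homo ⟩
    1#                                             ∎
    where
    lem : ∀ n → ((- n) * 1ℤ + n * 1ℤ) * 1ℤ ≡ 0ℤ * 1ℤ
    lem = solve-∀

  /-cross : ∀ {z w m n} .{{_ : ℕ.NonZero m}} .{{_ : ℕ.NonZero n}} → z * + n ≡ w * + m → z ℚᵘ./ m ℚᵘ.≃ w ℚᵘ./ n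
  /-cross {m = suc m} {suc n} eq = *≡* eq

  e-shift : ∀ z y n .{{_ : ℕ.NonZero n}} → e ((z + + n * y) ℚᵘ./ n) ≈ e (z ℚᵘ./ n)
  e-shift z y n@(suc d) = begin
    e ((z + + n * y) ℚᵘ./ n)          ≈⟨ e.⟦⟧-cong (*≡* (lem z y (+ n) (ℤₚ.pos-* n 1))) ⟩
    e ((z ℚᵘ./ n) ℚᵘ.+ (y ℚᵘ./ 1))    ≈⟨ e.homo (z ℚᵘ./ n) (y ℚᵘ./ 1) ⟩
    e (z ℚᵘ./ n) ⊛ e (y ℚᵘ./ 1)       ≈⟨ R.*-congˡ (e-integer y) ⟩
    e (z ℚᵘ./ n) ⊛ 1#                 ≈⟨ R.*-identityʳ _ ⟩
    e (z ℚᵘ./ n)                      ∎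
    where
    lem : ∀ z y n {m} → m ≡ n * 1ℤ → (z + n * y) * m ≡ (z * 1ℤ + y * n) * n
    lem z y n ≡.refl = lem′ z y n
      where
      lem′ : ∀ z y n → (z + n * y) * (n * 1ℤ) ≡ (z * 1ℤ + y * n) * n
      lem′ = solve-∀

  //-scaled : ∀ m b N .{{_ : ℕ.NonZero N}} .{{_ : ℤ.NonZero (+ N)}} → (m ℚᵘ./ 1) ℚᵘ.* (b // (+ N)) ℚᵘ.≃ (m * b) ℚᵘ./ N
  //-scaled m b N@(suc d) = *≡* (≡.trans (lem m b (+ N)) (cong (λ w → m * b * w) (≡.trans (ℤₚ.*-identityˡ (+ N)) (cong +_ (≡.sym (≡.trans (ℕₚ.+-identityʳ _) (ℕₚ.+-identityʳ N)))))))
    where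
    lem : ∀ m b n → m * (b * 1ℤ) * n ≡ m * b * (1ℤ * n)
    lem = solve-∀

  ψ : ℤ → ℕ → ℕ → Carrier
  ψ m x n = e (frac (m * + x) n)

  -- As 2ᵏ = 2ⁱ 2ʲ⁺¹, the quotient b / 2ᵏ equals (1 + 2 a) / 2ʲ⁺¹ + x, and the integer m x does not
  -- affect `e`. For B₂ the roles of i and j are exchanged.
  e-orbit : ∀ m i j k → k ≡ suc (i ℕ.+ j) → ∀ {b} a x → b ≡ + (2 ℕ.^ i) * (1ℤ + + 2 * (+ a + + (2 ℕ.^ j) * x)) → .{{_ : ℤ.NonZero (+ (2 ℕ.^ k))}} →
    e ((m ℚᵘ./ 1) ℚᵘ.* (b // (+ (2 ℕ.^ k)))) ≈ ψ m (1 ℕ.+ 2 ℕ.* a) (suc j)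
  e-orbit m i j k ≡.refl {b} a x b≡ = begin
    e ((m ℚᵘ./ 1) ℚᵘ.* (b // (+ (2 ℕ.^ k))))                 ≈⟨ e.⟦⟧-cong (//-scaled m b (2 ℕ.^ k)) ⟩
    e ((m * b) ℚᵘ./ (2 ℕ.^ k))                               ≈⟨ e.⟦⟧-cong (/-cross {m * b} {m * + (1 ℕ.+ 2 ℕ.* a) + N * (m * x)} {2 ℕ.^ k} {2 ℕ.^ suc j} cross) ⟩
    e ((m * + (1 ℕ.+ 2 ℕ.* a) + N * (m * x)) ℚᵘ./ (2 ℕ.^ suc j)) ≈⟨ e-shift (m * + (1 ℕ.+ 2 ℕ.* a)) (m * x) (2 ℕ.^ suc j) ⟩
    ψ m (1 ℕ.+ 2 ℕ.* a) (suc j)                              ∎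
    where
    N = + (2 ℕ.^ suc j)
    instance
      _ = ℕₚ.m^n≢0 2 k
      _ = ℕₚ.m^n≢0 2 (suc j)
    cross : m * b * N ≡ (m * + (1 ℕ.+ 2 ℕ.* a) + N * (m * x)) * + (2 ℕ.^ k)
    cross = ≡.trans (cong₂ (λ u v → m * u * v) b≡ (ℤₚ.pos-* 2 (2 ℕ.^ j)))
      (≡.trans (lem m (+ (2 ℕ.^ i)) (+ (2 ℕ.^ j)) (+ a) x)
      (≡.trans (cong (λ u → (m * (1ℤ + u) + + 2 * + (2 ℕ.^ j) * (m * x)) * (+ 2 * (+ (2 ℕ.^ i) * + (2 ℕ.^ j)))) (≡.sym (ℤₚ.pos-* 2 a)))
        (cong₂ (λ u v → (m * + (1 ℕ.+ 2 ℕ.* a) + u * (m * x)) * v) (≡.sym (ℤₚ.pos-* 2 (2 ℕ.^ j))) (≡.sym (pos-2^-suc i j)))))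
      where
      lem : ∀ m P Q a x → m * (P * (1ℤ + + 2 * (a + Q * x))) * (+ 2 * Q) ≡ (m * (1ℤ + + 2 * a) + + 2 * Q * (m * x)) * (+ 2 * (P * Q))
      lem = solve-∀

  -- The sums `g` as weighted sums over odd residues

  coprime-odd : ∀ a n → Coprime (1 ℕ.+ 2 ℕ.* a) (2 ℕ.^ n)
  coprime-odd a n = Coprime.sym (coprime-2^ n (odd-∤ {+ (1 ℕ.+ 2 ℕ.* a)} (+ a) (cong (λ w → 1ℤ + w) (ℤₚ.pos-* 2 a))))

  ¬coprime-even : ∀ a n → ¬ Coprime (2 ℕ.* a) (2 ℕ.^ suc n)
  ¬coprime-even a n coprime with coprime (ℕ∣.m∣m*n {2} a , ℕ∣.m∣m*n {2} (2 ℕ.^ n))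
  ... | ()

  -- A residue 1 + 2 a lies in the class of 1 or of -1 modulo 4 according to the parity of a.
  module _ (m : ℤ) (n t : ℕ) where
    private
      N = 2 ℕ.^ suc n
      InClass? : ∀ ε → Decidable (λ x → Coprime x (2 ℕ.^ suc (suc n)) × + 4 ∣ (+ x - ε))
      InClass? ε x = coprime? x (2 ℕ.^ suc (suc n)) ×-dec + 4 ∣ℤ? (+ x - ε)
      τ = (⊖ 1#) ^ t
      f : ℕ → Carrier
      f x = ψ m x (suc (suc n))
      F : ℕ → Carrier
      F x = (if does (InClass? 1ℤ x) then f x else 0#) ⊕ τ ⊛ (if does (InClass? -1ℤ x) then f x else 0#)

      if-yes : ∀ {P : Set} (P? : Dec P) {x y : Carrier} → P → (if does P? then x else y) ≈ x
      if-yes P? p rewrite dec-true P? p = R.refl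

      if-no : ∀ {P : Set} (P? : Dec P) {x y : Carrier} → ¬ P → (if does P? then x else y) ≈ y
      if-no P? ¬p rewrite dec-false P? ¬p = R.refl

      F-even : ∀ a → F (2 ℕ.* a) ≈ 0#
      F-even a = R.trans (R.+-cong (if-no (InClass? 1ℤ (2 ℕ.* a)) (¬coprime-even a (suc n) ∘ proj₁))
          (R.trans (R.*-congˡ (if-no (InClass? -1ℤ (2 ℕ.* a)) (¬coprime-even a (suc n) ∘ proj₁))) (R.zeroʳ τ)))
        (R.+-identityˡ 0#)

      pos-odd : ∀ a → + (1 ℕ.+ 2 ℕ.* a) ≡ 1ℤ + + 2 * + a
      pos-odd a = cong (λ w → 1ℤ + w) (ℤₚ.pos-* 2 a)

      4∤2+4* : ∀ w z → z ≡ + 2 * (1ℤ + + 2 * w) → ¬ + 4 ∣ z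
      4∤2+4* w z eq (divides q eq′) = even≢odd q w (ℤₚ.*-cancelˡ-≡ (+ 2) (+ 2 * q) (1ℤ + + 2 * w) (≡.trans (lem q) (≡.trans (≡.sym eq′) eq)))
        where
        lem : ∀ q → + 2 * (+ 2 * q) ≡ q * + 4
        lem = solve-∀

      F-odd : ∀ a → F (1 ℕ.+ 2 ℕ.* a) ≈ σ (+ t * + a) ⊛ f (1 ℕ.+ 2 ℕ.* a)
      F-odd a = go (parity (+ a)) ≡.refl
        where
        x = 1 ℕ.+ 2 ℕ.* a
        go : ∀ {z} → Parity z → z ≡ + a → F x ≈ σ (+ t * + a) ⊛ f x
        go (even w) eq = begin
          F x                     ≈⟨ R.+-cong (if-yes (InClass? 1ℤ x) (coprime-odd a (suc (suc n)) , divides w (≡.trans (cong (_- 1ℤ) x≡) (l₁ w))))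
                                       (R.trans (R.*-congˡ (if-no (InClass? -1ℤ x) (4∤2+4* w (+ x - -1ℤ) (≡.trans (cong (_- -1ℤ) x≡) (l₂ w)) ∘ proj₂))) (R.zeroʳ τ)) ⟩
          f x ⊕ 0#                ≈⟨ R.+-identityʳ (f x) ⟩
          f x                     ≈⟨ R.*-identityˡ (f x) ⟨
          1# ⊛ f x                ≈⟨ R.*-congʳ (σ≈1 {+ t * + a} (≡.trans (cong sgn (≡.trans (cong (+ t *_) (≡.sym eq)) (*-even (+ t) w))) (sgn-even (+ t * w)))) ⟨
          σ (+ t * + a) ⊛ f x     ∎
          where
          x≡ : + x ≡ 1ℤ + + 2 * (+ 2 * w)
          x≡ = ≡.trans (pos-odd a) (cong (λ u → 1ℤ + + 2 * u) (≡.sym eq))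
          l₁ : ∀ w → 1ℤ + + 2 * (+ 2 * w) - 1ℤ ≡ w * + 4
          l₁ = solve-∀
          l₂ : ∀ w → 1ℤ + + 2 * (+ 2 * w) - -1ℤ ≡ + 2 * (1ℤ + + 2 * w)
          l₂ = solve-∀
        go (odd w) eq = begin
          F x                     ≈⟨ R.+-cong (if-no (InClass? 1ℤ x) (4∤2+4* w (+ x - 1ℤ) (≡.trans (cong (_- 1ℤ) x≡) (l₁ w)) ∘ proj₂))
                                       (R.*-congˡ (if-yes (InClass? -1ℤ x) (coprime-odd a (suc (suc n)) , divides (1ℤ + w) (≡.trans (cong (_- -1ℤ) x≡) (l₂ w))))) ⟩
          0# ⊕ τ ⊛ f x            ≈⟨ R.+-identityˡ (τ ⊛ f x) ⟩
          τ ⊛ f x                 ≈⟨ R.*-congʳ (-1^≈σ t) ⟩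
          σ (+ t) ⊛ f x           ≈⟨ R.*-congʳ (σ-+2* (+ t) (+ t * w)) ⟨
          σ (+ t + + 2 * (+ t * w)) ⊛ f x ≈⟨ R.*-congʳ (R.reflexive (cong σ (≡.trans (l₃ (+ t) w) (cong (+ t *_) eq)))) ⟩
          σ (+ t * + a) ⊛ f x     ∎
          where
          x≡ : + x ≡ 1ℤ + + 2 * (1ℤ + + 2 * w)
          x≡ = ≡.trans (pos-odd a) (cong (λ u → 1ℤ + + 2 * u) (≡.sym eq))
          l₁ : ∀ w → 1ℤ + + 2 * (1ℤ + + 2 * w) - 1ℤ ≡ + 2 * (1ℤ + + 2 * w)
          l₁ = solve-∀
          l₂ : ∀ w → 1ℤ + + 2 * (1ℤ + + 2 * w) - -1ℤ ≡ (1ℤ + w) * + 4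
          l₂ = solve-∀
          l₃ : ∀ t w → t + + 2 * (t * w) ≡ t * (1ℤ + + 2 * w)
          l₃ = solve-∀

    -- Both sums are extended by 0 to all residues modulo 2ⁿ⁺² and merged into the sum of `F`. Even
    -- residues are no units, and the residue 1 + 2 a receives the weight (-1)^(t a).
    g-sum-≥2 : g 1ℤ m (suc (suc n)) ⊕ (⊖ 1#) ^ t ⊛ g -1ℤ m (suc (suc n)) ≈ ∑[ a ∈ upTo (2 ℕ.^ suc n) ] (σ (+ t * + a) ⊛ ψ m (1 ℕ.+ 2 ℕ.* a) (suc (suc n)))
    g-sum-≥2 = begin
      g 1ℤ m (suc (suc n)) ⊕ τ ⊛ g -1ℤ m (suc (suc n))
        ≈⟨ R.+-cong (∑-filter (InClass? 1ℤ) f (upTo (2 ℕ.* N))) (R.*-congˡ (∑-filter (InClass? -1ℤ) f (upTo (2 ℕ.* N)))) ⟩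
      ∑ (upTo (2 ℕ.* N)) (λ x → if does (InClass? 1ℤ x) then f x else 0#) ⊕ τ ⊛ ∑ (upTo (2 ℕ.* N)) (λ x → if does (InClass? -1ℤ x) then f x else 0#)
        ≈⟨ R.+-congˡ (∑-*ˡ τ _ (upTo (2 ℕ.* N))) ⟨
      ∑ (upTo (2 ℕ.* N)) (λ x → if does (InClass? 1ℤ x) then f x else 0#) ⊕ ∑ (upTo (2 ℕ.* N)) (λ x → τ ⊛ (if does (InClass? -1ℤ x) then f x else 0#))
        ≈⟨ ∑-⊕ _ _ (upTo (2 ℕ.* N)) ⟩
      ∑ (upTo (2 ℕ.* N)) F
        ≈⟨ ∑-upTo-2* F N ⟩
      ∑ (upTo N) (λ a → F (2 ℕ.* a) ⊕ F (1 ℕ.+ 2 ℕ.* a))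
        ≈⟨ ∑-cong (upTo N) (λ a → R.trans (R.+-congʳ (F-even a)) (R.trans (R.+-identityˡ _) (F-odd a))) ⟩
      ∑ (upTo N) (λ a → σ (+ t * + a) ⊛ f (1 ℕ.+ 2 ℕ.* a)) ∎

  -- For n = 1 the two halves recombine when the sign is trivial.
  g-sum-1 : ∀ m t → g 1ℤ m 1 ⊕ (⊖ 1#) ^ (2 ℕ.* t) ⊛ g -1ℤ m 1 ≈ ∑[ a ∈ upTo 1 ] (σ (+ (2 ℕ.* t) * + a) ⊛ ψ m (1 ℕ.+ 2 ℕ.* a) 1)
  g-sum-1 m t = begin
    g 1ℤ m 1 ⊕ (⊖ 1#) ^ (2 ℕ.* t) ⊛ g -1ℤ m 1
      ≈⟨ R.+-cong (half 1 0ℤ (l₁ m)) (R.trans (R.*-congʳ (R.trans (-1^≈σ (2 ℕ.* t)) (σ≈1 {+ (2 ℕ.* t)} (-1^[2*n]≡1 t)))) (R.trans (R.*-identityˡ _) (half 3 m (l₂ m)))) ⟩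
    ½ ⊛ ψ m 1 1 ⊕ ½ ⊛ ψ m 1 1    ≈⟨ R.distribʳ (ψ m 1 1) ½ ½ ⟨
    (½ ⊕ ½) ⊛ ψ m 1 1            ≈⟨ R.*-congʳ (R.trans (ExponentialRing.½⊕½≈1 E) (R.sym (σ≈1 {+ (2 ℕ.* t) * + 0} (cong sgn (ℤₚ.*-zeroʳ (+ (2 ℕ.* t))))))) ⟩
    σ (+ (2 ℕ.* t) * + 0) ⊛ ψ m 1 1  ≈⟨ R.+-identityʳ _ ⟨
    σ (+ (2 ℕ.* t) * + 0) ⊛ ψ m 1 1 ⊕ 0# ∎
    where
    half : ∀ x y → + 2 * m * + x * + 2 ≡ (m * + 1 + + 2 * y) * + 4 → ½ ⊛ (e ((+ 2 * m * + x) ℚᵘ./ 4) ⊕ 0#) ≈ ½ ⊛ ψ m 1 1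
    half x y eq = R.*-congˡ (R.trans (R.+-identityʳ _) (R.trans (e.⟦⟧-cong (/-cross {+ 2 * m * + x} {m * + 1 + + 2 * y} {4} {2} eq)) (e-shift (m * + 1) y 2)))
    l₁ : ∀ m → + 2 * m * + 1 * + 2 ≡ (m * + 1 + + 2 * 0ℤ) * + 4
    l₁ = solve-∀
    l₂ : ∀ m → + 2 * m * + 3 * + 2 ≡ (m * + 1 + + 2 * m) * + 4
    l₂ = solve-∀

  -- The condition at n = 0 reflects the convention for modulus 2: for odd t the two halves on the
  -- left would cancel, while the right side is the single term e(m / 2).
  g-sum : ∀ m n t → (n ≡ 0 → ∃ λ r → t ≡ 2 ℕ.* r) →
    g 1ℤ m (suc n) ⊕ (⊖ 1#) ^ t ⊛ g -1ℤ m (suc n) ≈ ∑[ a ∈ upTo (2 ℕ.^ n) ] (σ (+ t * + a) ⊛ ψ m (1 ℕ.+ 2 ℕ.* a) (suc n))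
  g-sum m (suc n) t _ = g-sum-≥2 m n t
  g-sum m zero    t t-even with r , ≡.refl ← t-even ≡.refl = g-sum-1 m r

  -- Evaluation of the sum over double cosets

  δ-yes : ∀ {P : Set} (P? : Dec P) → P → δ P? ≈ 1#
  δ-yes P? p rewrite dec-true P? p = R.refl

  δ-no : ∀ {P : Set} (P? : Dec P) → ¬ P → δ P? ≈ 0#
  δ-no P? ¬p rewrite dec-false P? ¬p = R.refl

  ∑-0 : ∀ {A : Set} {f : A → Carrier} xs → (∀ {x} → x ∈ xs → f x ≈ 0#) → ∑ xs f ≈ 0#
  ∑-0 []       f≈0 = R.refl
  ∑-0 (x ∷ xs) f≈0 = R.trans (R.+-cong (f≈0 (here ≡.refl)) (∑-0 xs (f≈0 ∘ there))) (R.+-identityˡ 0#)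

  ∑-σ : ∀ n → ∑[ c ∈ upTo (2 ℕ.* n) ] σ (+ c) ≈ 0#
  ∑-σ n = R.trans (∑-upTo-2* (λ c → σ (+ c)) n) (∑-0 (upTo n) λ {c} _ → cancel c)
    where
    cancel : ∀ c → σ (+ (2 ℕ.* c)) ⊕ σ (+ (1 ℕ.+ 2 ℕ.* c)) ≈ 0#
    cancel c = R.trans (R.+-cong (σ≈1 {+ (2 ℕ.* c)} (-1^[2*n]≡1 c)) (σ≈-1 {+ (1 ℕ.+ 2 ℕ.* c)} (cong (-1ℤ *_) (-1^[2*n]≡1 c)))) (R.-‿inverseʳ 1#)

  module _ (n : ℕ) (m₁ m₂ : ℤ) where
    private
      k = suc n
      A : ℤ
      A = + (2 ℕ.^ k)
      instance
        A≢0 : ℤ.NonZero A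
        A≢0 = m^n≢0 2 k

    exponent : Key → ℤ
    exponent (i , a₁ , a₂ , c) = (+ 2 + + (n ∸ i)) * + a₁ + (1ℤ + + (n ∸ i)) * + a₂ + (1ℤ + + i + + (n ∸ i)) * + c

    Ψ : ℕ → ℕ → ℕ → Carrier
    Ψ i a₁ a₂ = ψ m₁ (1 ℕ.+ 2 ℕ.* a₁) (suc (n ∸ i)) ⊛ ψ m₂ (1 ℕ.+ 2 ℕ.* a₂) (suc i)

    term : Mat → Carrier
    term γ = fromℤ (s γ) ⊛ e (((m₁ ℚᵘ./ 1) ℚᵘ.* (B₁ γ // A)) ℚᵘ.+ ((m₂ ℚᵘ./ 1) ℚᵘ.* (B₂ γ // A)))

    keyTerm : Key → Carrier
    keyTerm q@(i , a₁ , a₂ , c) = σ (exponent q) ⊛ Ψ i a₁ a₂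

    term≈keyTerm : ∀ {γ q} → HasKey n γ q → term γ ≈ keyTerm q
    term≈keyTerm {γ} {i , a₁ , a₂ , c} (hasKey γ∈𝕊 q∈ O) = R.*-cong
      (R.reflexive (cong fromℤ (s-value-at n (n≡i+[n∸i] n i<) γ∈𝕊 O)))
      (R.trans (e.homo ((m₁ ℚᵘ./ 1) ℚᵘ.* (B₁ γ // A)) ((m₂ ℚᵘ./ 1) ℚᵘ.* (B₂ γ // A)))
        (R.*-cong (e-orbit m₁ i (n ∸ i) k (cong suc (n≡i+[n∸i] n i<)) a₁ (Orbit.x O) (Orbit.B₁-value O))
                  (e-orbit m₂ (n ∸ i) i k (cong suc (≡.trans (n≡i+[n∸i] n i<) (ℕₚ.+-comm i (n ∸ i)))) a₂ (Orbit.y O) (Orbit.B₂-value O))))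
      where
      i< : i ℕ.< suc n
      i< = proj₁ (∈-keys⁻ n q∈)
      -- Both n and n ∸ i are generalised to variables, so that the equation N ≡ i + j can be
      -- matched.
      s-value-at : ∀ N {j} → N ≡ i ℕ.+ j → let A = + (2 ℕ.^ suc N) in 𝕊 A A γ → Orbit (+ (2 ℕ.^ i)) (+ (2 ℕ.^ j)) A a₁ a₂ c γ →
        s γ ≡ sgn ((+ 2 + + j) * + a₁ + (1ℤ + + j) * + a₂ + (1ℤ + + i + + j) * + c)
      s-value-at _ {j} ≡.refl = s-Orbit i j γ

    -- Each summand depends only on the key of its representative, and the keys of the
    -- representatives are a permutation of `keys n`.
    Σ-over≈∑keys : ∀ {γs} → Representatives A A γs → Σ-over γs A A m₁ m₂ ≈ ∑ (keys n) keyTerm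
    Σ-over≈∑keys reps = R.trans (∑-pointwise term≈keyTerm (proj₂ (keysOf n reps))) (∑-↭ keyTerm (keysOf-↭ n reps))

    ∑keys≈ : ∑ (keys n) keyTerm ≈ ∑[ i ∈ upTo k ] ∑[ a₁ ∈ upTo (2 ℕ.^ (n ∸ i)) ] ∑[ a₂ ∈ upTo (2 ℕ.^ i) ] ∑[ c ∈ upTo (2 ℕ.^ k) ] keyTerm (i , a₁ , a₂ , c)
    ∑keys≈ = R.trans (∑-concatMap keyTerm (λ i → map (i ,_) (keysOver n i)) (upTo k)) (∑-cong (upTo k) λ i →
      R.trans (∑-map keyTerm (i ,_) (keysOver n i))
      (R.trans (∑-cartesianProduct (λ x → keyTerm (i , x)) (upTo (2 ℕ.^ (n ∸ i))) _) (∑-cong (upTo (2 ℕ.^ (n ∸ i))) λ a₁ →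
        ∑-cartesianProduct (λ x → keyTerm (i , a₁ , x)) (upTo (2 ℕ.^ i)) (upTo (2 ℕ.^ k)))))

    private
      +k≡ : ∀ {i} → i ∈ upTo k → 1ℤ + + i + + (n ∸ i) ≡ + k
      +k≡ i∈ = cong (λ m → + suc m) (≡.sym (n≡i+[n∸i] n (∈-upTo⁻ i∈)))

    G₁ G₂ : ℕ → Carrier
    G₁ i = g 1ℤ m₁ (k ∸ i) ⊕ (⊖ 1#) ^ (suc i) ⊛ g -1ℤ m₁ (k ∸ i)
    G₂ i = g 1ℤ m₂ (suc i) ⊕ (⊖ 1#) ^ i ⊛ g -1ℤ m₂ (suc i)

    -- Raising C₁ = 4 c - 1 by 4 changes the sign of s.
    ∑keys-odd : ∀ {l} → k ≡ 1 ℕ.+ 2 ℕ.* l → ∑ (keys n) keyTerm ≈ 0#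
    ∑keys-odd {l} k≡ = R.trans ∑keys≈ (∑-0 (upTo k) λ {i} i∈ → ∑-0 (upTo (2 ℕ.^ (n ∸ i))) λ {a₁} _ → ∑-0 (upTo (2 ℕ.^ i)) λ {a₂} _ → begin
      ∑[ c ∈ upTo (2 ℕ.^ k) ] keyTerm (i , a₁ , a₂ , c)                       ≈⟨ ∑-cong (upTo (2 ℕ.^ k)) (λ c → R.trans (R.*-congʳ (split i∈ a₁ a₂ c)) (R.*-assoc _ _ _)) ⟩
      ∑[ c ∈ upTo (2 ℕ.^ k) ] (σ (+ c) ⊛ (σ (rest i a₁ a₂) ⊛ Ψ i a₁ a₂))   ≈⟨ ∑-*ʳ (σ (rest i a₁ a₂) ⊛ Ψ i a₁ a₂) (λ c → σ (+ c)) (upTo (2 ℕ.^ k)) ⟩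
      (∑[ c ∈ upTo (2 ℕ.^ k) ] σ (+ c)) ⊛ (σ (rest i a₁ a₂) ⊛ Ψ i a₁ a₂)   ≈⟨ R.*-congʳ (∑-σ (2 ℕ.^ n)) ⟩
      0# ⊛ (σ (rest i a₁ a₂) ⊛ Ψ i a₁ a₂)                                     ≈⟨ R.zeroˡ _ ⟩
      0#                                                                      ∎)
      where
      rest : ℕ → ℕ → ℕ → ℤ
      rest i a₁ a₂ = (+ 2 + + (n ∸ i)) * + a₁ + (1ℤ + + (n ∸ i)) * + a₂
      lem : ∀ r l c → r + (1ℤ + + 2 * l) * c ≡ c + r + + 2 * (l * c)
      lem = solve-∀
      split : ∀ {i} → i ∈ upTo k → ∀ a₁ a₂ c → σ (exponent (i , a₁ , a₂ , c)) ≈ σ (+ c) ⊛ σ (rest i a₁ a₂)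
      split {i} i∈ a₁ a₂ c = begin
        σ (rest i a₁ a₂ + (1ℤ + + i + + (n ∸ i)) * + c)  ≈⟨ R.reflexive (cong (λ w → σ (rest i a₁ a₂ + w * + c)) (≡.trans (+k≡ i∈) (≡.trans (cong +_ k≡) (cong (λ w → 1ℤ + w) (ℤₚ.pos-* 2 l))))) ⟩
        σ (rest i a₁ a₂ + (1ℤ + + 2 * + l) * + c)        ≈⟨ R.reflexive (cong σ (lem (rest i a₁ a₂) (+ l) (+ c))) ⟩
        σ (+ c + rest i a₁ a₂ + + 2 * (+ l * + c))       ≈⟨ σ-+2* (+ c + rest i a₁ a₂) (+ l * + c) ⟩
        σ (+ c + rest i a₁ a₂)                           ≈⟨ σ-+ (+ c) (rest i a₁ a₂) ⟩
        σ (+ c) ⊛ σ (rest i a₁ a₂)                       ∎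

    -- With j = n ∸ i and 1 + i + j = k even, the coefficients 2 + j and 1 + j have the parities of
    -- 1 + i and i. The coefficient k of c is even, so the 2ᵏ values of c contribute the factor
    -- `fromℤ A`.
    ∑keys-even : ∀ {l} → k ≡ 2 ℕ.* l → ∑ (keys n) keyTerm ≈ fromℤ A ⊛ (∑[ i ∈ upTo k ] (G₁ i ⊛ G₂ i))
    ∑keys-even {l} k≡ = R.trans ∑keys≈ (R.trans (∑-cong-∈ (upTo k) λ {i} i∈ → begin
      ∑[ a₁ ∈ upTo (2 ℕ.^ (n ∸ i)) ] ∑[ a₂ ∈ upTo (2 ℕ.^ i) ] ∑[ c ∈ upTo (2 ℕ.^ k) ] keyTerm (i , a₁ , a₂ , c)
        ≈⟨ ∑-cong (upTo (2 ℕ.^ (n ∸ i))) (λ a₁ → ∑-cong (upTo (2 ℕ.^ i)) (λ a₂ → R.trans (∑-cong (upTo (2 ℕ.^ k)) (split i∈ a₁ a₂))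
             (R.trans (∑-const (h₁ i a₁ ⊛ h₂ i a₂) (upTo (2 ℕ.^ k))) (R.*-congʳ (R.reflexive (cong (λ m → fromℤ (+ m)) (length-upTo (2 ℕ.^ k)))))))) ⟩
      ∑[ a₁ ∈ upTo (2 ℕ.^ (n ∸ i)) ] ∑[ a₂ ∈ upTo (2 ℕ.^ i) ] (fromℤ A ⊛ (h₁ i a₁ ⊛ h₂ i a₂))
        ≈⟨ ∑-cong (upTo (2 ℕ.^ (n ∸ i))) (λ a₁ → R.trans (∑-*ˡ (fromℤ A) (λ a₂ → h₁ i a₁ ⊛ h₂ i a₂) (upTo (2 ℕ.^ i))) (R.*-congˡ (∑-*ˡ (h₁ i a₁) (h₂ i) (upTo (2 ℕ.^ i))))) ⟩
      ∑[ a₁ ∈ upTo (2 ℕ.^ (n ∸ i)) ] (fromℤ A ⊛ (h₁ i a₁ ⊛ ∑ (upTo (2 ℕ.^ i)) (h₂ i)))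
        ≈⟨ R.trans (∑-*ˡ (fromℤ A) (λ a₁ → h₁ i a₁ ⊛ ∑ (upTo (2 ℕ.^ i)) (h₂ i)) (upTo (2 ℕ.^ (n ∸ i)))) (R.*-congˡ (∑-*ʳ (∑ (upTo (2 ℕ.^ i)) (h₂ i)) (h₁ i) (upTo (2 ℕ.^ (n ∸ i))))) ⟩
      fromℤ A ⊛ (∑ (upTo (2 ℕ.^ (n ∸ i))) (h₁ i) ⊛ ∑ (upTo (2 ℕ.^ i)) (h₂ i))
        ≈⟨ R.*-congˡ (R.*-cong (R.sym (G₁≈ i∈)) (R.sym (g-sum m₂ i i λ { ≡.refl → 0 , ≡.refl }))) ⟩
      fromℤ A ⊛ (G₁ i ⊛ G₂ i) ∎) (∑-*ˡ (fromℤ A) (λ i → G₁ i ⊛ G₂ i) (upTo k)))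
      where
      h₁ h₂ : ℕ → ℕ → Carrier
      h₁ i a₁ = σ (+ suc i * + a₁) ⊛ ψ m₁ (1 ℕ.+ 2 ℕ.* a₁) (suc (n ∸ i))
      h₂ i a₂ = σ (+ i * + a₂) ⊛ ψ m₂ (1 ℕ.+ 2 ℕ.* a₂) (suc i)
      G₁≈ : ∀ {i} → i ∈ upTo k → G₁ i ≈ ∑ (upTo (2 ℕ.^ (n ∸ i))) (h₁ i)
      G₁≈ {i} i∈ = R.trans (R.reflexive (cong (λ m → g 1ℤ m₁ m ⊕ (⊖ 1#) ^ (suc i) ⊛ g -1ℤ m₁ m) (ℕₚ.+-∸-assoc 1 (ℕ.s≤s⁻¹ (∈-upTo⁻ i∈)))))
        -- If n ∸ i = 0, then `suc i` is k and hence even, as `g-sum` demands at modulus 2.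
        (g-sum m₁ (n ∸ i) (suc i) λ n∸i≡0 → l , ≡.trans (cong suc (≡.trans (≡.sym (ℕₚ.+-identityʳ i)) (≡.trans (cong (i ℕ.+_) (≡.sym n∸i≡0)) (≡.sym (n≡i+[n∸i] n (∈-upTo⁻ i∈)))))) k≡)
      lem : ∀ i j l a₁ a₂ c → 1ℤ + i + j ≡ + 2 * l →
        (+ 2 + j) * a₁ + (1ℤ + j) * a₂ + (1ℤ + i + j) * c ≡ (1ℤ + i) * a₁ + i * a₂ + + 2 * ((l - i) * a₁ + (l - i) * a₂ + l * c)
      lem i j l a₁ a₂ c eq = ≡.trans (lem₁ i j a₁ a₂ c) (≡.trans (cong (λ w → (1ℤ + w - i) * a₁ + (w - i) * a₂ + w * c) eq) (lem₂ i l a₁ a₂ c))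
        where
        lem₁ : ∀ i j a₁ a₂ c → (+ 2 + j) * a₁ + (1ℤ + j) * a₂ + (1ℤ + i + j) * c ≡ (1ℤ + (1ℤ + i + j) - i) * a₁ + ((1ℤ + i + j) - i) * a₂ + (1ℤ + i + j) * c
        lem₁ = solve-∀
        lem₂ : ∀ i l a₁ a₂ c → (1ℤ + + 2 * l - i) * a₁ + (+ 2 * l - i) * a₂ + + 2 * l * c ≡ (1ℤ + i) * a₁ + i * a₂ + + 2 * ((l - i) * a₁ + (l - i) * a₂ + l * c)
        lem₂ = solve-∀
      split : ∀ {i} → i ∈ upTo k → ∀ a₁ a₂ c → keyTerm (i , a₁ , a₂ , c) ≈ h₁ i a₁ ⊛ h₂ i a₂
      split {i} i∈ a₁ a₂ c = R.trans (R.*-congʳ (begin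
        σ (exponent (i , a₁ , a₂ , c))
          ≈⟨ R.reflexive (cong σ (lem (+ i) (+ (n ∸ i)) (+ l) (+ a₁) (+ a₂) (+ c) (≡.trans (+k≡ i∈) (≡.trans (cong +_ k≡) (ℤₚ.pos-* 2 l))))) ⟩
        σ ((1ℤ + + i) * + a₁ + + i * + a₂ + + 2 * ((+ l - + i) * + a₁ + (+ l - + i) * + a₂ + + l * + c))
          ≈⟨ σ-+2* ((1ℤ + + i) * + a₁ + + i * + a₂) _ ⟩
        σ ((1ℤ + + i) * + a₁ + + i * + a₂)
          ≈⟨ σ-+ ((1ℤ + + i) * + a₁) (+ i * + a₂) ⟩
        σ ((1ℤ + + i) * + a₁) ⊛ σ (+ i * + a₂) ∎)) (*-interchange _ _ _ _)

    Σ-over≈ : ∀ {γs} → Representatives A A γs → Σ-over γs A A m₁ m₂ ≈ fromℤ A ⊛ δ (2 ∣? k) ⊛ (∑[ i ∈ upTo k ] (G₁ i ⊛ G₂ i))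
    Σ-over≈ reps = R.trans (Σ-over≈∑keys reps) (byParity (2 ∣? k))
      where
      S = ∑[ i ∈ upTo k ] (G₁ i ⊛ G₂ i)
      byParity : Dec (2 ℕ∣.∣ k) → ∑ (keys n) keyTerm ≈ fromℤ A ⊛ δ (2 ∣? k) ⊛ S
      byParity (yes 2∣k) = R.trans (∑keys-even {ℕ∣.quotient 2∣k} (≡.trans (ℕ∣._∣_.equality 2∣k) (ℕₚ.*-comm (ℕ∣.quotient 2∣k) 2)))
        (R.*-congʳ (R.sym (R.trans (R.*-congˡ (δ-yes (2 ∣? k) 2∣k)) (R.*-identityʳ (fromℤ A)))))
      byParity (no 2∤k) = R.trans (∑keys-odd {proj₁ k-odd} (proj₂ k-odd))
        (R.sym (R.trans (R.*-congʳ (R.trans (R.*-congˡ (δ-no (2 ∣? k) 2∤k)) (R.zeroʳ (fromℤ A)))) (R.zeroˡ S)))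
        where
        k-odd = 2∤⇒odd k 2∤k

proposition26 : {c ℓ : Level} (E : ExponentialRing c ℓ) → let open ExponentialSums E in
    (k : ℕ) → .{{_ : NonZero k}} → (m₁ m₂ : ℤ) →
    let instance _ = m^n≢0 2 k in
    Σ⟨ + (2 ^ℕ k) , + (2 ^ℕ k) ⨾ m₁ , m₂ ⟩≈
    (fromℤ (+ (2 ^ℕ k)) ⊛ δ (2 ∣? k) ⊛
    (∑[ i ∈ upTo k ]
    (g 1ℤ m₁ (k ∸ i) ⊕ (⊖ 1#) ^ (suc i) ⊛ g -1ℤ m₁ (k ∸ i))
    ⊛ (g 1ℤ m₂ (suc i) ⊕ (⊖ 1#) ^ i ⊛ g -1ℤ m₂ (suc i))))
proposition26 E (suc n) m₁ m₂ = representatives n , λ γs reps → Σ-over≈ E n m₁ m₂ reps
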